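{- Let $F$ be a strictly finite 1-sorted species and $G=G(X,Y)$ a 2-sorted species, and let $F\boxtimes_Y G$ be their inner plethysm in $Y$. Fix $n\ge 0$ and define a function $\chi$ on $\mathfrak{S}_n$, with values in the ring of symmetric functions in $x_1,x_2,\dots$, by $$\chi(\sigma)=\mathrm{fix}_w\,G_{X[Y]}(\mathbb{P}_x,\sigma)=\sum_{\lambda}\mathrm{fix}\,G[\lambda,\mu]\,\frac{p_\lambda(x)}{z_\lambda},$$ where $\mu$ is the cycle type of $\sigma$ and $\lambda$ runs over all partitions. Then for every $\sigma\in\mathfrak{S}_n$, $$\mathrm{fix}_w\,(F\boxtimes_Y G)_{X[Y]}(\mathbb{P}_x,\sigma)=Z_F[\chi](\sigma).$$
   Context: $\mathbb{B}$ is the category of finite sets and bijections; a 1-sorted species is a functor $\mathbb{B}\to\mathbb{B}$ and a 2-sorted species is a functor $\mathbb{B}^2\to\mathbb{B}$. $[n]=\{1,\dots,n\}$, $F[n]=F[[n]]$, and $F$ is strictly finite if $F[n]=\emptyset$ for all large $n$. For a commutative ring $R\supseteq\mathbb{Q}$ (with a notion of convergent infinite sums), $\mathrm{Sets}_R$ is the category of pairs $(A,w)$, $A$ a set and $w:A\to R$ a weight function such that $\sum_{a\in A}w(a)$ exists in $R$, with weight-preserving functions as morphisms. Here $R=\mathbb{Q}[[x_1,x_2,\dots]]$, and $\mathbb{P}_x$ is the set of positive integers with $w(i)=x_i$. For $A\in\mathrm{Sets}_R$ and a function $f:[m]\to A$, $w(f)=w(f(1))\cdots w(f(m))$. The analytic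 functor in $X$ of a 2-sorted species $G$ is $G_{X[Y]}(A,B)=\sum_{m\ge0}\bigl(G[m,B]\times A^m\bigr)/\mathfrak{S}_m$ for $A\in\mathrm{Sets}_R$ and $B$ a finite set, where $\mathfrak{S}_m$ acts by $\tau\cdot(t,f)=(G[\tau,1_B](t),f\circ\tau^{ -1})$ and the orbit of $(t,f)$ has weight $w(f)$; bijections of $B$ act through $G$. For a permutation $\sigma$ of $[n]$, $\mathrm{fix}_w\,G_{X[Y]}(\mathbb{P}_x,\sigma)$ is the sum of the weights of the elements of $G_{X[Y]}(\mathbb{P}_x,[n])$ fixed by $\sigma$. The analytic functor of a 1-sorted species $F$ is $F(A)=\sum_{m\ge0}(F[m]\times A^m)/\mathfrak{S}_m$ for $A\in\mathrm{Sets}_R$, with action $\tau\cdot(t,f)=(F[\tau](t),f\circ\tau^{ -1})$ and the orbit of $(t,f)$ having weight $w(f)$. The inner plethysm in $Y$, $F\boxtimes_Y G$, is the 2-sorted species $H$ with $H_{X[Y]}(A,B)\cong F(G_{X[Y]}(A,B))$ naturally in $A,B$. $\mathrm{fix}\,F[\lambda]$ is the number of fixed points of $F[\sigma]$ for $\sigma$ of cycle type $\lambda$; $\mathrm{fix}\,G[\lambda,\mu]$ is the number of fixed points of $G[\tau,\sigma]$ for $\tau,\sigma$ of cycle types $\lambda,\mu$. $Z_F=\sum_\lambda\mathrm{fix}\,F[\lambda]\frac{p_\lambda}{z_\lambda}$, where $p_\lambda$ are power sums and $z_\lambda=\prod_i i^{m_i}m_i!$ for $\lambda=(1^{m_1}2^{m_2}\cdots)$;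 $p_\lambda(x)$ is $p_\lambda$ in the variables $x_1,x_2,\dots$. Class functions $c$ on $\mathfrak{S}_n$ with values in symmetric functions in the $x_i$ (possibly of unbounded degree) form a ring under pointwise operations, with Adams operations $(\psi^k c)(\sigma)=p_k\circ\bigl(c(\sigma^k)\bigr)$, where $p_k\circ g$ is obtained from $g$ by replacing every $x_j$ with $x_j^k$. For a symmetric function $f$ of bounded degree, $f[\chi]$ is obtained by writing $f$ as a polynomial in the $p_k$ and substituting $\psi^k(\chi)$ for $p_k$. -}

module Defs where

open import Algebra.Bundles using (CommutativeMonoid; RawMonoid)
import Algebra.Definitions.RawMonoid as RawMonoidDefinitions
import Algebra.Properties.CommutativeMonoid.Sum as CommutativeMonoidSum
import Algebra.Properties.CommutativeSemigroup as CommutativeSemigroupProperties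
open import Data.Bool.Base using (Bool; true; false; if_then_else_; _∧_)
open import Data.Bool.Properties using (∧-zeroʳ; ∧-identityʳ)
open import Data.Fin.Base using (Fin; zero; suc; fromℕ)
import Data.Fin.Properties as Fin
open import Data.Fin.Permutation using (Permutation; Permutation′; _⟨$⟩ʳ_; _⟨$⟩ˡ_; _∘ₚ_; insert)
import Data.Fin.Permutation as Perm
import Data.Integer.Base as ℤ
open import Data.List.Base using (List; []; _∷_; _∷ʳ_; _++_; map; foldr; filter; length; replicate; concatMap; upTo; allFin; applyUpTo)
import Data.List.Membership.Setoid as SetoidMembership
import Data.List.Membership.Propositional.Properties as Membership
open import Data.List.Properties using (map-applyUpTo)
open import Data.List.Relation.Binary.Permutation.Propositional using (_↭_)
open import Data.List.Relation.Unary.All using (All; []; _∷_)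
import Data.List.Relation.Unary.All.Properties as All
open import Data.List.Relation.Unary.Linked using (Linked)
import Data.List.Relation.Unary.Unique.Setoid as SetoidUnique
import Data.List.Relation.Unary.Unique.Propositional.Properties as Unique
open import Data.Nat.Base as ℕ using (ℕ; zero; suc; _∸_; _^_; _!; _≤_; _<_; _≥_; _≡ᵇ_; NonZero)
open import Data.Nat.Divisibility using (_∣?_; divides)
open import Data.Nat.ListAction using (sum; product)
open import Data.Nat.ListAction.Properties using (sum-++; product≢0)
import Data.Nat.Properties as ℕ
open import Data.Product.Base using (Σ; Σ-syntax; _×_; _,_; proj₁; proj₂)
open import Data.Rational.Base using (ℚ; 0ℚ; 1ℚ; _+_; _*_; _/_)
open import Data.Rational.Properties using (+-assoc; +-comm; +-identityˡ; +-identityʳ; *-assoc; *-comm; *-identityˡ; *-zeroˡ; *-distribʳ-+; +-0-commutativeMonoid)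
open import Data.Sum.Function.Propositional using (_⊎-↔_)
open import Function.Base using (_∘_; id)
open import Function.Bundles using (Func; Inverse; _↔_)
open import Function.Construct.Composition using (_↔-∘_)
open import Function.Construct.Identity using (↔-id)
open import Function.Construct.Symmetry using (↔-sym)
open import Level using (0ℓ)
open import Relation.Binary.Bundles using (Setoid)
import Relation.Binary.Construct.On as On
open import Relation.Binary.PropositionalEquality as ≡ using (_≡_; _≢_; refl; sym; trans; cong; cong₂; module ≡-Reasoning)
open import Relation.Nullary.Decidable using (yes; no)
open import Relation.Nullary.Negation using (¬_; contradiction)

open CommutativeSemigroupProperties (CommutativeMonoid.commutativeSemigroup +-0-commutativeMonoid) using (interchange)

indicator : Bool → ℚ
indicator b = if b then 1ℚ else 0ℚ

sumℚ : List ℚ → ℚ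
sumℚ = foldr _+_ 0ℚ

-- ℚ[[x₀,x₁,x₂,…]]: coeff (a₀ ∷ a₁ ∷ … ∷ aᵣ ∷ []) is the coefficient of x₀^a₀ x₁^a₁ ⋯ xᵣ^aᵣ.
-- An exponent list stands for the same monomial as its extension by a
-- trailing zero, whence the second field.
record Series : Set where
  field
    coeff    : List ℕ → ℚ
    coherent : ∀ α → coeff (α ∷ʳ 0) ≡ coeff α

open Series public

infix 4 _≈ₛ_

_≈ₛ_ : Series → Series → Set
f ≈ₛ g = ∀ α → coeff f α ≡ coeff g α

-- Invariance under every permutation of finitely many variables.
Symmetric : Series → Set
Symmetric f = ∀ {α β} → α ↭ β → coeff f α ≡ coeff f β

sum-∷ʳ0 : ∀ α → sum (α ∷ʳ 0) ≡ sum α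
sum-∷ʳ0 α = trans (sum-++ α (0 ∷ [])) (ℕ.+-identityʳ (sum α))

0ₛ 1ₛ : Series
0ₛ = record { coeff = λ _ → 0ℚ ; coherent = λ _ → refl }
1ₛ = record
  { coeff    = λ α → indicator (sum α ≡ᵇ 0)
  ; coherent = λ α → cong (λ d → indicator (d ≡ᵇ 0)) (sum-∷ʳ0 α)
  }

infixl 6 _+ₛ_
infixl 7 _*ₛ_
infixr 7 _•_

_+ₛ_ : Series → Series → Series
f +ₛ g = record
  { coeff    = λ α → coeff f α + coeff g α
  ; coherent = λ α → cong₂ _+_ (coherent f α) (coherent g α)
  }

_•_ : ℚ → Series → Series
c • f = record
  { coeff    = λ α → c * coeff f α
  ; coherent = λ α → cong (c *_) (coherent f α)
  }

-- antidiag a h = Σ_{i+j=a} h i j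
antidiag : ℕ → (ℕ → ℕ → ℚ) → ℚ
antidiag zero    h = h 0 0
antidiag (suc a) h = h 0 (suc a) + antidiag a (λ i j → h (suc i) j)

-- conv f g α = Σ_{β+γ=α} f β * g γ
conv : (f g : List ℕ → ℚ) → List ℕ → ℚ
conv f g []      = f [] * g []
conv f g (a ∷ α) = antidiag a λ i j → conv (f ∘ (i ∷_)) (g ∘ (j ∷_)) α

antidiag-cong : ∀ a {h h′ : ℕ → ℕ → ℚ} → (∀ i j → h i j ≡ h′ i j) → antidiag a h ≡ antidiag a h′
antidiag-cong zero    eq = eq 0 0
antidiag-cong (suc a) eq = cong₂ _+_ (eq 0 (suc a)) (antidiag-cong a (λ i j → eq (suc i) j))

antidiag-0 : ∀ a → antidiag a (λ _ _ → 0ℚ) ≡ 0ℚ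
antidiag-0 zero    = refl
antidiag-0 (suc a) = trans (+-identityˡ _) (antidiag-0 a)

antidiag-+ : ∀ a (h h′ : ℕ → ℕ → ℚ) → antidiag a (λ i j → h i j + h′ i j) ≡ antidiag a h + antidiag a h′
antidiag-+ zero    h h′ = refl
antidiag-+ (suc a) h h′ = trans
  (cong ((h 0 (suc a) + h′ 0 (suc a)) +_) (antidiag-+ a (λ i j → h (suc i) j) (λ i j → h′ (suc i) j)))
  (interchange (h 0 (suc a)) (h′ 0 (suc a)) _ _)

antidiag-last : ∀ a (h : ℕ → ℕ → ℚ) → antidiag (suc a) h ≡ antidiag a (λ i j → h i (suc j)) + h (suc a) 0
antidiag-last zero    h = refl
antidiag-last (suc a) h = trans
  (cong (h 0 (suc (suc a)) +_) (antidiag-last a (λ i j → h (suc i) j)))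
  (sym (+-assoc (h 0 (suc (suc a))) _ _))

antidiag-comm : ∀ a (h : ℕ → ℕ → ℚ) → antidiag a h ≡ antidiag a (λ i j → h j i)
antidiag-comm zero    h = refl
antidiag-comm (suc a) h = begin
  h 0 (suc a) + antidiag a (λ i j → h (suc i) j)  ≡⟨ cong (h 0 (suc a) +_) (antidiag-comm a (λ i j → h (suc i) j)) ⟩
  h 0 (suc a) + antidiag a (λ i j → h (suc j) i)  ≡⟨ +-comm (h 0 (suc a)) _ ⟩
  antidiag a (λ i j → h (suc j) i) + h 0 (suc a)  ≡⟨ antidiag-last a (λ i j → h j i) ⟨
  antidiag (suc a) (λ i j → h j i)                ∎
  where open ≡-Reasoning

antidiag-assoc : ∀ a (h : ℕ → ℕ → ℕ → ℚ) →
  antidiag a (λ s l → antidiag s (λ i j → h i j l)) ≡ antidiag a (λ i s → antidiag s (h i))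
antidiag-assoc zero    h = refl
antidiag-assoc (suc a) h = begin
  h 0 0 (suc a) + antidiag a (λ s l → h 0 (suc s) l + antidiag s (λ i j → h (suc i) j l))
    ≡⟨ cong (h 0 0 (suc a) +_) (antidiag-+ a _ _) ⟩
  h 0 0 (suc a) + (antidiag a (λ s l → h 0 (suc s) l) + antidiag a (λ s l → antidiag s (λ i j → h (suc i) j l)))
    ≡⟨ +-assoc (h 0 0 (suc a)) _ _ ⟨
  antidiag (suc a) (h 0) + antidiag a (λ s l → antidiag s (λ i j → h (suc i) j l))
    ≡⟨ cong (antidiag (suc a) (h 0) +_) (antidiag-assoc a (λ i → h (suc i))) ⟩
  antidiag (suc a) (h 0) + antidiag a (λ i s → antidiag s (h (suc i))) ∎
  where open ≡-Reasoning

conv-cong : ∀ {f f′ g g′ : List ℕ → ℚ} → (∀ α → f α ≡ f′ α) → (∀ α → g α ≡ g′ α) →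
  ∀ α → conv f g α ≡ conv f′ g′ α
conv-cong p q []      = cong₂ _*_ (p []) (q [])
conv-cong p q (a ∷ α) = antidiag-cong a (λ i j → conv-cong (p ∘ (i ∷_)) (q ∘ (j ∷_)) α)

conv-coherent : ∀ {f g : List ℕ → ℚ} → (∀ α → f (α ∷ʳ 0) ≡ f α) → (∀ α → g (α ∷ʳ 0) ≡ g α) →
  ∀ α → conv f g (α ∷ʳ 0) ≡ conv f g α
conv-coherent p q []      = cong₂ _*_ (p []) (q [])
conv-coherent p q (a ∷ α) = antidiag-cong a (λ i j → conv-coherent (p ∘ (i ∷_)) (q ∘ (j ∷_)) α)

conv-comm : ∀ (f g : List ℕ → ℚ) α → conv f g α ≡ conv g f α
conv-comm f g []      = *-comm (f []) (g [])
conv-comm f g (a ∷ α) = trans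
  (antidiag-comm a (λ i j → conv (f ∘ (i ∷_)) (g ∘ (j ∷_)) α))
  (antidiag-cong a (λ i j → conv-comm (f ∘ (j ∷_)) (g ∘ (i ∷_)) α))

conv-zeroˡ : ∀ (g : List ℕ → ℚ) α → conv (λ _ → 0ℚ) g α ≡ 0ℚ
conv-zeroˡ g []      = *-zeroˡ (g [])
conv-zeroˡ g (a ∷ α) = trans (antidiag-cong a (λ i j → conv-zeroˡ (g ∘ (j ∷_)) α)) (antidiag-0 a)

conv-distribʳ : ∀ (f f′ g : List ℕ → ℚ) α → conv (λ β → f β + f′ β) g α ≡ conv f g α + conv f′ g α
conv-distribʳ f f′ g []      = *-distribʳ-+ (g []) (f []) (f′ [])
conv-distribʳ f f′ g (a ∷ α) = trans
  (antidiag-cong a (λ i j → conv-distribʳ (f ∘ (i ∷_)) (f′ ∘ (i ∷_)) (g ∘ (j ∷_)) α))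
  (antidiag-+ a _ _)

conv-antidiagˡ : ∀ a (h : ℕ → ℕ → List ℕ → ℚ) g α →
  conv (λ β → antidiag a (λ i j → h i j β)) g α ≡ antidiag a (λ i j → conv (h i j) g α)
conv-antidiagˡ zero    h g α = refl
conv-antidiagˡ (suc a) h g α = trans
  (conv-distribʳ (h 0 (suc a)) (λ β → antidiag a (λ i j → h (suc i) j β)) g α)
  (cong (conv (h 0 (suc a)) g α +_) (conv-antidiagˡ a (λ i j → h (suc i) j) g α))

conv-antidiagʳ : ∀ a (h : ℕ → ℕ → List ℕ → ℚ) f α →
  conv f (λ β → antidiag a (λ i j → h i j β)) α ≡ antidiag a (λ i j → conv f (h i j) α)
conv-antidiagʳ a h f α = begin
  conv f (λ β → antidiag a (λ i j → h i j β)) α  ≡⟨ conv-comm f _ α ⟩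
  conv (λ β → antidiag a (λ i j → h i j β)) f α  ≡⟨ conv-antidiagˡ a h f α ⟩
  antidiag a (λ i j → conv (h i j) f α)          ≡⟨ antidiag-cong a (λ i j → conv-comm (h i j) f α) ⟩
  antidiag a (λ i j → conv f (h i j) α)          ∎
  where open ≡-Reasoning

conv-assoc : ∀ (f g h : List ℕ → ℚ) α → conv (conv f g) h α ≡ conv f (conv g h) α
conv-assoc f g h []      = *-assoc (f []) (g []) (h [])
conv-assoc f g h (a ∷ α) = begin
  antidiag a (λ s l → conv (λ β → antidiag s (λ i j → conv (f ∘ (i ∷_)) (g ∘ (j ∷_)) β)) (h ∘ (l ∷_)) α)
    ≡⟨ antidiag-cong a (λ s l → conv-antidiagˡ s (λ i j → conv (f ∘ (i ∷_)) (g ∘ (j ∷_))) (h ∘ (l ∷_)) α) ⟩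
  antidiag a (λ s l → antidiag s (λ i j → conv (conv (f ∘ (i ∷_)) (g ∘ (j ∷_))) (h ∘ (l ∷_)) α))
    ≡⟨ antidiag-assoc a (λ i j l → conv (conv (f ∘ (i ∷_)) (g ∘ (j ∷_))) (h ∘ (l ∷_)) α) ⟩
  antidiag a (λ i s → antidiag s (λ j l → conv (conv (f ∘ (i ∷_)) (g ∘ (j ∷_))) (h ∘ (l ∷_)) α))
    ≡⟨ antidiag-cong a (λ i s → antidiag-cong s (λ j l → conv-assoc (f ∘ (i ∷_)) (g ∘ (j ∷_)) (h ∘ (l ∷_)) α)) ⟩
  antidiag a (λ i s → antidiag s (λ j l → conv (f ∘ (i ∷_)) (conv (g ∘ (j ∷_)) (h ∘ (l ∷_))) α))
    ≡⟨ antidiag-cong a (λ i s → conv-antidiagʳ s (λ j l → conv (g ∘ (j ∷_)) (h ∘ (l ∷_))) (f ∘ (i ∷_)) α) ⟨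
  antidiag a (λ i s → conv (f ∘ (i ∷_)) (λ β → antidiag s (λ j l → conv (g ∘ (j ∷_)) (h ∘ (l ∷_)) β)) α) ∎
  where open ≡-Reasoning

conv-identityˡ : ∀ (g : List ℕ → ℚ) α → conv (coeff 1ₛ) g α ≡ g α
conv-identityˡ g []            = *-identityˡ (g [])
conv-identityˡ g (zero ∷ α)    = conv-identityˡ (g ∘ (0 ∷_)) α
conv-identityˡ g (a@(suc b) ∷ α) = begin
  conv (coeff 1ₛ) (g ∘ (a ∷_)) α + antidiag b (λ _ j → conv (λ _ → 0ℚ) (g ∘ (j ∷_)) α)
    ≡⟨ cong₂ _+_ (conv-identityˡ (g ∘ (a ∷_)) α)
                 (trans (antidiag-cong b (λ _ j → conv-zeroˡ (g ∘ (j ∷_)) α)) (antidiag-0 b)) ⟩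
  g (a ∷ α) + 0ℚ
    ≡⟨ +-identityʳ _ ⟩
  g (a ∷ α) ∎
  where open ≡-Reasoning

_*ₛ_ : Series → Series → Series
f *ₛ g = record
  { coeff    = conv (coeff f) (coeff g)
  ; coherent = conv-coherent (coherent f) (coherent g)
  }

≈ₛ-setoid : Setoid 0ℓ 0ℓ
≈ₛ-setoid = record
  { Carrier       = Series
  ; _≈_           = _≈ₛ_
  ; isEquivalence = record
    { refl  = λ _ → refl
    ; sym   = λ p α → sym (p α)
    ; trans = λ p q α → trans (p α) (q α)
    }
  }

*ₛ-1ₛ-commutativeMonoid : CommutativeMonoid 0ℓ 0ℓ
*ₛ-1ₛ-commutativeMonoid = record
  { Carrier             = Series
  ; _≈_                 = _≈ₛ_
  ; _∙_                 = _*ₛ_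
  ; ε                   = 1ₛ
  ; isCommutativeMonoid = record
    { isMonoid = record
      { isSemigroup = record
        { isMagma = record
          { isEquivalence = Setoid.isEquivalence ≈ₛ-setoid
          ; ∙-cong        = λ p q → conv-cong p q
          }
        ; assoc = λ f g h → conv-assoc (coeff f) (coeff g) (coeff h)
        }
      ; identity = (λ f → conv-identityˡ (coeff f))
                 , (λ f α → trans (conv-comm (coeff f) (coeff 1ₛ) α) (conv-identityˡ (coeff f) α))
      }
    ; comm = λ f g → conv-comm (coeff f) (coeff g)
    }
  }

module Product = CommutativeMonoidSum *ₛ-1ₛ-commutativeMonoid

∏ : ∀ {m} → (Fin m → Series) → Series
∏ = Product.sum

sumₛ productₛ : List Series → Series
sumₛ     = foldr _+ₛ_ 0ₛ
productₛ = foldr _*ₛ_ 1ₛ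

exponent : List ℕ → ℕ → ℕ
exponent []      _       = 0
exponent (a ∷ α) zero    = a
exponent (a ∷ α) (suc j) = exponent α j

exponent-∷ʳ0 : ∀ α j → exponent (α ∷ʳ 0) j ≡ exponent α j
exponent-∷ʳ0 []      zero    = refl
exponent-∷ʳ0 []      (suc j) = refl
exponent-∷ʳ0 (a ∷ α) zero    = refl
exponent-∷ʳ0 (a ∷ α) (suc j) = exponent-∷ʳ0 α j

x : ℕ → Series
x j = record
  { coeff    = λ α → indicator ((sum α ≡ᵇ 1) ∧ (exponent α j ≡ᵇ 1))
  ; coherent = λ α → cong₂ (λ d e → indicator ((d ≡ᵇ 1) ∧ (e ≡ᵇ 1))) (sum-∷ʳ0 α) (exponent-∷ʳ0 α j)
  }

-- Σⱼ xⱼ, the sum of all monomials of degree 1.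
Σx : Series
Σx = record
  { coeff    = λ α → indicator (sum α ≡ᵇ 1)
  ; coherent = λ α → cong (λ d → indicator (d ≡ᵇ 1)) (sum-∷ʳ0 α)
  }

-- The coefficient of x^α in g(x₀^k, x₁^k, …): that of x^(α/k) in g if k
-- divides every exponent, and 0 otherwise.
dilateCoeff : ℕ → (List ℕ → ℚ) → List ℕ → ℚ
dilateCoeff k g []      = g []
dilateCoeff k g (a ∷ α) with k ∣? a
... | yes (divides q _) = dilateCoeff k (g ∘ (q ∷_)) α
... | no  _             = 0ℚ

dilateCoeff-coherent : ∀ k {g : List ℕ → ℚ} → (∀ α → g (α ∷ʳ 0) ≡ g α) →
  ∀ α → dilateCoeff k g (α ∷ʳ 0) ≡ dilateCoeff k g α
dilateCoeff-coherent zero      p []      = p []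
dilateCoeff-coherent k@(suc _) p []      with k ∣? 0
... | yes (divides zero _) = p []
... | no  ∤0               = contradiction (divides 0 refl) ∤0
dilateCoeff-coherent k p (a ∷ α) with k ∣? a
... | yes (divides q _) = dilateCoeff-coherent k (p ∘ (q ∷_)) α
... | no  _             = refl

-- p_k ∘ g: every xⱼ is replaced by xⱼ^k (used for k ≥ 1 only).
dilate : ℕ → Series → Series
dilate k g = record
  { coeff    = dilateCoeff k (coeff g)
  ; coherent = dilateCoeff-coherent k (coherent g)
  }

record WeightedSet : Set₁ where
  field
    setoid : Setoid 0ℓ 0ℓ
  open Setoid setoid public using (Carrier; _≈_)
  field
    weight      : Carrier → Series
    weight-cong : ∀ {a b} → a ≈ b → weight a ≈ₛ weight b

infix 4 _HasSum_

-- The weights of A are summable with sum s: for each monomial α, only finitely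
-- many elements (up to ≈, all of them in the list) have a weight in which α
-- occurs, and their coefficients add up to that of s.
_HasSum_ : WeightedSet → Series → Set
A HasSum s = ∀ α → Σ[ as ∈ List A.Carrier ]
    Unique as
  × (∀ a → coeff (A.weight a) α ≢ 0ℚ → a ∈ as)
  × coeff s α ≡ sumℚ (map (λ a → coeff (A.weight a) α) as)
  where
  module A = WeightedSet A
  open SetoidMembership A.setoid using (_∈_)
  open SetoidUnique A.setoid using (Unique)

-- The objects of Sets_R for R = ℚ[[x₀,x₁,…]].
record SetsR : Set₁ where
  field
    weightedSet : WeightedSet
    total       : Series
    hasTotal    : weightedSet HasSum total

open SetsR public using (weightedSet)

infix 4 _⇒_ _≅_

record _⇒_ (A B : WeightedSet) : Set where
  private
    module A = WeightedSet A
    module B = WeightedSet B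
  field
    func      : Func A.setoid B.setoid
  open Func func public using (to) renaming (cong to to-cong)
  field
    preserves : ∀ a → B.weight (to a) ≈ₛ A.weight a

record _≅_ (A B : WeightedSet) : Set where
  private
    module A = WeightedSet A
    module B = WeightedSet B
  field
    inverse   : Inverse A.setoid B.setoid
  open Inverse inverse public using (to; from)
  field
    preserves : ∀ a → B.weight (to a) ≈ₛ A.weight a

⇒-id : ∀ {A} → A ⇒ A
⇒-id = record
  { func      = record { to = id ; cong = id }
  ; preserves = λ _ _ → refl
  }

Fixed : ∀ {A} → A ⇒ A → WeightedSet
Fixed {A} e = record
  { setoid      = On.setoid {B = Σ[ a ∈ A.Carrier ] _⇒_.to e a A.≈ a} A.setoid proj₁
  ; weight      = A.weight ∘ proj₁
  ; weight-cong = A.weight-cong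
  }
  where module A = WeightedSet A

sumℚ-zeros : ∀ n → sumℚ (applyUpTo (λ _ → 0ℚ) n) ≡ 0ℚ
sumℚ-zeros zero    = refl
sumℚ-zeros (suc n) = trans (+-identityˡ _) (sumℚ-zeros n)

Σx-sum : ∀ α → coeff Σx α ≡ sumℚ (applyUpTo (λ j → coeff (x j) α) (length α))
Σx-sum []                = refl
Σx-sum (zero ∷ α)        = begin
  coeff Σx α                                                 ≡⟨ Σx-sum α ⟩
  sumℚ (applyUpTo (λ j → coeff (x j) α) (length α))          ≡⟨ +-identityˡ _ ⟨
  0ℚ + sumℚ (applyUpTo (λ j → coeff (x j) α) (length α))     ≡⟨ cong (λ c → indicator c + sumℚ (applyUpTo (λ j → coeff (x j) α) (length α))) (∧-zeroʳ (sum α ≡ᵇ 1)) ⟨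
  sumℚ (applyUpTo (λ j → coeff (x j) (0 ∷ α)) (suc (length α))) ∎
  where open ≡-Reasoning
Σx-sum (suc zero ∷ α)    = sym (trans
  (cong₂ _+_ (cong indicator (∧-identityʳ (sum α ≡ᵇ 0))) (none α))
  (+-identityʳ _))
  where
  none : ∀ β → sumℚ (applyUpTo (λ j → indicator ((sum β ≡ᵇ 0) ∧ (exponent β j ≡ᵇ 1))) (length β)) ≡ 0ℚ
  none []          = refl
  none (zero ∷ β)  = trans (cong₂ _+_ (cong indicator (∧-zeroʳ (sum β ≡ᵇ 0))) (none β)) (+-identityʳ _)
  none (suc _ ∷ β) = sumℚ-zeros (suc (length β))
Σx-sum (suc (suc _) ∷ α) = sym (sumℚ-zeros (suc (length α)))

-- The variables are numbered from 0, so j : ℕ stands for the positive integer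
-- j + 1.
ℙₓ : SetsR
ℙₓ = record
  { weightedSet = record
    { setoid      = ≡.setoid ℕ
    ; weight      = x
    ; weight-cong = λ { refl _ → refl }
    }
  ; total    = Σx
  ; hasTotal = λ α → upTo (length α)
                   , Unique.upTo⁺ (length α)
                   , (λ j c≢0 → Membership.∈-upTo⁺ (support α j c≢0))
                   , trans (Σx-sum α) (cong sumℚ (sym (map-applyUpTo (λ j → j) (λ j → coeff (x j) α) (length α))))
  }
  where
  exponent-positive : ∀ α j {b} → indicator (b ∧ (exponent α j ≡ᵇ 1)) ≢ 0ℚ → j < length α
  exponent-positive []      j {b} c≢0 = contradiction (cong indicator (∧-zeroʳ b)) c≢0
  exponent-positive (a ∷ α) zero    _   = ℕ.s≤s ℕ.z≤n
  exponent-positive (a ∷ α) (suc j) c≢0 = ℕ.s≤s (exponent-positive α j c≢0)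

  support : ∀ α j → coeff (x j) α ≢ 0ℚ → j < length α
  support α j = exponent-positive α j {sum α ≡ᵇ 1}

record FinSet : Set₁ where
  field
    Carrier     : Set
    size        : ℕ
    enumeration : Carrier ↔ Fin size

∣_∣ : FinSet → Set
∣ A ∣ = FinSet.Carrier A

[_] : ℕ → FinSet
[ n ] = record { Carrier = Fin n ; size = n ; enumeration = ↔-id (Fin n) }

infix 4 _≃_ _≗ₑ_

_≃_ : FinSet → FinSet → Set
A ≃ B = ∣ A ∣ ↔ ∣ B ∣

_≗ₑ_ : ∀ {A B : Set} → A ↔ B → A ↔ B → Set
f ≗ₑ g = ∀ a → Inverse.to f a ≡ Inverse.to g a

record Species₁ : Set₁ where
  field
    ob       : FinSet → FinSet
    mor      : ∀ {A A′} → A ≃ A′ → ob A ≃ ob A′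
    mor-cong : ∀ {A A′} {f g : A ≃ A′} → f ≗ₑ g → mor {A} {A′} f ≗ₑ mor {A} {A′} g
    mor-id   : ∀ {A} → mor {A} {A} (↔-id _) ≗ₑ ↔-id _
    mor-∘    : ∀ {A A′ A″} (f′ : A′ ≃ A″) (f : A ≃ A′) →
               mor {A} {A″} (f′ ↔-∘ f) ≗ₑ mor {A′} {A″} f′ ↔-∘ mor {A} {A′} f

record Species₂ : Set₁ where
  field
    ob       : FinSet → FinSet → FinSet
    mor      : ∀ {A A′ B B′} → A ≃ A′ → B ≃ B′ → ob A B ≃ ob A′ B′
    mor-cong : ∀ {A A′ B B′} {f f′ : A ≃ A′} {g g′ : B ≃ B′} → f ≗ₑ f′ → g ≗ₑ g′ →
               mor {A} {A′} {B} {B′} f g ≗ₑ mor {A} {A′} {B} {B′} f′ g′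
    mor-id   : ∀ {A B} → mor {A} {A} {B} {B} (↔-id _) (↔-id _) ≗ₑ ↔-id _
    mor-∘    : ∀ {A A′ A″ B B′ B″} (f′ : A′ ≃ A″) (f : A ≃ A′) (g′ : B′ ≃ B″) (g : B ≃ B′) →
               mor {A} {A″} {B} {B″} (f′ ↔-∘ f) (g′ ↔-∘ g) ≗ₑ
               mor {A′} {A″} {B′} {B″} f′ g′ ↔-∘ mor {A} {A′} {B} {B′} f g

StrictlyFinite : Species₁ → Set
StrictlyFinite F = Σ[ N ∈ ℕ ] (∀ n → N ≤ n → ¬ ∣ Species₁.ob F [ n ] ∣)

sectionY : Species₂ → FinSet → Species₁
sectionY G B = record
  { ob       = λ A → G.ob A B
  ; mor      = λ {A} {A′} f → G.mor {A} {A′} {B} {B} f (↔-id _)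
  ; mor-cong = λ {A} {A′} p → G.mor-cong {A} {A′} {B} {B} p (λ _ → refl)
  ; mor-id   = λ {A} → G.mor-id {A} {B}
  ; mor-∘    = λ {A} {A′} {A″} f′ f → G.mor-∘ {A} {A′} {A″} {B} {B} {B} f′ f (↔-id _) (↔-id _)
  }
  where module G = Species₂ G

module Analytic (F : Species₁) (A : WeightedSet) where
  private
    module F = Species₁ F
    module A = WeightedSet A
    module A≈ = Setoid A.setoid

  Structure : Set
  Structure = Σ[ m ∈ ℕ ] ∣ F.ob [ m ] ∣ × (Fin m → A.Carrier)

  act : ∀ {m} → Permutation′ m → ∣ F.ob [ m ] ∣ → ∣ F.ob [ m ] ∣
  act {m} τ = Inverse.to (F.mor {[ m ]} {[ m ]} τ)

  -- Lying in the same 𝔖ₘ-orbit, where τ · (t , f) = (F[τ] t , f ∘ τ⁻¹).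
  data _∼_ : Structure → Structure → Set where
    orbit : ∀ {m t t′ f f′} (τ : Permutation′ m) →
            act τ t ≡ t′ → (∀ i → f (τ ⟨$⟩ˡ i) A.≈ f′ i) →
            (m , t , f) ∼ (m , t′ , f′)

  act-∘ : ∀ {m} (τ ρ : Permutation′ m) t → act (τ ∘ₚ ρ) t ≡ act ρ (act τ t)
  act-∘ {m} τ ρ = F.mor-∘ {[ m ]} {[ m ]} {[ m ]} ρ τ

  act-inverse : ∀ {m} (τ : Permutation′ m) t → act (Perm.flip τ) (act τ t) ≡ t
  act-inverse {m} τ t = begin
    act (Perm.flip τ) (act τ t)  ≡⟨ act-∘ τ (Perm.flip τ) t ⟨
    act (τ ∘ₚ Perm.flip τ) t     ≡⟨ F.mor-cong {[ m ]} {[ m ]} (λ i → Perm.inverseˡ τ) t ⟩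
    act Perm.id t                ≡⟨ F.mor-id {[ m ]} t ⟩
    t                            ∎
    where open ≡-Reasoning

  ∼-refl : ∀ {s} → s ∼ s
  ∼-refl {m , t , f} = orbit Perm.id (F.mor-id {[ m ]} t) (λ _ → A≈.refl)

  ∼-sym : ∀ {s s′} → s ∼ s′ → s′ ∼ s
  ∼-sym {m , t , f} (orbit {f′ = f′} τ refl q) = orbit (Perm.flip τ) (act-inverse τ t) λ i →
    A≈.trans (A≈.sym (q (τ ⟨$⟩ʳ i))) (A≈.reflexive (cong f (Perm.inverseˡ τ)))

  ∼-trans : ∀ {s s′ s″} → s ∼ s′ → s′ ∼ s″ → s ∼ s″
  ∼-trans {m , t , f} (orbit τ refl q) (orbit ρ refl r) =
    orbit (τ ∘ₚ ρ) (act-∘ τ ρ t) (λ i → A≈.trans (q (ρ ⟨$⟩ˡ i)) (r i))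

  weight : Structure → Series
  weight (m , t , f) = ∏ (λ i → A.weight (f i))

  weight-cong : ∀ {s s′} → s ∼ s′ → weight s ≈ₛ weight s′
  weight-cong {m , t , f} (orbit {f′ = f′} τ _ q) α = trans
    (Product.sum-permute (λ i → A.weight (f i)) (Perm.flip τ) α)
    (Product.sum-cong-≋ {m} {λ i → A.weight (f (τ ⟨$⟩ˡ i))} {λ i → A.weight (f′ i)} (λ i → A.weight-cong (q i)) α)

  weightedSet′ : WeightedSet
  weightedSet′ = record
    { setoid      = record
      { Carrier       = Structure
      ; _≈_           = _∼_
      ; isEquivalence = record { refl = ∼-refl ; sym = ∼-sym ; trans = ∼-trans }
      }
    ; weight      = weight
    ; weight-cong = weight-cong
    }

open Analytic public using (orbit)

-- analytic₁ F A is F(A), and analytic₂ G A B below is G_{X[Y]}(A, B).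
analytic₁ : Species₁ → WeightedSet → WeightedSet
analytic₁ F A = Analytic.weightedSet′ F A

analytic₁-map : ∀ F {A A′} → A ⇒ A′ → analytic₁ F A ⇒ analytic₁ F A′
analytic₁-map F h = record
  { func      = record
    { to   = λ (m , t , f) → m , t , h.to ∘ f
    ; cong = λ { (orbit τ p q) → orbit τ p (λ i → h.to-cong (q i)) }
    }
  ; preserves = λ (m , t , f) → Product.sum-cong-≋ (λ i → h.preserves (f i))
  }
  where module h = _⇒_ h

analytic₂ : Species₂ → WeightedSet → FinSet → WeightedSet
analytic₂ G A B = analytic₁ (sectionY G B) A

analytic₂-map : ∀ G {A A′ B B′} → A ⇒ A′ → B ≃ B′ → analytic₂ G A B ⇒ analytic₂ G A′ B′
analytic₂-map G {A} {A′} {B} {B′} h β = record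
  { func      = record
    { to   = λ (m , t , f) → m , actY m t , h.to ∘ f
    ; cong = λ { (orbit {m} {t} τ refl q) → orbit τ (commute τ t) (λ i → h.to-cong (q i)) }
    }
  ; preserves = λ (m , t , f) → Product.sum-cong-≋ (λ i → h.preserves (f i))
  }
  where
  module h = _⇒_ h
  module G = Species₂ G

  actY : ∀ m → ∣ G.ob [ m ] B ∣ → ∣ G.ob [ m ] B′ ∣
  actY m = Inverse.to (G.mor {[ m ]} {[ m ]} {B} {B′} (↔-id _) β)

  commute : ∀ {m} (τ : Permutation′ m) t →
    Analytic.act (sectionY G B′) A′ τ (actY m t) ≡ actY m (Analytic.act (sectionY G B) A τ t)
  commute {m} τ t = begin
    Inverse.to (G.mor {[ m ]} {[ m ]} {B′} {B′} τ (↔-id _)) (actY m t)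
      ≡⟨ G.mor-∘ {[ m ]} {[ m ]} {[ m ]} {B} {B′} {B′} τ (↔-id _) (↔-id _) β t ⟨
    Inverse.to (G.mor {[ m ]} {[ m ]} {B} {B′} (τ ↔-∘ ↔-id _) (↔-id _ ↔-∘ β)) t
      ≡⟨ G.mor-cong {[ m ]} {[ m ]} {B} {B′} (λ _ → refl) (λ _ → refl) t ⟩
    Inverse.to (G.mor {[ m ]} {[ m ]} {B} {B′} (↔-id _ ↔-∘ τ) (β ↔-∘ ↔-id _)) t
      ≡⟨ G.mor-∘ {[ m ]} {[ m ]} {[ m ]} {B} {B} {B′} (↔-id _) τ β (↔-id _) t ⟩
    actY m (Inverse.to (G.mor {[ m ]} {[ m ]} {B} {B} τ (↔-id _)) t) ∎
    where open ≡-Reasoning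

-- The weighted set whose sum of weights is fix_w G_{X[Y]}(ℙₓ, σ).
Fix : ∀ {n} → Species₂ → Permutation′ n → WeightedSet
Fix {n} G σ = Fixed (analytic₂-map G {weightedSet ℙₓ} {weightedSet ℙₓ} {[ n ]} {[ n ]} ⇒-id σ)

-- The species F ⊠_Y G is determined by this property only up to isomorphism, so
-- it is not a function of F and G here.
record IsInnerPlethysm (F : Species₁) (G H : Species₂) : Set₁ where
  field
    iso     : ∀ (A : SetsR) (B : FinSet) →
              analytic₂ H (weightedSet A) B ≅ analytic₁ F (analytic₂ G (weightedSet A) B)
    natural : ∀ (A A′ : SetsR) (B B′ : FinSet)
              (h : weightedSet A ⇒ weightedSet A′) (β : B ≃ B′) →
              ∀ s → WeightedSet._≈_ (analytic₁ F (analytic₂ G (weightedSet A′) B′))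
                (_≅_.to (iso A′ B′) (_⇒_.to (analytic₂-map H {B = B} {B′} h β) s))
                (_⇒_.to (analytic₁-map F (analytic₂-map G {B = B} {B′} h β)) (_≅_.to (iso A B) s))

IsPartition : List ℕ → Set
IsPartition κ = Linked _≥_ κ × All (0 <_) κ

Partition : Set
Partition = Σ (List ℕ) IsPartition

parts : Partition → List ℕ
parts = proj₁

-- On Fin (suc k) this is the cycle i ↦ i - 1 mod (suc k).
cycle : ∀ k → Permutation′ k
cycle zero    = Perm.id
cycle (suc k) = insert zero (fromℕ k) Perm.id

-- Cycles of lengths k₁, k₂, … on consecutive blocks of Fin (k₁ + k₂ + ⋯).
standard : ∀ κ → Permutation′ (sum κ)
standard []      = Perm.id
standard (k ∷ κ) = ↔-sym Fin.+↔⊎ ↔-∘ ((cycle k ⊎-↔ standard κ) ↔-∘ Fin.+↔⊎)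

HasCycleType : ∀ {n} → Permutation′ n → Partition → Set
HasCycleType {n} σ (κ , _) = Σ[ θ ∈ Permutation (sum κ) n ] (∀ i → θ ⟨$⟩ʳ (standard κ ⟨$⟩ʳ i) ≡ σ ⟨$⟩ʳ (θ ⟨$⟩ʳ i))

fixedPoints : ∀ A → A ≃ A → ℕ
fixedPoints A e = length (filter (λ i → to (Inverse.to e (from i)) Fin.≟ i) (allFin (FinSet.size A)))
  where open Inverse (FinSet.enumeration A) using (to; from)

-- fix F[λ] and fix G[λ, μ] are counted on chosen permutations of cycle types λ
-- and μ; by functoriality the choice does not matter.
fix₁ : Species₁ → List ℕ → ℕ
fix₁ F κ = fixedPoints (F.ob [ sum κ ]) (F.mor {[ sum κ ]} {[ sum κ ]} (standard κ))
  where module F = Species₁ F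

fix₂ : Species₂ → List ℕ → List ℕ → ℕ
fix₂ G κ μ = fixedPoints (G.ob [ sum κ ] [ sum μ ])
  (G.mor {[ sum κ ]} {[ sum κ ]} {[ sum μ ]} {[ sum μ ]} (standard κ) (standard μ))
  where module G = Species₂ G

multiplicity : ℕ → List ℕ → ℕ
multiplicity i κ = length (filter (i ℕ.≟_) κ)

z : List ℕ → ℕ
z κ = product (map (λ i → i ^ multiplicity i κ ℕ.* multiplicity i κ !) (applyUpTo suc (sum κ)))

z≢0 : ∀ κ → NonZero (z κ)
z≢0 κ = product≢0 (All.map⁺ (All.applyUpTo⁺₁ suc (sum κ) λ {i} _ →
  ℕ.m*n≢0 (suc i ^ multiplicity (suc i) κ) (multiplicity (suc i) κ !)
    {{ℕ.m^n≢0 (suc i) (multiplicity (suc i) κ)}} {{multiplicity (suc i) κ ℕ.!≢0}}))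

infixl 8 _/z_

_/z_ : ℕ → List ℕ → ℚ
n /z κ = ((ℤ.+ n) / z κ) {{z≢0 κ}}

-- The power sums p_k(x) = Σⱼ xⱼ^k and p_λ(x) = p_{λ₁}(x) p_{λ₂}(x) ⋯.
powerSum : ℕ → Series
powerSum k = dilate k Σx

powerSumₚ : List ℕ → Series
powerSumₚ κ = productₛ (map powerSum κ)

frobeniusTerm : Species₂ → List ℕ → List ℕ → Series
frobeniusTerm G μ κ = fix₂ G κ μ /z κ • powerSumₚ κ

frobeniusTerm-cong : ∀ G μ {κ κ′} → κ ≡ κ′ → frobeniusTerm G μ κ ≈ₛ frobeniusTerm G μ κ′
frobeniusTerm-cong G μ refl _ = refl

-- The family fix G[λ, μ] p_λ(x) / z_λ, indexed by all partitions λ.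
frobenius : Species₂ → Partition → WeightedSet
frobenius G μ = record
  { setoid      = On.setoid (≡.setoid (List ℕ)) parts
  ; weight      = λ κ → frobeniusTerm G (parts μ) (parts κ)
  ; weight-cong = λ {κ} {κ′} → frobeniusTerm-cong G (parts μ) {parts κ} {parts κ′}
  }

-- partitionsUpTo k m enumerates the partitions of m with all parts at most k,
-- according to the multiplicity j of the part k.
partitionsUpTo : ℕ → ℕ → List (List ℕ)
partitionsUpTo zero    zero    = [] ∷ []
partitionsUpTo zero    (suc m) = []
partitionsUpTo (suc k) m       = concatMap
  (λ j → map (replicate j (suc k) ++_) (partitionsUpTo k (m ∸ j ℕ.* suc k)))
  (filter (λ j → j ℕ.* suc k ℕ.≤? m) (upTo (suc m)))

partitionsOf : ℕ → List (List ℕ)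
partitionsOf m = partitionsUpTo m m

-- With ρ the identity this also says that χ σ depends only on the function
-- underlying σ.
IsClassFunction : ∀ {n} → (Permutation′ n → Series) → Set
IsClassFunction χ = ∀ σ σ′ ρ → (∀ i → ρ ⟨$⟩ʳ (σ ⟨$⟩ʳ i) ≡ σ′ ⟨$⟩ʳ (ρ ⟨$⟩ʳ i)) → χ σ ≈ₛ χ σ′

_^ₚ_ : ∀ {n} → Permutation′ n → ℕ → Permutation′ n
σ ^ₚ zero  = Perm.id
σ ^ₚ suc k = (σ ^ₚ k) ∘ₚ σ

ψ : ∀ {n} → ℕ → (Permutation′ n → Series) → (Permutation′ n → Series)
ψ k c σ = dilate k (c (σ ^ₚ k))

-- Symmetric functions of bounded degree, written as polynomials in the power
-- sums: a list of terms (c , λ) stands for Σ c p_λ.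
PowerSumPolynomial : Set
PowerSumPolynomial = List (ℚ × List ℕ)

_⟦_⟧ : ∀ {n} → PowerSumPolynomial → (Permutation′ n → Series) → (Permutation′ n → Series)
(f ⟦ χ ⟧) σ = sumₛ (map (λ (c , κ) → c • productₛ (map (λ k → ψ k χ σ) κ)) f)

-- As F[m] is empty for m ≥ N, only partitions of m < N contribute to Z_F.
Z : ∀ F → StrictlyFinite F → PowerSumPolynomial
Z F (N , _) = map (λ κ → fix₁ F κ /z κ , κ) (concatMap partitionsOf (upTo N))

-- Everything is reduced to one orbit count. Let 𝔖ₘ act on F[m] × Aᵐ, and let a
-- map E built from an automorphism ε of F and a weight-preserving e : A → A act
-- compatibly. Counting the triples (τ, t, f) with τ·E(t, f) = (t, f) gives, as in
-- the Cauchy–Frobenius lemma, m! times the weight of the E-fixed orbits as the sum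
-- over τ of #{t : F[τ] ε t = t} times the total weight of the f with e ∘ f = f ∘ τ.
-- The summand is a class function of τ. On a product of cycles of lengths κᵢ the
-- functions f split into choices of points fixed by e^κᵢ, and since the weights are
-- monomials these contribute p_κᵢ ∘ (sum of the weights fixed by e^κᵢ). Grouping
-- the τ by cycle type, with m!/z_κ of them for κ, yields Σ_κ of these over z_κ.
--
-- With F = G(X, [n]), A = ℙₓ, ε = σ and e = id this is the formula for χ(σ); with
-- A = G_{X[Y]}(ℙₓ, [n]), ε = id and e = σ it is Z_F[χ](σ), because e^k is the
-- action of σ^k.
--
-- That class sums carry the weights 1/z_κ is shown by removing the cycle through
-- 0: both sides satisfy (m+1) a_{m+1}(Φ) = Σ_{i+j=m} a_j(Φ(c_{i+1} ⊕ ·)), on the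
-- partition side because m+1 = Σ_k k·m_k(κ).

module Submission where

open import Defs
open import Algebra.Bundles using (CommutativeMonoid)
import Algebra.Properties.CommutativeSemigroup as CommutativeSemigroupProperties
open import Data.Bool.Base using (T; true; false; _∧_)
open import Data.Bool.Properties using (∧-zeroʳ)
open import Data.Fin.Base using (Fin; zero; suc; toℕ; fromℕ; fromℕ<; inject₁; punchIn; splitAt; join; _↑ˡ_; _↑ʳ_)
import Data.Fin.Properties as Fin
open import Data.Fin.Permutation using (Permutation; Permutation′; _⟨$⟩ʳ_; _⟨$⟩ˡ_; _∘ₚ_; remove; lift₀; transpose)
import Data.Fin.Permutation as Perm
import Data.Fin.Permutation.Components as PC
import Data.Integer.Base as ℤ
import Data.Integer.Properties as ℤ
open import Data.List.Base using (List; []; _∷_; _∷ʳ_; _++_; map; filter; length; replicate; concatMap; upTo; allFin; applyUpTo; deduplicate; cartesianProduct; cartesianProductWith)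
open import Data.List.Properties using (≡-dec; filter-accept; filter-reject; applyUpTo-∷ʳ; map-++; map-∘; map-cong; map-tabulate; length-tabulate)
open import Data.List.Membership.Propositional using (_∈_)
import Data.List.Membership.Setoid as SetoidMembership
import Data.List.Membership.Setoid.Properties as SetoidMembershipₚ
import Data.List.Membership.Propositional.Properties as Membership
open import Data.List.Relation.Binary.Permutation.Propositional as ↭ using (_↭_; ↭-sym; ↭-trans; ↭-refl; prep; swap)
import Data.List.Relation.Binary.Permutation.Propositional.Properties as ↭
open import Data.List.Relation.Unary.All as All using (All; []; _∷_)
import Data.List.Relation.Unary.All.Properties as All
open import Data.List.Relation.Unary.AllPairs as AllPairs using (AllPairs; []; _∷_)
import Data.List.Relation.Unary.AllPairs.Properties as AllPairs
open import Data.List.Relation.Unary.Any as Any using (Any; here; there; any?)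
import Data.List.Relation.Unary.Any.Properties as Any
open import Data.List.Relation.Unary.Linked using (Linked; []; [-]; _∷_)
import Data.List.Relation.Unary.Sorted.TotalOrder.Properties as Sorted
import Data.List.Relation.Binary.Pointwise as Pointwise
import Data.List.Sort as Sort
import Data.List.Relation.Unary.Unique.Setoid as SetoidUnique
import Data.List.Relation.Unary.Unique.Setoid.Properties as SetoidUniqueₚ
import Data.List.Relation.Unary.Unique.DecSetoid.Properties as DecSetoidUniqueₚ
import Data.List.Relation.Unary.Unique.Propositional.Properties as Unique
open import Data.Nat.Base as ℕ using (ℕ; zero; suc; _∸_; _^_; _!; _≤_; _<_; _≥_; _≡ᵇ_; NonZero; z≤n; s≤s)
open import Data.Nat.Divisibility using (_∣_; _∣?_; divides)
import Data.Nat.Divisibility as ∣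
open import Data.Nat.ListAction using (sum; product)
open import Data.Nat.ListAction.Properties using (sum-↭; product-++)
import Data.Nat.Properties as ℕ
open import Data.Product.Base using (Σ; Σ-syntax; _×_; _,_; proj₁; proj₂)
open import Data.Product.Relation.Binary.Pointwise.NonDependent using (×-setoid)
open import Data.Rational.Base using (ℚ; 0ℚ; 1ℚ; _+_; _*_; _/_)
import Data.Rational.Base as ℚ
import Data.Rational.Properties as ℚ
open import Data.Rational.Unnormalised.Base as ℚᵘ using (mkℚᵘ; *≡*)
import Data.Rational.Unnormalised.Properties as ℚᵘ
open import Data.Sum.Base using (_⊎_; inj₁; inj₂; [_,_]′)
import Data.Sum.Base as Sum
open import Data.Sum.Function.Propositional using (_⊎-↔_)
open import Function.Base using (_∘_; id)
open import Function.Bundles using (Inverse; _↔_; mk↔ₛ′)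
open import Function.Construct.Composition using (_↔-∘_)
open import Function.Construct.Identity using (↔-id)
open import Function.Construct.Symmetry using (↔-sym)
open import Level using (0ℓ)
open import Relation.Binary.Bundles using (Setoid; DecSetoid)
import Relation.Binary.Construct.On as On
import Relation.Binary.Construct.Flip.EqAndOrd as Flip
open import Relation.Binary.Definitions using (Decidable)
open import Relation.Binary.PropositionalEquality as ≡ using (_≡_; _≢_; refl; sym; trans; cong; cong₂; subst; module ≡-Reasoning)
open import Relation.Nullary.Decidable using (Dec; yes; no; map′; _×-dec_; dec-true; dec-false)
open import Relation.Nullary.Negation using (¬_; contradiction)
import Relation.Unary as Unary

open CommutativeSemigroupProperties (CommutativeMonoid.commutativeSemigroup ℚ.+-0-commutativeMonoid)
  using () renaming (interchange to +-interchange)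
open CommutativeSemigroupProperties (CommutativeMonoid.commutativeSemigroup ℚ.*-1-commutativeMonoid)
  using () renaming (interchange to *-interchange; x∙yz≈y∙xz to x*yz≡y*xz)
open CommutativeSemigroupProperties ℕ.+-commutativeSemigroup
  using () renaming (interchange to ℕ+-interchange)
open CommutativeSemigroupProperties ℕ.*-commutativeSemigroup
  using () renaming (interchange to ℕ*-interchange; x∙yz≈y∙xz to ℕ*-x∙yz≈y∙xz)

-- Finite sums of rationals

-- A `_HasSum_` is a separate finite list for each monomial, so everything is computed at one fixed
-- exponent list α. Two lists for the same weighted set can be compared only if its equality is
-- decidable, and choosing orbit representatives needs this too; hence the `DecidableEquality`
-- arguments. For `analytic₂ G`, where equality means lying in one orbit, it is obtained by a search
-- through 𝔖ₘ. The count can be applied twice because its assumption on weights passes to its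
-- output: s^k = p_k ∘ s holds for variables and is closed under products, so the weights of
-- G-structures have this property again. The arities that contribute at α must form a finite list.
-- For G over `ℙₓ` only the degree of α is possible; but G-structures may have weight 1, so for F
-- the degree bounds nothing and strict finiteness takes over. A last obstacle is that `Fin (sum κ)`
-- and `Fin m` are different types when `sum κ ≡ m` is only an equation. Class functions are
-- therefore families over all sizes, compared along bijections between `Fin m` and `Fin n`, and
-- permutations are never transported.

𝟙 : ∀ {P : Set} → Dec P → ℚ
𝟙 (yes _) = 1ℚ
𝟙 (no _)  = 0ℚ

module _ {P : Set} where

  𝟙-yes : P → (p? : Dec P) → 𝟙 p? ≡ 1ℚ
  𝟙-yes p (yes _) = refl
  𝟙-yes p (no ¬p) = contradiction p ¬p

  𝟙-no : ¬ P → (p? : Dec P) → 𝟙 p? ≡ 0ℚ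
  𝟙-no ¬p (yes p) = contradiction p ¬p
  𝟙-no ¬p (no _)  = refl

module _ {P : Set} where

  𝟙-⇔ : ∀ {Q : Set} → (P → Q) → (Q → P) → (p? : Dec P) (q? : Dec Q) → 𝟙 p? ≡ 𝟙 q?
  𝟙-⇔ to from (yes p) q? = sym (𝟙-yes (to p) q?)
  𝟙-⇔ to from (no ¬p) q? = sym (𝟙-no (¬p ∘ from) q?)

  𝟙-× : ∀ {Q R : Set} → (P → Q × R) → (Q → R → P) →
        (p? : Dec P) (q? : Dec Q) (r? : Dec R) → 𝟙 p? ≡ 𝟙 q? * 𝟙 r?
  𝟙-× to from p? (yes q) (yes r) = 𝟙-yes (from q r) p?
  𝟙-× to from p? (yes q) (no ¬r) = 𝟙-no (¬r ∘ proj₂ ∘ to) p?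
  𝟙-× to from p? (no ¬q) r?      = trans (𝟙-no (¬q ∘ proj₁ ∘ to) p?) (sym (ℚ.*-zeroˡ (𝟙 r?)))

Σˡ : {A : Set} → List A → (A → ℚ) → ℚ
Σˡ xs f = sumℚ (map f xs)

module _ {A : Set} where

  Σˡ-cong∈ : ∀ (xs : List A) {f g : A → ℚ} → (∀ {x} → x ∈ xs → f x ≡ g x) → Σˡ xs f ≡ Σˡ xs g
  Σˡ-cong∈ []       eq = refl
  Σˡ-cong∈ (x ∷ xs) eq = cong₂ _+_ (eq (here refl)) (Σˡ-cong∈ xs (eq ∘ there))

  Σˡ-cong : ∀ (xs : List A) {f g : A → ℚ} → (∀ x → f x ≡ g x) → Σˡ xs f ≡ Σˡ xs g
  Σˡ-cong xs eq = Σˡ-cong∈ xs (λ {x} _ → eq x)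

  Σˡ-0 : ∀ (xs : List A) → Σˡ xs (λ _ → 0ℚ) ≡ 0ℚ
  Σˡ-0 []       = refl
  Σˡ-0 (x ∷ xs) = trans (ℚ.+-identityˡ _) (Σˡ-0 xs)

  Σˡ-≡0 : ∀ (xs : List A) {f : A → ℚ} → (∀ {x} → x ∈ xs → f x ≡ 0ℚ) → Σˡ xs f ≡ 0ℚ
  Σˡ-≡0 xs eq = trans (Σˡ-cong∈ xs eq) (Σˡ-0 xs)

  Σˡ-+ : ∀ (xs : List A) (f g : A → ℚ) → Σˡ xs (λ x → f x + g x) ≡ Σˡ xs f + Σˡ xs g
  Σˡ-+ []       f g = refl
  Σˡ-+ (x ∷ xs) f g = trans (cong (f x + g x +_) (Σˡ-+ xs f g)) (+-interchange (f x) (g x) _ _)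

  Σˡ-*ˡ : ∀ c (xs : List A) (f : A → ℚ) → Σˡ xs (λ x → c * f x) ≡ c * Σˡ xs f
  Σˡ-*ˡ c []       f = sym (ℚ.*-zeroʳ c)
  Σˡ-*ˡ c (x ∷ xs) f = trans (cong (c * f x +_) (Σˡ-*ˡ c xs f)) (sym (ℚ.*-distribˡ-+ c _ _))

  Σˡ-*ʳ : ∀ (xs : List A) (f : A → ℚ) c → Σˡ xs (λ x → f x * c) ≡ Σˡ xs f * c
  Σˡ-*ʳ xs f c = trans (Σˡ-cong xs (λ x → ℚ.*-comm (f x) c)) (trans (Σˡ-*ˡ c xs f) (ℚ.*-comm c _))

  Σˡ-++ : ∀ (xs ys : List A) (f : A → ℚ) → Σˡ (xs ++ ys) f ≡ Σˡ xs f + Σˡ ys f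
  Σˡ-++ []       ys f = sym (ℚ.+-identityˡ _)
  Σˡ-++ (x ∷ xs) ys f = trans (cong (f x +_) (Σˡ-++ xs ys f)) (sym (ℚ.+-assoc (f x) _ _))

  Σˡ-filter : ∀ {P : A → Set} (P? : Unary.Decidable P) xs (f : _ → ℚ) →
              Σˡ (filter P? xs) f ≡ Σˡ xs (λ x → 𝟙 (P? x) * f x)
  Σˡ-filter P? []       f = refl
  Σˡ-filter P? (x ∷ xs) f with P? x
  ... | yes _ = cong₂ _+_ (sym (ℚ.*-identityˡ (f x))) (Σˡ-filter P? xs f)
  ... | no  _ = trans (Σˡ-filter P? xs f) (sym (trans (cong (_+ _) (ℚ.*-zeroˡ (f x))) (ℚ.+-identityˡ _)))

module _ {A B : Set} where

  Σˡ-map : ∀ (g : A → B) xs (f : _ → ℚ) → Σˡ (map g xs) f ≡ Σˡ xs (f ∘ g)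
  Σˡ-map g xs f = cong sumℚ (sym (map-∘ xs))

module _ {A B : Set} where

  Σˡ-concatMap : ∀ (g : A → List B) xs (f : _ → ℚ) → Σˡ (concatMap g xs) f ≡ Σˡ xs (λ x → Σˡ (g x) f)
  Σˡ-concatMap g []       f = refl
  Σˡ-concatMap g (x ∷ xs) f = trans (Σˡ-++ (g x) (concatMap g xs) f) (cong (Σˡ (g x) f +_) (Σˡ-concatMap g xs f))

  Σˡ-swap : ∀ (xs : List A) (ys : List B) (f : A → B → ℚ) →
            Σˡ xs (λ x → Σˡ ys (f x)) ≡ Σˡ ys (λ y → Σˡ xs (λ x → f x y))
  Σˡ-swap []       ys f = sym (Σˡ-0 ys)
  Σˡ-swap (x ∷ xs) ys f = trans (cong (Σˡ ys (f x) +_) (Σˡ-swap xs ys f)) (sym (Σˡ-+ ys (f x) _))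

  Σˡ-cartesianProductWith : ∀ {C : Set} (g : A → B → C) (xs : List A) (ys : List B) (f : C → ℚ) →
    Σˡ (cartesianProductWith g xs ys) f ≡ Σˡ xs (λ x → Σˡ ys (λ y → f (g x y)))
  Σˡ-cartesianProductWith g []       ys f = refl
  Σˡ-cartesianProductWith g (x ∷ xs) ys f = trans
    (Σˡ-++ (map (g x) ys) (cartesianProductWith g xs ys) f)
    (cong₂ _+_ (Σˡ-map (g x) ys f) (Σˡ-cartesianProductWith g xs ys f))

-- Over a decidable setoid, sums over duplicate-free lists that contain the
-- support of the summand are determined by the summand.
module ListSums (S : Setoid 0ℓ 0ℓ) (_≟_ : Decidable (Setoid._≈_ S)) where
  open Setoid S renaming (Carrier to A; refl to ≈-refl; sym to ≈-sym; trans to ≈-trans)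
  open SetoidMembership S using () renaming (_∈_ to _∈ₛ_; _∉_ to _∉ₛ_)
  open SetoidUnique S public using (Unique)

  Respects : (A → ℚ) → Set
  Respects c = ∀ {a b} → a ≈ b → c a ≡ c b

  Supported : (A → ℚ) → List A → Set
  Supported c xs = ∀ a → c a ≢ 0ℚ → a ∈ₛ xs

  _∈?_ : ∀ a xs → Dec (a ∈ₛ xs)
  a ∈? xs = any? (a ≟_) xs

  outside : ∀ (c : A → ℚ) {xs} → Supported c xs → ∀ {a} → a ∉ₛ xs → c a ≡ 0ℚ
  outside c supp {a} a∉ with c a ℚ.≟ 0ℚ
  ... | yes c≡0 = c≡0
  ... | no  c≢0 = contradiction (supp a c≢0) a∉

  Σˡ-∉ : ∀ {xs} (c : A → ℚ) {a} → a ∉ₛ xs → Σˡ xs (λ b → 𝟙 (a ≟ b) * c b) ≡ 0ℚ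
  Σˡ-∉ {[]}     c a∉ = refl
  Σˡ-∉ {x ∷ xs} c {a} a∉ = cong₂ _+_
    (trans (cong (_* c x) (𝟙-no (a∉ ∘ here) (a ≟ x))) (ℚ.*-zeroˡ (c x)))
    (Σˡ-∉ {xs} c (a∉ ∘ there))

  Σˡ-point-∈ : ∀ {c : A → ℚ} {xs a} → Respects c → Unique xs → a ∈ₛ xs → Σˡ xs (λ b → 𝟙 (a ≟ b) * c b) ≡ c a
  Σˡ-point-∈ {c} {x ∷ xs} {a} resp (x∉ ∷ _) (here a≈x) = begin
    𝟙 (a ≟ x) * c x + Σˡ xs (λ b → 𝟙 (a ≟ b) * c b)
      ≡⟨ cong₂ _+_ (trans (cong (_* c x) (𝟙-yes a≈x (a ≟ x))) (ℚ.*-identityˡ (c x)))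
                   (Σˡ-∉ c (All.All¬⇒¬Any (All.map (λ x≉b a≈b → x≉b (≈-trans (≈-sym a≈x) a≈b)) x∉))) ⟩
    c x + 0ℚ  ≡⟨ ℚ.+-identityʳ (c x) ⟩
    c x       ≡⟨ resp a≈x ⟨
    c a       ∎
    where open ≡-Reasoning
  Σˡ-point-∈ {c} {x ∷ xs} {a} resp (x∉ ∷ u) (there a∈) = begin
    𝟙 (a ≟ x) * c x + Σˡ xs (λ b → 𝟙 (a ≟ b) * c b)
      ≡⟨ cong₂ _+_ (trans (cong (_* c x) (𝟙-no a≉x (a ≟ x))) (ℚ.*-zeroˡ (c x))) (Σˡ-point-∈ resp u a∈) ⟩
    0ℚ + c a  ≡⟨ ℚ.+-identityˡ (c a) ⟩
    c a       ∎
    where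
    open ≡-Reasoning
    a≉x : ¬ (a ≈ x)
    a≉x a≈x = All.All¬⇒¬Any (All.map (λ x≉b a≈b → x≉b (≈-trans (≈-sym a≈x) a≈b)) x∉) a∈

  Σˡ-point : ∀ {c : A → ℚ} {xs} → Respects c → Unique xs → Supported c xs →
             ∀ a → Σˡ xs (λ b → 𝟙 (a ≟ b) * c b) ≡ c a
  Σˡ-point {c} {xs} resp u supp a with a ∈? xs
  ... | yes a∈ = Σˡ-point-∈ resp u a∈
  ... | no  a∉ = trans (Σˡ-∉ c a∉) (sym (outside c supp a∉))

  -- Both sides equal the double sum of `𝟙 (x ≟ y) * c y`. Inclusion is asked only where `c` does
  -- not vanish, so lists that differ in irrelevant entries can be compared.
  Σˡ-unique : ∀ {c : A → ℚ} {xs ys} → Respects c → Unique xs → Unique ys →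
              (∀ {a} → a ∈ xs → c a ≢ 0ℚ → a ∈ₛ ys) → (∀ {a} → a ∈ ys → c a ≢ 0ℚ → a ∈ₛ xs) →
              Σˡ xs c ≡ Σˡ ys c
  Σˡ-unique {c} {xs} {ys} resp u v xs⊆ys ys⊆xs = begin
    Σˡ xs c
      ≡⟨ Σˡ-cong∈ xs (λ x∈ → sym (expand v (xs⊆ys x∈))) ⟩
    Σˡ xs (λ x → Σˡ ys (λ y → 𝟙 (x ≟ y) * c y))
      ≡⟨ Σˡ-swap xs ys _ ⟩
    Σˡ ys (λ y → Σˡ xs (λ x → 𝟙 (x ≟ y) * c y))
      ≡⟨ Σˡ-cong ys (λ y → Σˡ-cong xs (λ x → flip-𝟙 x y)) ⟩
    Σˡ ys (λ y → Σˡ xs (λ x → 𝟙 (y ≟ x) * c x))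
      ≡⟨ Σˡ-cong∈ ys (λ y∈ → expand u (ys⊆xs y∈)) ⟩
    Σˡ ys c ∎
    where
    open ≡-Reasoning
    flip-𝟙 : ∀ x y → 𝟙 (x ≟ y) * c y ≡ 𝟙 (y ≟ x) * c x
    flip-𝟙 x y with x ≟ y
    ... | yes x≈y = cong₂ _*_ (sym (𝟙-yes (≈-sym x≈y) (y ≟ x))) (sym (resp x≈y))
    ... | no  x≉y = trans (ℚ.*-zeroˡ (c y)) (sym (trans (cong (_* c x) (𝟙-no (x≉y ∘ ≈-sym) (y ≟ x))) (ℚ.*-zeroˡ (c x))))
    expand : ∀ {zs} → Unique zs → ∀ {a} → (c a ≢ 0ℚ → a ∈ₛ zs) → Σˡ zs (λ b → 𝟙 (a ≟ b) * c b) ≡ c a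
    expand {zs} w {a} f with c a ℚ.≟ 0ℚ
    ... | no  c≢0 = Σˡ-point-∈ resp w (f c≢0)
    -- Here `a` may be missing from `zs`; a nonzero indicator would force `c b ≡ c a`, so every term
    -- is 0 all the same.
    ... | yes c≡0 = trans (trans (Σˡ-cong zs vanish) (Σˡ-0 zs)) (sym c≡0)
      where
      vanish : ∀ b → 𝟙 (a ≟ b) * c b ≡ 0ℚ
      vanish b with a ≟ b
      ... | yes a≈b = trans (ℚ.*-identityˡ (c b)) (trans (sym (resp a≈b)) c≡0)
      ... | no  _   = ℚ.*-zeroˡ (c b)

-- Built by repeated addition of 1, so that counting a list agrees with it step by step; `toℚᵘ-ι`
-- links it to fractions.
ι : ℕ → ℚ
ι zero    = 0ℚ
ι (suc n) = 1ℚ + ι n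

ι-+ : ∀ m n → ι (m ℕ.+ n) ≡ ι m + ι n
ι-+ zero    n = sym (ℚ.+-identityˡ (ι n))
ι-+ (suc m) n = trans (cong (1ℚ +_) (ι-+ m n)) (sym (ℚ.+-assoc 1ℚ (ι m) (ι n)))

ι-* : ∀ m n → ι (m ℕ.* n) ≡ ι m * ι n
ι-* zero    n = sym (ℚ.*-zeroˡ (ι n))
ι-* (suc m) n = begin
  ι (n ℕ.+ m ℕ.* n)       ≡⟨ ι-+ n (m ℕ.* n) ⟩
  ι n + ι (m ℕ.* n)       ≡⟨ cong₂ _+_ (sym (ℚ.*-identityˡ (ι n))) (ι-* m n) ⟩
  1ℚ * ι n + ι m * ι n    ≡⟨ ℚ.*-distribʳ-+ (ι n) 1ℚ (ι m) ⟨
  (1ℚ + ι m) * ι n        ∎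
  where open ≡-Reasoning

ι-length : ∀ {A : Set} (xs : List A) → ι (length xs) ≡ Σˡ xs (λ _ → 1ℚ)
ι-length []       = refl
ι-length (x ∷ xs) = cong (1ℚ +_) (ι-length xs)

Σˡ-const : ∀ {A : Set} (xs : List A) c → Σˡ xs (λ _ → c) ≡ ι (length xs) * c
Σˡ-const []       c = sym (ℚ.*-zeroˡ c)
Σˡ-const (x ∷ xs) c = trans (cong₂ _+_ (sym (ℚ.*-identityˡ c)) (Σˡ-const xs c)) (sym (ℚ.*-distribʳ-+ c 1ℚ (ι (length xs))))

toℚᵘ-ι : ∀ n → ℚ.toℚᵘ (ι n) ℚᵘ.≃ mkℚᵘ (ℤ.+ n) 0
toℚᵘ-ι zero    = *≡* refl
toℚᵘ-ι (suc n) = ℚᵘ.≃-trans (ℚ.toℚᵘ-homo-+ 1ℚ (ι n))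
  (ℚᵘ.≃-trans (ℚᵘ.+-cong (ℚᵘ.≃-refl {ℚ.toℚᵘ 1ℚ}) (toℚᵘ-ι n)) (*≡* (cong (λ k → ((ℤ.+ 1) ℤ.+ k) ℤ.* (ℤ.+ 1)) (ℤ.*-identityʳ (ℤ.+ n)))))

/-*-cancel : ∀ n d .{{_ : NonZero d}} → (ℤ.+ n / d) * ι d ≡ ι n
/-*-cancel n d@(suc d-1) = ℚ.toℚᵘ-injective (begin-equality
  ℚ.toℚᵘ ((ℤ.+ n / d) * ι d)                   ≃⟨ ℚ.toℚᵘ-homo-* (ℤ.+ n / d) (ι d) ⟩
  ℚ.toℚᵘ (ℤ.+ n / d) ℚᵘ.* ℚ.toℚᵘ (ι d)         ≃⟨ ℚᵘ.*-cong (ℚ.toℚᵘ-fromℚᵘ (mkℚᵘ (ℤ.+ n) d-1)) (toℚᵘ-ι d) ⟩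
  mkℚᵘ (ℤ.+ n) d-1 ℚᵘ.* mkℚᵘ (ℤ.+ d) 0         ≃⟨ *≡* (trans (ℤ.*-identityʳ _) (cong (ℤ.+ n ℤ.*_) (cong ℤ.+_ (sym (ℕ.*-identityʳ d))))) ⟩
  mkℚᵘ (ℤ.+ n) 0                               ≃⟨ toℚᵘ-ι n ⟨
  ℚ.toℚᵘ (ι n)                                 ∎)
  where open ℚᵘ.≤-Reasoning

-- Identities involving 1/z_κ, and the final division by m!, are obtained by multiplying out and
-- cancelling here.
ι-cancelˡ : ∀ d .{{_ : NonZero d}} {p q} → ι d * p ≡ ι d * q → p ≡ q
ι-cancelˡ d {p} {q} eq = begin
  p                      ≡⟨ unit p ⟨
  (ℤ.+ 1 / d) * (ι d * p)  ≡⟨ cong ((ℤ.+ 1 / d) *_) eq ⟩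
  (ℤ.+ 1 / d) * (ι d * q)  ≡⟨ unit q ⟩
  q                      ∎
  where
  open ≡-Reasoning
  unit : ∀ r → (ℤ.+ 1 / d) * (ι d * r) ≡ r
  unit r = trans (sym (ℚ.*-assoc (ℤ.+ 1 / d) (ι d) r)) (trans (cong (_* r) (/-*-cancel 1 d)) (ℚ.*-identityˡ r))

/-as-* : ∀ n d .{{_ : NonZero d}} → ℤ.+ n / d ≡ ι n * (ℤ.+ 1 / d)
/-as-* n d = ι-cancelˡ d (begin
  ι d * (ℤ.+ n / d)          ≡⟨ trans (ℚ.*-comm (ι d) _) (/-*-cancel n d) ⟩
  ι n                        ≡⟨ ℚ.*-identityʳ (ι n) ⟨
  ι n * 1ℚ                   ≡⟨ cong (ι n *_) (trans (ℚ.*-comm (ι d) _) (/-*-cancel 1 d)) ⟨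
  ι n * (ι d * (ℤ.+ 1 / d))  ≡⟨ x*yz≡y*xz (ι n) (ι d) _ ⟩
  ι d * (ι n * (ℤ.+ 1 / d))  ∎)
  where open ≡-Reasoning

-- Coefficients of products and dilations

antidiag-cong≤ : ∀ a {h h′ : ℕ → ℕ → ℚ} → (∀ i j → i ℕ.+ j ≡ a → h i j ≡ h′ i j) → antidiag a h ≡ antidiag a h′
antidiag-cong≤ zero    eq = eq 0 0 refl
antidiag-cong≤ (suc a) eq = cong₂ _+_ (eq 0 (suc a) refl) (antidiag-cong≤ a (λ i j i+j≡a → eq (suc i) j (cong suc i+j≡a)))

antidiag-≡0 : ∀ a {h : ℕ → ℕ → ℚ} → (∀ i j → i ℕ.+ j ≡ a → h i j ≡ 0ℚ) → antidiag a h ≡ 0ℚ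
antidiag-≡0 a eq = trans (antidiag-cong≤ a eq) (antidiag-0 a)

antidiag-*ʳ : ∀ a (h : ℕ → ℕ → ℚ) c → antidiag a (λ i j → h i j * c) ≡ antidiag a h * c
antidiag-*ʳ zero    h c = refl
antidiag-*ʳ (suc a) h c = trans (cong (h 0 (suc a) * c +_) (antidiag-*ʳ a (λ i j → h (suc i) j) c))
  (sym (ℚ.*-distribʳ-+ c (h 0 (suc a)) (antidiag a (λ i j → h (suc i) j))))

antidiag-Σˡ : ∀ {A : Set} (xs : List A) a (h : A → ℕ → ℕ → ℚ) →
  antidiag a (λ i j → Σˡ xs (λ x → h x i j)) ≡ Σˡ xs (λ x → antidiag a (h x))
antidiag-Σˡ []       a h = antidiag-0 a
antidiag-Σˡ (x ∷ xs) a h = trans (antidiag-+ a (h x) _) (cong (antidiag a (h x) +_) (antidiag-Σˡ xs a h))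

antidiag-swap : ∀ a b (h : ℕ → ℕ → ℕ → ℕ → ℚ) →
  antidiag a (λ i j → antidiag b (h i j)) ≡ antidiag b (λ p q → antidiag a (λ i j → h i j p q))
antidiag-swap zero    b h = refl
antidiag-swap (suc a) b h = trans
  (cong (antidiag b (h 0 (suc a)) +_) (antidiag-swap a b (λ i j → h (suc i) j)))
  (sym (antidiag-+ b (h 0 (suc a)) _))

antidiag-support : ∀ a {h : ℕ → ℕ → ℚ} → antidiag a h ≢ 0ℚ → Σ[ i ∈ ℕ ] Σ[ j ∈ ℕ ] (i ℕ.+ j ≡ a × h i j ≢ 0ℚ)
antidiag-support zero    h≢0 = 0 , 0 , refl , h≢0
antidiag-support (suc a) {h} h≢0 with h 0 (suc a) ℚ.≟ 0ℚ
... | no  h₀≢0 = 0 , suc a , refl , h₀≢0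
... | yes h₀≡0 with i , j , i+j≡a , hᵢⱼ≢0 ← antidiag-support a (λ rest≡0 → h≢0 (cong₂ _+_ h₀≡0 rest≡0)) =
  suc i , j , cong suc i+j≡a , hᵢⱼ≢0

antidiag-skip : ∀ r a (h : ℕ → ℕ → ℚ) → (∀ i j → i < r → h i j ≡ 0ℚ) →
  antidiag (r ℕ.+ a) h ≡ antidiag a (λ i j → h (r ℕ.+ i) j)
antidiag-skip zero    a h h≡0 = refl
antidiag-skip (suc r) a h h≡0 = trans
  (cong₂ _+_ (h≡0 0 _ (s≤s z≤n)) (antidiag-skip r a (λ i j → h (suc i) j) (λ i j i<r → h≡0 (suc i) j (s≤s i<r))))
  (ℚ.+-identityˡ _)

antidiag-point : ∀ a m (v : ℕ → ℚ) → m ≤ a → antidiag a (λ i j → 𝟙 (i ℕ.≟ m) * v j) ≡ v (a ∸ m)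
antidiag-point zero    zero    v _ = ℚ.*-identityˡ (v 0)
antidiag-point (suc a) zero    v _ = trans
  (cong₂ _+_ (ℚ.*-identityˡ (v (suc a)))
    (antidiag-≡0 a (λ i j _ → trans (cong (_* v j) (𝟙-no (λ ()) (suc i ℕ.≟ 0))) (ℚ.*-zeroˡ (v j)))))
  (ℚ.+-identityʳ _)
antidiag-point (suc a) (suc m) v (s≤s m≤a) = trans
  (cong₂ _+_ (trans (cong (_* v (suc a)) (𝟙-no (λ ()) (0 ℕ.≟ suc m))) (ℚ.*-zeroˡ (v (suc a))))
    (antidiag-cong a (λ i j → cong (_* v j) (𝟙-⇔ ℕ.suc-injective (cong suc) (suc i ℕ.≟ suc m) (i ℕ.≟ m)))))
  (trans (ℚ.+-identityˡ _) (antidiag-point a m v m≤a))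

-- Each step of the induction on q keeps the term at 0 and skips the k - 1 indices after it. Once k
-- divides i it divides the complementary index too, the total being q k.
antidiag-multiples : ∀ k .{{_ : NonZero k}} q (h : ℕ → ℕ → ℚ) → (∀ i j → ¬ k ∣ i → h i j ≡ 0ℚ) →
  antidiag (q ℕ.* k) h ≡ antidiag q (λ i j → h (i ℕ.* k) (j ℕ.* k))
antidiag-multiples k           zero    h h≡0 = refl
antidiag-multiples k@(suc k-1) (suc q) h h≡0 = cong (h 0 (k ℕ.+ q ℕ.* k) +_) (trans
  (antidiag-skip k-1 (q ℕ.* k) (λ i j → h (suc i) j) (λ i j i<k-1 → h≡0 (suc i) j (∣.>⇒∤ (s≤s i<k-1))))
  (antidiag-multiples k q (λ i j → h (k ℕ.+ i) j) (λ i j k∤i → h≡0 (k ℕ.+ i) j (λ k∣k+i → k∤i (∣.∣m+n∣m⇒∣n k∣k+i ∣.∣-refl)))))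

-- The exponents of the divisors of x^α, which are all that the coefficient of x^α in a product can
-- see.
below : List ℕ → List (List ℕ)
below []      = [] ∷ []
below (a ∷ α) = cartesianProductWith _∷_ (upTo (suc a)) (below α)

∷-below : ∀ {a i α β} → i ≤ a → β ∈ below α → (i ∷ β) ∈ below (a ∷ α)
∷-below i≤a = Membership.∈-cartesianProductWith⁺ _∷_ (Membership.∈-upTo⁺ (s≤s i≤a))

conv-cong-below : ∀ {f f′ g g′ : List ℕ → ℚ} α →
  (∀ {β} → β ∈ below α → f β ≡ f′ β) → (∀ {β} → β ∈ below α → g β ≡ g′ β) →
  conv f g α ≡ conv f′ g′ α
conv-cong-below []      p q = cong₂ _*_ (p (here refl)) (q (here refl))
conv-cong-below (a ∷ α) p q = antidiag-cong≤ a λ { i j refl → conv-cong-below α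
  (p ∘ ∷-below {α = α} (ℕ.m≤m+n i j)) (q ∘ ∷-below {α = α} (ℕ.m≤n+m j i)) }

-- The two degrees are recorded so that products of homogeneous series can be shown homogeneous.
conv-support : ∀ {f g : List ℕ → ℚ} α → conv f g α ≢ 0ℚ →
  Σ[ β ∈ List ℕ ] Σ[ γ ∈ List ℕ ]
    (β ∈ below α × γ ∈ below α) × (f β ≢ 0ℚ × g γ ≢ 0ℚ) × sum β ℕ.+ sum γ ≡ sum α
conv-support {f} {g} [] c≢0 = [] , [] , (here refl , here refl) ,
  ((λ f≡0 → c≢0 (trans (cong (_* g []) f≡0) (ℚ.*-zeroˡ (g [])))) ,
   (λ g≡0 → c≢0 (trans (cong (f [] *_) g≡0) (ℚ.*-zeroʳ (f []))))) , refl
conv-support (a ∷ α) c≢0 with i , j , refl , cᵢⱼ≢0 ← antidiag-support a c≢0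
                         with β , γ , (β∈ , γ∈) , ≢0 , Σ≡ ← conv-support α cᵢⱼ≢0 =
  i ∷ β , j ∷ γ , (∷-below {α = α} (ℕ.m≤m+n i j) β∈ , ∷-below {α = α} (ℕ.m≤n+m j i) γ∈) , ≢0 ,
  trans (ℕ+-interchange i (sum β) j (sum γ)) (cong (i ℕ.+ j ℕ.+_) Σ≡)

conv-scale : ∀ c d (f g : List ℕ → ℚ) α → conv (λ β → c * f β) (λ β → d * g β) α ≡ (c * d) * conv f g α
conv-scale c d f g []      = *-interchange c (f []) d (g [])
conv-scale c d f g (a ∷ α) = trans
  (antidiag-cong a (λ i j → trans (conv-scale c d (f ∘ (i ∷_)) (g ∘ (j ∷_)) α) (ℚ.*-comm (c * d) _)))
  (trans (antidiag-*ʳ a _ (c * d)) (ℚ.*-comm _ (c * d)))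

conv-Σˡˡ : ∀ {A : Set} (xs : List A) (u : A → List ℕ → ℚ) g α →
  conv (λ β → Σˡ xs (λ x → u x β)) g α ≡ Σˡ xs (λ x → conv (u x) g α)
conv-Σˡˡ []       u g α = conv-zeroˡ g α
conv-Σˡˡ (x ∷ xs) u g α = trans (conv-distribʳ (u x) _ g α) (cong (conv (u x) g α +_) (conv-Σˡˡ xs u g α))

conv-Σˡʳ : ∀ {A : Set} f (xs : List A) (u : A → List ℕ → ℚ) α →
  conv f (λ β → Σˡ xs (λ x → u x β)) α ≡ Σˡ xs (λ x → conv f (u x) α)
conv-Σˡʳ f xs u α = trans (conv-comm f _ α) (trans (conv-Σˡˡ xs u f α) (Σˡ-cong xs (λ x → conv-comm (u x) f α)))

-- Divisibility of the exponents by k does not involve g: at a given α, dilation either reads one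
-- coefficient, at the same place for all g, or is 0 for all g. Its linearity follows at once.
dilateCoeff-cases : ∀ k α →
  (Σ[ β ∈ List ℕ ] sum α ≡ sum β ℕ.* k × (∀ g → dilateCoeff k g α ≡ g β)) ⊎ (∀ g → dilateCoeff k g α ≡ 0ℚ)
dilateCoeff-cases k []      = inj₁ ([] , refl , λ g → refl)
dilateCoeff-cases k (a ∷ α) with k ∣? a
... | no  _               = inj₂ (λ g → refl)
... | yes (divides q a≡qk) with dilateCoeff-cases k α
...   | inj₁ (β , Σ≡ , eq) = inj₁ (q ∷ β , trans (cong₂ ℕ._+_ a≡qk Σ≡) (sym (ℕ.*-distribʳ-+ k q (sum β))) , λ g → eq (g ∘ (q ∷_)))
...   | inj₂ eq            = inj₂ (λ g → eq (g ∘ (q ∷_)))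

dilateCoeff-cong : ∀ k {f g : List ℕ → ℚ} → (∀ α → f α ≡ g α) → ∀ α → dilateCoeff k f α ≡ dilateCoeff k g α
dilateCoeff-cong k {f} {g} eq α with dilateCoeff-cases k α
... | inj₁ (β , _ , d) = trans (d f) (trans (eq β) (sym (d g)))
... | inj₂ d           = trans (d f) (sym (d g))

dilateCoeff-scale : ∀ k c (f : List ℕ → ℚ) α → dilateCoeff k (λ β → c * f β) α ≡ c * dilateCoeff k f α
dilateCoeff-scale k c f α with dilateCoeff-cases k α
... | inj₁ (β , _ , d) = trans (d (λ β → c * f β)) (cong (c *_) (sym (d f)))
... | inj₂ d           = trans (d (λ β → c * f β)) (sym (trans (cong (c *_) (d f)) (ℚ.*-zeroʳ c)))

dilateCoeff-antidiag : ∀ k a (h : ℕ → ℕ → List ℕ → ℚ) α →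
  dilateCoeff k (λ β → antidiag a (λ i j → h i j β)) α ≡ antidiag a (λ i j → dilateCoeff k (h i j) α)
dilateCoeff-antidiag k a h α with dilateCoeff-cases k α
... | inj₁ (β , _ , d) = trans (d (λ β → antidiag a (λ i j → h i j β))) (antidiag-cong a (λ i j → sym (d (h i j))))
... | inj₂ d           = trans (d (λ β → antidiag a (λ i j → h i j β))) (sym (antidiag-≡0 a (λ i j _ → d (h i j))))

dilateCoeff-multiple : ∀ k .{{_ : NonZero k}} q (g : List ℕ → ℚ) α →
  dilateCoeff k g (q ℕ.* k ∷ α) ≡ dilateCoeff k (g ∘ (q ∷_)) α
dilateCoeff-multiple k q g α with k ∣? (q ℕ.* k)
... | no  k∤qk           = contradiction (∣.n∣m*n q) k∤qk
... | yes (divides q′ eq) rewrite ℕ.*-cancelʳ-≡ q q′ k eq = refl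

dilateCoeff-nonmultiple : ∀ k {a} (g : List ℕ → ℚ) α → ¬ k ∣ a → dilateCoeff k g (a ∷ α) ≡ 0ℚ
dilateCoeff-nonmultiple k {a} g α k∤a with k ∣? a
... | yes k∣a = contradiction k∣a k∤a
... | no  _   = refl

conv-zeroʳ : ∀ (f : List ℕ → ℚ) α → conv f (λ _ → 0ℚ) α ≡ 0ℚ
conv-zeroʳ f α = trans (conv-comm f _ α) (conv-zeroˡ f α)

-- An exponent not divisible by k has no splitting i + j into two multiples of k; for an exponent q
-- k, the splittings into multiples of k correspond to the splittings of q.
dilate-*ₛ : ∀ k .{{_ : NonZero k}} f g → dilate k (f *ₛ g) ≈ₛ dilate k f *ₛ dilate k g
dilate-*ₛ k f g = go (coeff f) (coeff g)
  where
  open ≡-Reasoning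
  go : ∀ (f g : List ℕ → ℚ) α → dilateCoeff k (conv f g) α ≡ conv (dilateCoeff k f) (dilateCoeff k g) α
  go f g []      = refl
  go f g (a ∷ α) with k ∣? a
  ... | no  k∤a = sym (antidiag-≡0 a vanish)
    where
    vanish : ∀ i j → i ℕ.+ j ≡ a → conv (dilateCoeff k f ∘ (i ∷_)) (dilateCoeff k g ∘ (j ∷_)) α ≡ 0ℚ
    vanish i j refl with k ∣? i | k ∣? j
    ... | no  _   | _       = conv-zeroˡ _ α
    ... | yes _   | no _    = conv-zeroʳ _ α
    ... | yes k∣i | yes k∣j = contradiction (∣.∣m∣n⇒∣m+n k∣i k∣j) k∤a
  ... | yes (divides q refl) = begin
    dilateCoeff k (λ β → antidiag q (λ i j → conv (f ∘ (i ∷_)) (g ∘ (j ∷_)) β)) α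
      ≡⟨ dilateCoeff-antidiag k q (λ i j → conv (f ∘ (i ∷_)) (g ∘ (j ∷_))) α ⟩
    antidiag q (λ i j → dilateCoeff k (conv (f ∘ (i ∷_)) (g ∘ (j ∷_))) α)
      ≡⟨ antidiag-cong q (λ i j → go (f ∘ (i ∷_)) (g ∘ (j ∷_)) α) ⟩
    antidiag q (λ i j → conv (dilateCoeff k (f ∘ (i ∷_))) (dilateCoeff k (g ∘ (j ∷_))) α)
      ≡⟨ antidiag-cong q (λ i j → conv-cong (dilateCoeff-multiple k i f) (dilateCoeff-multiple k j g) α) ⟨
    antidiag q (λ i j → conv (dilateCoeff k f ∘ (i ℕ.* k ∷_)) (dilateCoeff k g ∘ (j ℕ.* k ∷_)) α)
      ≡⟨ antidiag-multiples k q (λ i j → conv (dilateCoeff k f ∘ (i ∷_)) (dilateCoeff k g ∘ (j ∷_)) α)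
           (λ i j k∤i → trans (conv-cong (λ β → dilateCoeff-nonmultiple k f β k∤i) (λ _ → refl) α) (conv-zeroˡ _ α)) ⟨
    antidiag (q ℕ.* k) (λ i j → conv (dilateCoeff k f ∘ (i ∷_)) (dilateCoeff k g ∘ (j ∷_)) α) ∎

dilate-1ₛ : ∀ k .{{_ : NonZero k}} → dilate k 1ₛ ≈ₛ 1ₛ
dilate-1ₛ k           []      = refl
dilate-1ₛ k@(suc _) (a ∷ α) with k ∣? a
dilate-1ₛ k@(suc _) (a ∷ α)       | yes (divides zero refl)    = dilate-1ₛ k α
dilate-1ₛ k@(suc _) (a ∷ α)       | yes (divides (suc q) refl) with dilateCoeff-cases k α
... | inj₁ (_ , _ , d) = d (λ _ → 0ℚ)
... | inj₂ d           = d (λ _ → 0ℚ)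
dilate-1ₛ k@(suc _) (zero ∷ α)    | no k∤a = contradiction (k ∣.∣0) k∤a
dilate-1ₛ k@(suc _) (suc a ∷ α)   | no k∤a = refl

-- The coefficients of xⱼ^k, by recursion on the exponent list.
varPower : ℕ → ℕ → List ℕ → ℚ
varPower j       k []      = 𝟙 (k ℕ.≟ 0)
varPower zero    k (a ∷ α) = 𝟙 (a ℕ.≟ k) * coeff 1ₛ α
varPower (suc j) k (a ∷ α) = 𝟙 (a ℕ.≟ 0) * varPower j k α

coeff-x : ∀ j α → coeff (x j) α ≡ varPower j 1 α
coeff-x j       []                = refl
coeff-x zero    (zero ∷ α)        = trans (cong indicator (∧-zeroʳ (sum α ≡ᵇ 1))) (sym (ℚ.*-zeroˡ (coeff 1ₛ α)))
coeff-x zero    (suc zero ∷ α)    with sum α ≡ᵇ 0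
... | true  = refl
... | false = refl
coeff-x zero    (suc (suc a) ∷ α) = sym (ℚ.*-zeroˡ (coeff 1ₛ α))
coeff-x (suc j) (zero ∷ α)        = trans (coeff-x j α) (sym (ℚ.*-identityˡ (varPower j 1 α)))
coeff-x (suc j) (suc zero ∷ α)    = trans (cong indicator (degree0 α j)) (sym (ℚ.*-zeroˡ (varPower j 1 α)))
  where
  degree0 : ∀ α j → (sum α ≡ᵇ 0) ∧ (exponent α j ≡ᵇ 1) ≡ false
  degree0 []          j       = refl
  degree0 (zero ∷ α)  zero    with sum α ≡ᵇ 0
  ... | true  = refl
  ... | false = refl
  degree0 (zero ∷ α)  (suc j) = degree0 α j
  degree0 (suc _ ∷ α) j       = refl
coeff-x (suc j) (suc (suc a) ∷ α) = sym (ℚ.*-zeroˡ (varPower j 1 α))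

varPower-0 : ∀ j α → varPower j 0 α ≡ coeff 1ₛ α
varPower-0 j       []          = refl
varPower-0 zero    (zero ∷ α)  = ℚ.*-identityˡ (coeff 1ₛ α)
varPower-0 zero    (suc a ∷ α) = ℚ.*-zeroˡ (coeff 1ₛ α)
varPower-0 (suc j) (zero ∷ α)  = trans (ℚ.*-identityˡ (varPower j 0 α)) (varPower-0 j α)
varPower-0 (suc j) (suc a ∷ α) = ℚ.*-zeroˡ (varPower j 0 α)

varPower-suc : ∀ j k α → conv (varPower j 1) (varPower j k) α ≡ varPower j (suc k) α
varPower-suc j       k []      = ℚ.*-zeroˡ (𝟙 (k ℕ.≟ 0))
varPower-suc zero    k (a ∷ α) = begin
  antidiag a (λ i l → conv (λ β → 𝟙 (i ℕ.≟ 1) * coeff 1ₛ β) (λ β → 𝟙 (l ℕ.≟ k) * coeff 1ₛ β) α)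
    ≡⟨ antidiag-cong a (λ i l → trans (conv-scale (𝟙 (i ℕ.≟ 1)) (𝟙 (l ℕ.≟ k)) (coeff 1ₛ) (coeff 1ₛ) α)
                                      (cong (𝟙 (i ℕ.≟ 1) * 𝟙 (l ℕ.≟ k) *_) (conv-identityˡ (coeff 1ₛ) α))) ⟩
  antidiag a (λ i l → 𝟙 (i ℕ.≟ 1) * 𝟙 (l ℕ.≟ k) * coeff 1ₛ α)
    ≡⟨ antidiag-*ʳ a _ (coeff 1ₛ α) ⟩
  antidiag a (λ i l → 𝟙 (i ℕ.≟ 1) * 𝟙 (l ℕ.≟ k)) * coeff 1ₛ α
    ≡⟨ cong (_* coeff 1ₛ α) (degree a) ⟩
  𝟙 (a ℕ.≟ suc k) * coeff 1ₛ α ∎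
  where
  open ≡-Reasoning
  degree : ∀ a → antidiag a (λ i l → 𝟙 (i ℕ.≟ 1) * 𝟙 (l ℕ.≟ k)) ≡ 𝟙 (a ℕ.≟ suc k)
  degree zero    = trans (ℚ.*-zeroˡ (𝟙 (0 ℕ.≟ k))) (sym (𝟙-no (λ ()) (0 ℕ.≟ suc k)))
  degree (suc a) = trans (antidiag-point (suc a) 1 (λ l → 𝟙 (l ℕ.≟ k)) (s≤s z≤n))
                         (𝟙-⇔ (cong suc) ℕ.suc-injective (a ℕ.≟ k) (suc a ℕ.≟ suc k))
varPower-suc (suc j) k (a ∷ α) = begin
  antidiag a (λ i l → conv (λ β → 𝟙 (i ℕ.≟ 0) * varPower j 1 β) (λ β → 𝟙 (l ℕ.≟ 0) * varPower j k β) α)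
    ≡⟨ antidiag-cong a (λ i l → conv-scale (𝟙 (i ℕ.≟ 0)) (𝟙 (l ℕ.≟ 0)) (varPower j 1) (varPower j k) α) ⟩
  antidiag a (λ i l → 𝟙 (i ℕ.≟ 0) * 𝟙 (l ℕ.≟ 0) * conv (varPower j 1) (varPower j k) α)
    ≡⟨ antidiag-*ʳ a _ _ ⟩
  antidiag a (λ i l → 𝟙 (i ℕ.≟ 0) * 𝟙 (l ℕ.≟ 0)) * conv (varPower j 1) (varPower j k) α
    ≡⟨ cong₂ _*_ (antidiag-point a 0 (λ l → 𝟙 (l ℕ.≟ 0)) z≤n) (varPower-suc j k α) ⟩
  𝟙 (a ℕ.≟ 0) * varPower j (suc k) α ∎
  where open ≡-Reasoning

coeff-∏-x : ∀ k j α → coeff (∏ {k} (λ _ → x j)) α ≡ varPower j k α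
coeff-∏-x zero    j α = sym (varPower-0 j α)
coeff-∏-x (suc k) j α = trans (conv-cong (coeff-x j) (coeff-∏-x k j) α) (varPower-suc j k α)

dilate-varPower : ∀ k .{{_ : NonZero k}} j α → dilateCoeff k (varPower j 1) α ≡ varPower j k α
dilate-varPower (suc k) j []      = refl
dilate-varPower k@(suc _) zero    (a ∷ α) with k ∣? a
... | no k∤a = sym (trans (cong (_* coeff 1ₛ α) (𝟙-no (λ { refl → k∤a ∣.∣-refl }) (a ℕ.≟ k))) (ℚ.*-zeroˡ (coeff 1ₛ α)))
... | yes (divides q refl) = trans (dilateCoeff-scale k (𝟙 (q ℕ.≟ 1)) (coeff 1ₛ) α) (cong₂ _*_
  (𝟙-⇔ (λ { refl → ℕ.+-identityʳ k }) (λ eq → ℕ.*-cancelʳ-≡ q 1 k (trans eq (sym (ℕ.*-identityˡ k)))) (q ℕ.≟ 1) (q ℕ.* k ℕ.≟ k))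
  (dilate-1ₛ k α))
dilate-varPower k@(suc _) (suc j) (a ∷ α) with k ∣? a
... | no k∤a = sym (trans (cong (_* varPower j k α) (𝟙-no (λ { refl → k∤a (k ∣.∣0) }) (a ℕ.≟ 0))) (ℚ.*-zeroˡ (varPower j k α)))
... | yes (divides q refl) = trans (dilateCoeff-scale k (𝟙 (q ℕ.≟ 0)) (varPower j 1) α) (cong₂ _*_
  (𝟙-⇔ (λ { refl → refl }) (λ eq → ℕ.*-cancelʳ-≡ q 0 k eq) (q ℕ.≟ 0) (q ℕ.* k ℕ.≟ 0))
  (dilate-varPower k j α))

-- A monomial with coefficient 1 has this property, x₀ + x₁ does not. It turns the k equal weights
-- along a k-cycle into one weight dilated by k.
PowersAreDilations : Series → Set
PowersAreDilations s = ∀ k .{{_ : NonZero k}} → ∏ {k} (λ _ → s) ≈ₛ dilate k s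

x-powers : ∀ j → PowersAreDilations (x j)
x-powers j k α = trans (coeff-∏-x k j α) (sym (trans (dilateCoeff-cong k (coeff-x j) α) (dilate-varPower k j α)))

-- Interchanging the two products reduces the power of a product to powers of its factors. This
-- carries the property from the variables to the weights of G-structures.
∏-powers : ∀ {m} (s : Fin m → Series) → (∀ i → PowersAreDilations (s i)) → PowersAreDilations (∏ s)
∏-powers {m} s powers k α = begin
  coeff (∏ {k} (λ _ → ∏ s)) α             ≡⟨ Product.∑-comm {k} {m} (λ _ i → s i) α ⟩
  coeff (∏ (λ i → ∏ {k} (λ _ → s i))) α   ≡⟨ Product.sum-cong-≋ {m} (λ i → powers i k) α ⟩
  coeff (∏ (λ i → dilate k (s i))) α      ≡⟨ distribute s α ⟨
  coeff (dilate k (∏ s)) α                ∎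
  where
  open ≡-Reasoning
  distribute : ∀ {m} (s : Fin m → Series) → dilate k (∏ s) ≈ₛ ∏ (λ i → dilate k (s i))
  distribute {zero}  s = dilate-1ₛ k
  distribute {suc m} s β = trans (dilate-*ₛ k (s zero) (∏ (s ∘ suc)) β) (conv-cong (λ _ → refl) (distribute (s ∘ suc)) β)

-- Summable weighted sets

DecidableEquality : WeightedSet → Set
DecidableEquality A = Decidable (WeightedSet._≈_ A)

-- `_HasSum_` at one monomial with a rational in place of a series, so that a count at α need not
-- come with a coherent series.
HasSumAt : WeightedSet → List ℕ → ℚ → Set
HasSumAt A α q = Σ[ as ∈ List A.Carrier ]
    SetoidUnique.Unique A.setoid as
  × (∀ a → coeff (A.weight a) α ≢ 0ℚ → SetoidMembership._∈_ A.setoid a as)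
  × q ≡ Σˡ as (λ a → coeff (A.weight a) α)
  where module A = WeightedSet A

hasSumAt-unique : ∀ {A α q q′} → DecidableEquality A → HasSumAt A α q → HasSumAt A α q′ → q ≡ q′
hasSumAt-unique {A} {α} _≟_ (as , u , supp , refl) (as′ , u′ , supp′ , refl) =
  ListSums.Σˡ-unique A.setoid _≟_ (λ a≈b → A.weight-cong a≈b α) u u′ (λ {a} _ → supp′ a) (λ {a} _ → supp a)
  where module A = WeightedSet A

module _ (A B : WeightedSet) where
  private
    module A = WeightedSet A
    module B = WeightedSet B

  -- Surjectivity is up to ≈ and no inverse function is recorded, so no congruence of an inverse has
  -- to be shown; this much suffices to carry a list of summands across.
  record Correspondence : Set where
    field
      to         : A.Carrier → B.Carrier
      to-cong    : ∀ {a a′} → a A.≈ a′ → to a B.≈ to a′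
      injective  : ∀ {a a′} → to a B.≈ to a′ → a A.≈ a′
      surjective : ∀ b → Σ[ a ∈ A.Carrier ] to a B.≈ b
      preserves  : ∀ a → B.weight (to a) ≈ₛ A.weight a

module _ {A B : WeightedSet} (F : Correspondence A B) where
  private
    module A = WeightedSet A
    module B = WeightedSet B
    module B≈ = Setoid B.setoid
  open Correspondence F

  hasSumAt-transport : ∀ {α q} → HasSumAt A α q → HasSumAt B α q
  hasSumAt-transport {α} (as , u , supp , refl) =
    map to as , SetoidUniqueₚ.map⁺ A.setoid B.setoid injective u , supp′ ,
    sym (trans (Σˡ-map to as _) (Σˡ-cong as (λ a → preserves a α)))
    where
    supp′ : ∀ b → coeff (B.weight b) α ≢ 0ℚ → SetoidMembership._∈_ B.setoid b (map to as)
    supp′ b c≢0 with a , toa≈b ← surjective b =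
      SetoidMembershipₚ.∈-resp-≈ B.setoid toa≈b (SetoidMembershipₚ.∈-map⁺ A.setoid B.setoid to-cong
        (supp a (λ c≡0 → c≢0 (trans (B.weight-cong (B≈.sym toa≈b) α) (trans (preserves a α) c≡0)))))

  hasSum-transport : ∀ {s} → A HasSum s → B HasSum s
  hasSum-transport h α = hasSumAt-transport (h α)

Fixed-cong : ∀ {A} {e e′ : A ⇒ A} → (∀ a → WeightedSet._≈_ A (_⇒_.to e a) (_⇒_.to e′ a)) →
             Correspondence (Fixed e) (Fixed e′)
Fixed-cong {A} e≈e′ = record
  { to         = λ (a , ea≈a) → a , A≈.trans (A≈.sym (e≈e′ a)) ea≈a
  ; to-cong    = id
  ; injective  = id
  ; surjective = λ (a , e′a≈a) → (a , A≈.trans (e≈e′ a) e′a≈a) , A≈.refl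
  ; preserves  = λ _ _ → refl
  }
  where module A≈ = Setoid (WeightedSet.setoid A)

_⊗_ : WeightedSet → WeightedSet → WeightedSet
A ⊗ B = record
  { setoid      = ×-setoid A.setoid B.setoid
  ; weight      = λ (a , b) → A.weight a *ₛ B.weight b
  ; weight-cong = λ (a≈a′ , b≈b′) → conv-cong (A.weight-cong a≈a′) (B.weight-cong b≈b′)
  }
  where
  module A = WeightedSet A
  module B = WeightedSet B

module _ {A : WeightedSet} {s} (_≟_ : DecidableEquality A) (h : A HasSum s) where
  private
    module A = WeightedSet A
    module A≈ = Setoid A.setoid
    decSetoid : DecSetoid 0ℓ 0ℓ
    decSetoid = record { isDecEquivalence = record { isEquivalence = A≈.isEquivalence ; _≟_ = _≟_ } }
  open SetoidMembership A.setoid using () renaming (_∈_ to _∈ₛ_)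

  -- The lists given for different monomials may differ. Merging those of all divisors of x^α and
  -- removing duplicates gives one list that serves every coefficient entering a product at α.
  hasSum-below : ∀ α → Σ[ as ∈ List A.Carrier ] SetoidUnique.Unique A.setoid as
    × (∀ {β} → β ∈ below α → (∀ a → coeff (A.weight a) β ≢ 0ℚ → a ∈ₛ as)
                             × coeff s β ≡ Σˡ as (λ a → coeff (A.weight a) β))
  hasSum-below α = as , u , λ {β} β∈ → supp β∈ , trans (proj₂ (proj₂ (proj₂ (h β))))
      (ListSums.Σˡ-unique A.setoid _≟_ (λ a≈b → A.weight-cong a≈b β) (proj₁ (proj₂ (h β))) u
        (λ {a} _ → supp β∈ a) (λ {a} _ → proj₁ (proj₂ (proj₂ (h β))) a))
    where
    as : List A.Carrier
    as = deduplicate _≟_ (concatMap (λ β → proj₁ (h β)) (below α))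

    u : SetoidUnique.Unique A.setoid as
    u = DecSetoidUniqueₚ.deduplicate-! decSetoid (concatMap (λ β → proj₁ (h β)) (below α))

    supp : ∀ {β} → β ∈ below α → ∀ a → coeff (A.weight a) β ≢ 0ℚ → a ∈ₛ as
    supp {β} β∈ a c≢0 = SetoidMembershipₚ.∈-deduplicate⁺ A.setoid _≟_ (λ y≈z x≈y → A≈.trans x≈y (A≈.sym y≈z))
      (Any.concatMap⁺ (λ β → proj₁ (h β)) (Any.map (λ { refl → proj₁ (proj₂ (proj₂ (h β))) a c≢0 }) β∈))

hasSum-⊗ : ∀ {A B s t} → DecidableEquality A → DecidableEquality B →
           A HasSum s → B HasSum t → (A ⊗ B) HasSum (s *ₛ t)
hasSum-⊗ {A} {B} {s} {t} _≟A_ _≟B_ hA hB α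
  with as , uA , suppA ← hasSum-below {A} {s} _≟A_ hA α
     | bs , uB , suppB ← hasSum-below {B} {t} _≟B_ hB α =
  cartesianProduct as bs ,
  SetoidUniqueₚ.cartesianProduct⁺ A.setoid B.setoid uA uB ,
  (λ (a , b) c≢0 → let β , γ , (β∈ , γ∈) , (a≢0 , b≢0) , _ = conv-support α c≢0 in
    SetoidMembershipₚ.∈-cartesianProduct⁺ A.setoid B.setoid (proj₁ (suppA β∈) a a≢0) (proj₁ (suppB γ∈) b b≢0)) ,
  (begin
    conv (coeff s) (coeff t) α
      ≡⟨ conv-cong-below α (λ β∈ → proj₂ (suppA β∈)) (λ γ∈ → proj₂ (suppB γ∈)) ⟩
    conv (λ β → Σˡ as (λ a → coeff (A.weight a) β)) (λ γ → Σˡ bs (λ b → coeff (B.weight b) γ)) α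
      ≡⟨ conv-Σˡˡ as (λ a → coeff (A.weight a)) _ α ⟩
    Σˡ as (λ a → conv (coeff (A.weight a)) (λ γ → Σˡ bs (λ b → coeff (B.weight b) γ)) α)
      ≡⟨ Σˡ-cong as (λ a → conv-Σˡʳ (coeff (A.weight a)) bs (λ b → coeff (B.weight b)) α) ⟩
    Σˡ as (λ a → Σˡ bs (λ b → conv (coeff (A.weight a)) (coeff (B.weight b)) α))
      ≡⟨ Σˡ-cartesianProductWith _,_ as bs _ ⟨
    Σˡ (cartesianProduct as bs) (λ (a , b) → conv (coeff (A.weight a)) (coeff (B.weight b)) α) ∎)
  where
  open ≡-Reasoning
  module A = WeightedSet A
  module B = WeightedSet B

Dilated : ℕ → WeightedSet → WeightedSet
Dilated k A = record
  { setoid      = A.setoid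
  ; weight      = λ a → dilate k (A.weight a)
  ; weight-cong = λ a≈b → dilateCoeff-cong k (A.weight-cong a≈b)
  }
  where module A = WeightedSet A

hasSum-dilate : ∀ k {A s} → A HasSum s → Dilated k A HasSum dilate k s
hasSum-dilate k {A} {s} h α with dilateCoeff-cases k α
... | inj₂ d = [] , [] , (λ a c≢0 → contradiction (d (coeff (WeightedSet.weight A a))) c≢0) , d (coeff s)
... | inj₁ (β , _ , d) with as , u , supp , Σ≡ ← h β =
  as , u , (λ a c≢0 → supp a (λ c≡0 → c≢0 (trans (d (coeff (WeightedSet.weight A a))) c≡0))) ,
  trans (d (coeff s)) (trans Σ≡ (Σˡ-cong as (λ a → sym (d (coeff (WeightedSet.weight A a))))))

-- Sums over symmetric groups, by the cycle through 0

-- The index j is the preimage of 0. As `_∘ₚ_` applies its left argument first, the transposition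
-- brings j to 0, and `lift₀ π` then permutes the other points.
perms : ∀ n → List (Permutation′ n)
perms zero    = Perm.id ∷ []
perms (suc n) = cartesianProductWith (λ j π → transpose zero j ∘ₚ lift₀ π) (allFin (suc n)) (perms n)

permSetoid : ℕ → Setoid 0ℓ 0ℓ
permSetoid n = record
  { Carrier       = Permutation′ n
  ; _≈_           = Perm._≈_
  ; isEquivalence = record
    { refl  = λ _ → refl
    ; sym   = λ p i → sym (p i)
    ; trans = λ p q i → trans (p i) (q i)
    }
  }

_≟ₚ_ : ∀ {n} → Decidable (Perm._≈_ {n} {n})
σ ≟ₚ τ = Fin.all? (λ i → (σ ⟨$⟩ʳ i) Fin.≟ (τ ⟨$⟩ʳ i))

module _ {n : ℕ} where
  open SetoidMembership (permSetoid n) public using () renaming (_∈_ to _∈ₚ_)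

module PermSums n = ListSums (permSetoid n) _≟ₚ_

perm-injective : ∀ {m n} (π : Permutation m n) {i j} → π ⟨$⟩ʳ i ≡ π ⟨$⟩ʳ j → i ≡ j
perm-injective π eq = trans (sym (Perm.inverseˡ π)) (trans (cong (π ⟨$⟩ˡ_) eq) (Perm.inverseˡ π))

transpose-0-back : ∀ {n} (j : Fin (suc n)) → PC.transpose j zero zero ≡ j
transpose-0-back zero    = refl
transpose-0-back (suc j) = refl

transpose-0-j : ∀ {n} (j : Fin (suc n)) → PC.transpose zero j j ≡ zero
transpose-0-j zero    = refl
transpose-0-j (suc j) rewrite dec-true (j Fin.≟ j) refl = refl

transpose-0-other : ∀ {n} {i j : Fin n} → i ≢ j → PC.transpose zero (suc j) (suc i) ≡ suc i
transpose-0-other {i = i} {j} i≢j rewrite dec-false (i Fin.≟ j) i≢j = refl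

perms-complete : ∀ {n} (τ : Permutation′ n) → τ ∈ₚ perms n
perms-complete {zero}  τ = here λ ()
perms-complete {suc n} τ = Any.cartesianProductWith⁺ (λ j π → transpose zero j ∘ₚ lift₀ π)
  (λ {j} {π} → step {j} {π})
  (Membership.∈-allFin j₀) (perms-complete π₀)
  where
  j₀ = τ ⟨$⟩ˡ zero
  -- Undoing the transposition before applying τ yields a permutation that fixes 0, which `remove`
  -- restricts to the other points.
  σ = Perm.flip (transpose zero j₀) ∘ₚ τ
  π₀ = remove zero σ
  decompose : ∀ i → τ ⟨$⟩ʳ i ≡ lift₀ π₀ ⟨$⟩ʳ PC.transpose zero j₀ i
  decompose i = sym (trans
    (Perm.lift₀-remove σ (trans (cong (τ ⟨$⟩ʳ_) (transpose-0-back j₀)) (Perm.inverseʳ τ)) (PC.transpose zero j₀ i))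
    (cong (τ ⟨$⟩ʳ_) (PC.transpose-inverse j₀ zero)))
  step : ∀ {j π} → j₀ ≡ j → π₀ Perm.≈ π → τ Perm.≈ (transpose zero j ∘ₚ lift₀ π)
  step {j} {π} refl π₀≈π i = trans (decompose i) (Perm.lift₀-cong π₀ π π₀≈π (PC.transpose zero j i))

perms-unique : ∀ n → SetoidUnique.Unique (permSetoid n) (perms n)
perms-unique zero    = [] ∷ []
perms-unique (suc n) = SetoidUniqueₚ.cartesianProductWith⁺ (≡.setoid (Fin (suc n))) (permSetoid n) (permSetoid (suc n))
  (λ j π → transpose zero j ∘ₚ lift₀ π) inj (Unique.allFin⁺ (suc n)) (perms-unique n)
  where
  inj : ∀ {j j′ π π′} → (transpose zero j ∘ₚ lift₀ π) Perm.≈ (transpose zero j′ ∘ₚ lift₀ π′) → j ≡ j′ × π Perm.≈ π′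
  inj {j} {j′} {π} {π′} eq = j≡j′ , same j≡j′
    where
    sends : ∀ j (π : Permutation′ n) → (transpose zero j ∘ₚ lift₀ π) ⟨$⟩ʳ j ≡ zero
    sends j π = cong (lift₀ π ⟨$⟩ʳ_) (transpose-0-j j)
    j≡j′ = perm-injective (transpose zero j′ ∘ₚ lift₀ π′) (trans (sym (eq j)) (trans (sends j π) (sym (sends j′ π′))))
    same : j ≡ j′ → π Perm.≈ π′
    same refl i = Fin.suc-injective (begin
      lift₀ π ⟨$⟩ʳ suc i   ≡⟨ cong (lift₀ π ⟨$⟩ʳ_) (PC.transpose-inverse zero j) ⟨
      lift₀ π ⟨$⟩ʳ PC.transpose zero j (PC.transpose j zero (suc i))   ≡⟨ eq (PC.transpose j zero (suc i)) ⟩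
      lift₀ π′ ⟨$⟩ʳ PC.transpose zero j (PC.transpose j zero (suc i))  ≡⟨ cong (lift₀ π′ ⟨$⟩ʳ_) (PC.transpose-inverse zero j) ⟩
      lift₀ π′ ⟨$⟩ʳ suc i  ∎)
      where open ≡-Reasoning

length-perms : ∀ n → ι (length (perms n)) ≡ ι (n !)
length-perms n = trans (ι-length (perms n)) (go n)
  where
  open ≡-Reasoning
  go : ∀ n → Σˡ (perms n) (λ _ → 1ℚ) ≡ ι (n !)
  go zero    = refl
  go (suc n) = begin
    Σˡ (perms (suc n)) (λ _ → 1ℚ)
      ≡⟨ Σˡ-cartesianProductWith (λ j π → transpose zero j ∘ₚ lift₀ π) (allFin (suc n)) (perms n) (λ _ → 1ℚ) ⟩
    Σˡ (allFin (suc n)) (λ _ → Σˡ (perms n) (λ _ → 1ℚ))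
      ≡⟨ Σˡ-const (allFin (suc n)) _ ⟩
    ι (length (allFin (suc n))) * Σˡ (perms n) (λ _ → 1ℚ)
      ≡⟨ cong₂ (λ l s → ι l * s) (length-tabulate {n = suc n} id) (go n) ⟩
    ι (suc n) * ι (n !)
      ≡⟨ ι-* (suc n) (n !) ⟨
    ι (suc n !) ∎

-- It is applied to conjugation by a transposition and to translation by a group element.
Σˡ-perms-reindex : ∀ {n} (φ φ⁻¹ : Permutation′ n → Permutation′ n) →
  (∀ {σ τ} → σ Perm.≈ τ → φ σ Perm.≈ φ τ) → (∀ {σ τ} → φ σ Perm.≈ φ τ → σ Perm.≈ τ) → (∀ τ → φ (φ⁻¹ τ) Perm.≈ τ) →
  ∀ {g : Permutation′ n → ℚ} → PermSums.Respects n g → Σˡ (perms n) (g ∘ φ) ≡ Σˡ (perms n) g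
Σˡ-perms-reindex {n} φ φ⁻¹ φ-cong φ-inj φφ⁻¹ {g} resp = trans (sym (Σˡ-map φ (perms n) g))
  (PermSums.Σˡ-unique n (λ {σ} {τ} → resp {σ} {τ})
    (SetoidUniqueₚ.map⁺ (permSetoid n) (permSetoid n) (λ {σ} {τ} → φ-inj {σ} {τ}) (perms-unique n)) (perms-unique n)
    (λ {τ} _ _ → perms-complete τ)
    (λ {τ} _ _ → SetoidMembershipₚ.∈-resp-≈ (permSetoid n) {_} {φ (φ⁻¹ τ)} {τ} (φφ⁻¹ τ)
      (SetoidMembershipₚ.∈-map⁺ (permSetoid n) (permSetoid n) {φ} (λ {σ} {τ} → φ-cong {σ} {τ}) {φ⁻¹ τ} (perms-complete (φ⁻¹ τ)))))

Intertwines : ∀ {m n} → Permutation m n → Permutation′ m → Permutation′ n → Set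
Intertwines θ σ τ = ∀ i → θ ⟨$⟩ʳ (σ ⟨$⟩ʳ i) ≡ τ ⟨$⟩ʳ (θ ⟨$⟩ʳ i)

-- The conjugating bijection may join different sizes, so that a permutation of `Fin (sum κ)` is
-- comparable with one of `Fin m`.
IsClassFamily : (∀ n → Permutation′ n → ℚ) → Set
IsClassFamily Φ = ∀ {m n} (θ : Permutation m n) (σ : Permutation′ m) (τ : Permutation′ n) → Intertwines θ σ τ → Φ m σ ≡ Φ n τ

-- Conjugacy by a bijection that fixes 0. Ordinary conjugacy is too coarse: `extend` inserts its new
-- point in the cycle of 0, so the result depends on which cycle contains 0.
_~₀_ : ∀ {m n} → Permutation′ (suc m) → Permutation′ (suc n) → Set
_~₀_ {m} {n} σ τ = Σ[ θ ∈ Permutation m n ] Intertwines (lift₀ θ) σ τ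

≈⇒~₀ : ∀ {n} (σ τ : Permutation′ (suc n)) → σ Perm.≈ τ → σ ~₀ τ
≈⇒~₀ σ τ eq = Perm.id , λ i → trans (Perm.lift₀-id _) (trans (eq i) (cong (τ ⟨$⟩ʳ_) (sym (Perm.lift₀-id i))))

-- Inserts a new point, numbered 0, between the old point 0 and its image; the
-- old points are renumbered by suc.
extend : ∀ {n} → Permutation′ (suc n) → Permutation′ (suc (suc n))
extend σ = transpose zero (suc zero) ∘ₚ lift₀ σ

extend-~₀ : ∀ {m n} (σ : Permutation′ (suc m)) (τ : Permutation′ (suc n)) → σ ~₀ τ → extend σ ~₀ extend τ
extend-~₀ σ τ (θ , eq) = lift₀ θ , λ where
  zero          → cong suc (eq zero)
  (suc zero)    → refl
  (suc (suc i)) → cong suc (eq (suc i))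

extend^ : ∀ k {n} → Permutation′ (suc n) → Permutation′ (suc (k ℕ.+ n))
extend^ zero    σ = σ
extend^ (suc k) σ = extend (extend^ k σ)

extend^-~₀ : ∀ k {m n} (σ : Permutation′ (suc m)) (τ : Permutation′ (suc n)) → σ ~₀ τ → extend^ k σ ~₀ extend^ k τ
extend^-~₀ zero    σ τ p = p
extend^-~₀ (suc k) σ τ p = extend-~₀ (extend^ k σ) (extend^ k τ) (extend^-~₀ k σ τ p)

-- The sizes `k + suc n` and `suc k + n` agree only propositionally, so the two permutations are
-- related by `_~₀_` and not pointwise.
extend^-extend : ∀ k {n} (σ : Permutation′ (suc n)) → extend^ k (extend σ) ~₀ extend^ (suc k) σ
extend^-extend zero    σ = ≈⇒~₀ (extend σ) (extend σ) (λ _ → refl)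
extend^-extend (suc k) σ = extend-~₀ (extend^ k (extend σ)) (extend^ (suc k) σ) (extend^-extend k σ)

infixr 6 _⊕_

-- The shape is that of `standard`, so `standard (k ∷ κ)` is `cycle k ⊕ standard κ` by definition.
_⊕_ : ∀ {k l m n} → Permutation k l → Permutation m n → Permutation (k ℕ.+ m) (l ℕ.+ n)
σ ⊕ τ = ↔-sym Fin.+↔⊎ ↔-∘ ((σ ⊎-↔ τ) ↔-∘ Fin.+↔⊎)

cycle-⊕-zero : ∀ {n} (π : Permutation′ n) → lift₀ π Perm.≈ (cycle 1 ⊕ π)
cycle-⊕-zero π zero    = refl
cycle-⊕-zero π (suc i) = refl

-- The standard cycle runs downwards: it sends the old 0, now numbered 1, to the new 0, and the new
-- 0 to the last point of the block, just as `extend` does.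
cycle-⊕-suc : ∀ k {n} (π : Permutation′ n) → extend (cycle (suc k) ⊕ π) Perm.≈ (cycle (suc (suc k)) ⊕ π)
cycle-⊕-suc k π zero       = refl
cycle-⊕-suc k π (suc zero) = refl
cycle-⊕-suc k π (suc (suc i)) with splitAt k i
... | inj₁ a = refl
... | inj₂ b = refl

-- In `lift₀ π` the point 0 forms a cycle of length 1, and each insertion lengthens that cycle by
-- one.
extend^-lift₀ : ∀ k {n} (π : Permutation′ n) → extend^ k (lift₀ π) Perm.≈ (cycle (suc k) ⊕ π)
extend^-lift₀ zero    π   = cycle-⊕-zero π
extend^-lift₀ (suc k) π i = trans
  (Perm.lift₀-cong (extend^ k (lift₀ π)) (cycle (suc k) ⊕ π) (extend^-lift₀ k π) (PC.transpose zero (suc zero) i))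
  (cycle-⊕-suc k π i)

module _ {n : ℕ} {Ψ : Permutation′ (suc n) → ℚ} (inv : ∀ σ τ → σ ~₀ τ → Ψ σ ≡ Ψ τ) where

  Σˡ-perms-split : Σˡ (perms (suc n)) Ψ ≡
    Σˡ (perms n) (Ψ ∘ lift₀) + Σˡ (allFin n) (λ j → Σˡ (perms n) (λ π → Ψ (transpose zero (suc j) ∘ₚ lift₀ π)))
  Σˡ-perms-split = trans
    (Σˡ-cartesianProductWith (λ j π → transpose zero j ∘ₚ lift₀ π) (allFin (suc n)) (perms n) Ψ)
    (cong₂ _+_
      (Σˡ-cong (perms n) (λ π → inv _ _ (≈⇒~₀ (transpose zero zero ∘ₚ lift₀ π) (lift₀ π) (transpose-0-0 π))))
      (trans (cong (λ js → Σˡ js (λ j → Σˡ (perms n) (λ π → Ψ (transpose zero j ∘ₚ lift₀ π)))) (sym (map-tabulate {n = n} id suc)))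
             (Σˡ-map suc (allFin n) _)))
    where
    transpose-0-0 : ∀ (π : Permutation′ n) → (transpose zero zero ∘ₚ lift₀ π) Perm.≈ lift₀ π
    transpose-0-0 π zero    = refl
    transpose-0-0 π (suc i) = refl

-- The first sum collects the permutations fixing 0. In all others the preimage of 0 is one of
-- `suc n` points, and each choice gives the same sum, since a conjugation fixing 0 moves the
-- preimage to 1.
Σˡ-perms-extend : ∀ {n} {Ψ : Permutation′ (suc (suc n)) → ℚ} → (∀ σ τ → σ ~₀ τ → Ψ σ ≡ Ψ τ) →
  Σˡ (perms (suc (suc n))) Ψ ≡ Σˡ (perms (suc n)) (Ψ ∘ lift₀) + ι (suc n) * Σˡ (perms (suc n)) (Ψ ∘ extend)
Σˡ-perms-extend {n} {Ψ} inv = trans (Σˡ-perms-split inv) (cong (Σˡ (perms (suc n)) (Ψ ∘ lift₀) +_) (begin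
  Σˡ (allFin (suc n)) (λ j → Σˡ (perms (suc n)) (λ π → Ψ (transpose zero (suc j) ∘ₚ lift₀ π)))
    ≡⟨ Σˡ-cong (allFin (suc n)) move ⟩
  Σˡ (allFin (suc n)) (λ _ → Σˡ (perms (suc n)) (Ψ ∘ extend))
    ≡⟨ Σˡ-const (allFin (suc n)) _ ⟩
  ι (length (allFin (suc n))) * Σˡ (perms (suc n)) (Ψ ∘ extend)
    ≡⟨ cong (λ l → ι l * Σˡ (perms (suc n)) (Ψ ∘ extend)) (length-tabulate {n = suc n} id) ⟩
  ι (suc n) * Σˡ (perms (suc n)) (Ψ ∘ extend) ∎))
  where
  open ≡-Reasoning
  -- Conjugation by the transposition ρ of 0 and j, acting on the nonzero
  -- points, turns the transposition of 0 and j + 1 into that of 0 and 1.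
  move : ∀ j → Σˡ (perms (suc n)) (λ π → Ψ (transpose zero (suc j) ∘ₚ lift₀ π)) ≡ Σˡ (perms (suc n)) (Ψ ∘ extend)
  move j = trans
    (Σˡ-cong (perms (suc n)) (λ π → inv (transpose zero (suc j) ∘ₚ lift₀ π) (extend (conj π)) (ρ , conjugates π)))
    (Σˡ-perms-reindex conj (λ τ → ρ ∘ₚ τ ∘ₚ Perm.flip ρ)
      (λ eq i → cong (ρ ⟨$⟩ʳ_) (eq (ρ ⟨$⟩ˡ i)))
      (λ {σ} {τ} eq i → trans (cong (σ ⟨$⟩ʳ_) (sym (Perm.inverseˡ ρ))) (trans (perm-injective ρ (eq (ρ ⟨$⟩ʳ i))) (cong (τ ⟨$⟩ʳ_) (Perm.inverseˡ ρ))))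
      (λ τ i → trans (Perm.inverseʳ ρ) (cong (τ ⟨$⟩ʳ_) (Perm.inverseʳ ρ)))
      (λ {σ} {τ} eq → inv (extend σ) (extend τ) (extend-~₀ σ τ (≈⇒~₀ σ τ eq))))
    where
    ρ = transpose zero j
    conj : Permutation′ (suc n) → Permutation′ (suc n)
    conj π = Perm.flip ρ ∘ₚ π ∘ₚ ρ
    ρj≡0 : ρ ⟨$⟩ʳ j ≡ zero
    ρj≡0 = transpose-0-j j
    0≡ : PC.transpose j zero zero ≡ j
    0≡ = transpose-0-back j
    extend-suc : ∀ (σ : Permutation′ (suc n)) {k} → k ≢ zero → extend σ ⟨$⟩ʳ suc k ≡ suc (σ ⟨$⟩ʳ k)
    extend-suc σ {zero}  k≢0 = contradiction refl k≢0
    extend-suc σ {suc k} k≢0 = refl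
    conjugates-suc : ∀ π i → Dec (i ≡ j) →
      lift₀ ρ ⟨$⟩ʳ ((transpose zero (suc j) ∘ₚ lift₀ π) ⟨$⟩ʳ suc i) ≡ extend (conj π) ⟨$⟩ʳ suc (ρ ⟨$⟩ʳ i)
    conjugates-suc π i (yes refl) = trans
      (cong (λ k → lift₀ ρ ⟨$⟩ʳ (lift₀ π ⟨$⟩ʳ k)) (transpose-0-j (suc i)))
      (cong (λ k → extend (conj π) ⟨$⟩ʳ suc k) (sym ρj≡0))
    conjugates-suc π i (no i≢j) = trans
      (cong (λ k → lift₀ ρ ⟨$⟩ʳ (lift₀ π ⟨$⟩ʳ k)) (transpose-0-other i≢j))
      (sym (trans (extend-suc (conj π) (λ ρi≡0 → i≢j (perm-injective ρ (trans ρi≡0 (sym ρj≡0)))))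
                  (cong (λ k → suc (ρ ⟨$⟩ʳ (π ⟨$⟩ʳ k))) (Perm.inverseˡ ρ))))
    conjugates : ∀ π → Intertwines (lift₀ ρ) (transpose zero (suc j) ∘ₚ lift₀ π) (extend (conj π))
    conjugates π zero    = cong (λ k → suc (ρ ⟨$⟩ʳ (π ⟨$⟩ʳ k))) (sym 0≡)
    conjugates π (suc i) = conjugates-suc π i (i Fin.≟ j)

module _ {Φ : ∀ n → Permutation′ n → ℚ} (class : IsClassFamily Φ) where
  private
    class₀ : ∀ {m n} (σ : Permutation′ (suc m)) (τ : Permutation′ (suc n)) → σ ~₀ τ → Φ (suc m) σ ≡ Φ (suc n) τ
    class₀ σ τ (θ , eq) = class (lift₀ θ) σ τ eq

  -- Splits off the cycle through 0, according to its length.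
  Σˡ-perms-cycles : ∀ (g : ℕ → ℕ → ℚ) n →
    (∀ k j → j ≤ n → Σˡ (perms j) (λ π → Φ (suc k ℕ.+ j) (cycle (suc k) ⊕ π)) ≡ ι (j !) * g k j) →
    Σˡ (perms (suc n)) (Φ (suc n)) ≡ ι (n !) * antidiag n g
  Σˡ-perms-cycles g n hyp = go 0 n hyp
    where
    open ≡-Reasoning
    shape : ∀ k {n} (π : Permutation′ n) → Φ (suc k ℕ.+ n) (extend^ k (lift₀ π)) ≡ Φ (suc k ℕ.+ n) (cycle (suc k) ⊕ π)
    shape k π = class Perm.id (extend^ k (lift₀ π)) (cycle (suc k) ⊕ π) (extend^-lift₀ k π)

    -- `k` counts the points inserted into the cycle through 0 so far. Either 0 is fixed by π, and
    -- the cycle has length `suc k`, or one more point is split off; the factor `suc n` from that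
    -- choice turns n! into (n+1)!.
    go : ∀ k n → (∀ l j → j ≤ n → Σˡ (perms j) (λ π → Φ (suc l ℕ.+ j) (cycle (suc l) ⊕ π)) ≡ ι (j !) * g l j) →
         Σˡ (perms (suc n)) (λ π → Φ (suc k ℕ.+ n) (extend^ k π)) ≡ ι (n !) * antidiag n (λ i j → g (k ℕ.+ i) j)
    go k zero hyp = begin
      Σˡ (perms 1) (λ π → Φ (suc k ℕ.+ 0) (extend^ k π))
        ≡⟨ Σˡ-perms-split {0} {λ π → Φ (suc k ℕ.+ 0) (extend^ k π)} (λ σ τ p → class₀ (extend^ k σ) (extend^ k τ) (extend^-~₀ k σ τ p)) ⟩
      Σˡ (perms 0) (λ π → Φ (suc k ℕ.+ 0) (extend^ k (lift₀ π))) + 0ℚ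
        ≡⟨ ℚ.+-identityʳ _ ⟩
      Σˡ (perms 0) (λ π → Φ (suc k ℕ.+ 0) (extend^ k (lift₀ π)))
        ≡⟨ Σˡ-cong (perms 0) (shape k) ⟩
      Σˡ (perms 0) (λ π → Φ (suc k ℕ.+ 0) (cycle (suc k) ⊕ π))
        ≡⟨ hyp k 0 z≤n ⟩
      ι (0 !) * g k 0
        ≡⟨ cong (λ l → ι (0 !) * g l 0) (ℕ.+-identityʳ k) ⟨
      ι (0 !) * g (k ℕ.+ 0) 0 ∎
    go k (suc n) hyp = begin
      Σˡ (perms (suc (suc n))) (λ π → Φ (suc k ℕ.+ suc n) (extend^ k π))
        ≡⟨ Σˡ-perms-extend {n} {λ π → Φ (suc k ℕ.+ suc n) (extend^ k π)} (λ σ τ p → class₀ (extend^ k σ) (extend^ k τ) (extend^-~₀ k σ τ p)) ⟩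
      Σˡ (perms (suc n)) (λ π → Φ (suc k ℕ.+ suc n) (extend^ k (lift₀ π))) +
      ι (suc n) * Σˡ (perms (suc n)) (λ π → Φ (suc k ℕ.+ suc n) (extend^ k (extend π)))
        ≡⟨ cong₂ (λ s t → s + ι (suc n) * t)
             (trans (Σˡ-cong (perms (suc n)) (shape k)) (hyp k (suc n) ℕ.≤-refl))
             (trans (Σˡ-cong (perms (suc n)) (λ π → class₀ (extend^ k (extend π)) (extend^ (suc k) π) (extend^-extend k π)))
                    (go (suc k) n (λ l j j≤n → hyp l j (ℕ.m≤n⇒m≤1+n j≤n)))) ⟩
      ι (suc n !) * g k (suc n) + ι (suc n) * (ι (n !) * rest (suc k))
        ≡⟨ cong (ι (suc n !) * g k (suc n) +_) (trans (sym (ℚ.*-assoc (ι (suc n)) (ι (n !)) _)) (cong (_* rest (suc k)) (sym (ι-* (suc n) (n !))))) ⟩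
      ι (suc n !) * g k (suc n) + ι (suc n !) * rest (suc k)
        ≡⟨ ℚ.*-distribˡ-+ (ι (suc n !)) _ _ ⟨
      ι (suc n !) * (g k (suc n) + rest (suc k))
        ≡⟨ cong (ι (suc n !) *_) (cong₂ _+_ (cong (λ l → g l (suc n)) (sym (ℕ.+-identityʳ k)))
             (antidiag-cong n (λ i j → cong (λ l → g l j) (sym (ℕ.+-suc k i))))) ⟩
      ι (suc n !) * antidiag (suc n) (λ i j → g (k ℕ.+ i) j) ∎
      where
      rest : ℕ → ℚ
      rest l = antidiag n (λ i j → g (l ℕ.+ i) j)

-- Partitions up to permutation

≥-decTotalOrder = Flip.decTotalOrder ℕ.≤-decTotalOrder

open Sort ≥-decTotalOrder using (sort; sort-↭; sort-↗)

sorted-↭⇒≡ : ∀ {κ κ′} → Linked _≥_ κ → Linked _≥_ κ′ → κ ↭ κ′ → κ ≡ κ′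
sorted-↭⇒≡ κ↘ κ′↘ p = Pointwise.Pointwise-≡⇒≡ (Sorted.↗↭↗⇒≋ (Flip.totalOrder ℕ.≤-totalOrder) κ↘ κ′↘ (↭.↭⇒↭ₛ p))

_↭?_ : Decidable (_↭_ {A = ℕ})
κ ↭? κ′ = map′
  (λ eq → ↭-trans (↭-sym (sort-↭ κ)) (subst (_↭ κ′) (sym eq) (sort-↭ κ′)))
  (λ p → sorted-↭⇒≡ (sort-↗ κ) (sort-↗ κ′) (↭-trans (sort-↭ κ) (↭-trans p (↭-sym (sort-↭ κ′)))))
  (≡-dec ℕ._≟_ (sort κ) (sort κ′))

-- Partitions are compared up to permutation, so that putting a part in front needs no sorting;
-- decreasing representatives return in `χ-frobenius`.
↭-setoidℕ : Setoid 0ℓ 0ℓ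
↭-setoidℕ = ↭.↭-setoid {A = ℕ}

module PartitionSums = ListSums ↭-setoidℕ _↭?_
open SetoidMembership ↭-setoidℕ using () renaming (_∈_ to _∈↭_)
open SetoidUnique ↭-setoidℕ using () renaming (Unique to Unique↭)

multiplicity-∷-≡ : ∀ i κ → multiplicity i (i ∷ κ) ≡ suc (multiplicity i κ)
multiplicity-∷-≡ i κ = cong length (filter-accept (i ℕ.≟_) {i} {κ} refl)

multiplicity-∷-≢ : ∀ {i k} κ → i ≢ k → multiplicity i (k ∷ κ) ≡ multiplicity i κ
multiplicity-∷-≢ {i} {k} κ i≢k = cong length (filter-reject (i ℕ.≟_) {k} {κ} i≢k)

multiplicity-↭ : ∀ i {κ κ′} → κ ↭ κ′ → multiplicity i κ ≡ multiplicity i κ′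
multiplicity-↭ i p = ↭.↭-length (↭.filter-↭ (i ℕ.≟_) p)

multiplicity-< : ∀ i {κ} → All (_< i) κ → multiplicity i κ ≡ 0
multiplicity-< i []                  = refl
multiplicity-< i {k ∷ κ} (k<i ∷ κ<i) = trans (multiplicity-∷-≢ κ (ℕ.>⇒≢ k<i)) (multiplicity-< i κ<i)

multiplicity-replicate : ∀ i j {κ} → All (_< i) κ → multiplicity i (replicate j i ++ κ) ≡ j
multiplicity-replicate i zero        κ<i = multiplicity-< i κ<i
multiplicity-replicate i (suc j) {κ} κ<i = trans
  (multiplicity-∷-≡ i (replicate j i ++ κ)) (cong suc (multiplicity-replicate i j κ<i))

multiplicity≢0⇒∈ : ∀ i κ → multiplicity i κ ≢ 0 → i ∈ κ
multiplicity≢0⇒∈ i []      ≢0 = contradiction refl ≢0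
multiplicity≢0⇒∈ i (k ∷ κ) ≢0 with i ℕ.≟ k
... | yes i≡k = here i≡k
... | no  i≢k = there (multiplicity≢0⇒∈ i κ (λ ≡0 → ≢0 (trans (multiplicity-∷-≢ κ i≢k) ≡0)))

remove-part : ∀ i {κ} → i ∈ κ → Σ[ κ′ ∈ List ℕ ] κ ↭ i ∷ κ′
remove-part i i∈κ with ys , zs , refl ← Membership.∈-∃++ i∈κ = ys ++ zs , ↭.shift i ys zs

-- The last component, quantified over every `P`, expresses that all entries of `κ′` come from `κ`.
extract-part : ∀ i κ → Σ[ κ′ ∈ List ℕ ] κ ↭ replicate (multiplicity i κ) i ++ κ′ × All (i ≢_) κ′ × (∀ {P : ℕ → Set} → All P κ → All P κ′)
extract-part i []      = [] , ↭-refl , [] , id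
extract-part i (k ∷ κ) with i ℕ.≟ k | extract-part i κ
... | yes refl | κ′ , p , i∉ , all rewrite multiplicity-∷-≡ i κ = κ′ , prep k p , i∉ , λ { (_ ∷ ps) → all ps }
... | no  i≢k  | κ′ , p , i∉ , all rewrite multiplicity-∷-≢ κ i≢k =
  k ∷ κ′ , ↭-trans (prep k p) (↭-sym (↭.shift k (replicate (multiplicity i κ) i) κ′)) , i≢k ∷ i∉ , λ { (pk ∷ ps) → pk ∷ all ps }

sum-replicate : ∀ j i κ → sum (replicate j i ++ κ) ≡ j ℕ.* i ℕ.+ sum κ
sum-replicate zero    i κ = refl
sum-replicate (suc j) i κ = trans (cong (i ℕ.+_) (sum-replicate j i κ)) (sym (ℕ.+-assoc i _ _))

PartsUpTo : ℕ → List ℕ → Set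
PartsUpTo k = All (λ p → 0 < p × p ≤ k)

linked-∷ : ∀ {k κ} → All (_≤ k) κ → Linked _≥_ κ → Linked _≥_ (k ∷ κ)
linked-∷ []        []           = [-]
linked-∷ (p≤k ∷ _) linked@[-]     = p≤k ∷ linked
linked-∷ (p≤k ∷ _) linked@(_ ∷ _) = p≤k ∷ linked

linked-replicate : ∀ j {k κ} → All (_≤ k) κ → Linked _≥_ κ → Linked _≥_ (replicate j k ++ κ)
linked-replicate zero    κ≤k κ↘ = κ↘
linked-replicate (suc j) κ≤k κ↘ = linked-∷ (All.++⁺ (All.replicate⁺ j ℕ.≤-refl) κ≤k) (linked-replicate j κ≤k κ↘)

record IsPartitionUpTo (k m : ℕ) (κ : List ℕ) : Set where
  field
    sum≡   : sum κ ≡ m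
    bounds : PartsUpTo k κ
    linked : Linked _≥_ κ

multiples : ℕ → ℕ → List ℕ
multiples k m = filter (λ j → j ℕ.* suc k ℕ.≤? m) (upTo (suc m))

withMultiplicity : ℕ → ℕ → ℕ → List (List ℕ)
withMultiplicity k m j = map (replicate j (suc k) ++_) (partitionsUpTo k (m ∸ j ℕ.* suc k))

partitionsUpTo-sound : ∀ k m → All (IsPartitionUpTo k m) (partitionsUpTo k m)
partitionsUpTo-sound zero    zero    = record { sum≡ = refl ; bounds = [] ; linked = [] } ∷ []
partitionsUpTo-sound zero    (suc m) = []
partitionsUpTo-sound (suc k) m       = All.concat⁺ (All.map⁺ {xs = multiples k m} (All.map (λ {j} → sound {j}) (All.all-filter (λ j → j ℕ.* suc k ℕ.≤? m) (upTo (suc m)))))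
  where
  sound : ∀ {j} → j ℕ.* suc k ≤ m → All (IsPartitionUpTo (suc k) m) (withMultiplicity k m j)
  sound {j} jk≤m = All.map⁺ (All.map extend-partition (partitionsUpTo-sound k (m ∸ j ℕ.* suc k)))
    where
    extend-partition : ∀ {κ} → IsPartitionUpTo k (m ∸ j ℕ.* suc k) κ → IsPartitionUpTo (suc k) m (replicate j (suc k) ++ κ)
    extend-partition {κ} κ-part = record
      { sum≡   = trans (sum-replicate j (suc k) κ) (trans (cong (j ℕ.* suc k ℕ.+_) sum≡) (ℕ.m+[n∸m]≡n jk≤m))
      ; bounds = All.++⁺ (All.replicate⁺ j (s≤s z≤n , ℕ.≤-refl)) (All.map (λ (0<p , p≤k) → 0<p , ℕ.m≤n⇒m≤1+n p≤k) bounds)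
      ; linked = linked-replicate j (All.map (λ (_ , p≤k) → ℕ.m≤n⇒m≤1+n p≤k) bounds) linked
      }
      where open IsPartitionUpTo κ-part

-- The branch to follow is the actual multiplicity of `suc k` in `κ`. As `κ` need not be decreasing,
-- the copies of that part are first gathered in front.
partitionsUpTo-complete : ∀ k m κ → PartsUpTo k κ → sum κ ≡ m → κ ∈↭ partitionsUpTo k m
partitionsUpTo-complete zero    m       (p ∷ κ) ((0<p , p≤0) ∷ _) _    = contradiction (ℕ.<-≤-trans 0<p p≤0) (ℕ.<-irrefl refl)
partitionsUpTo-complete zero    .0      []      _                 refl = here ↭-refl
partitionsUpTo-complete (suc k) m       κ       bounds            refl
  with κ′ , κ↭ , ∉κ′ , keep ← extract-part (suc k) κ =
  Any.concatMap⁺ (withMultiplicity k m) (Any.map (λ { {j} refl → member }) j∈)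
  where
  open ≡-Reasoning
  j = multiplicity (suc k) κ
  sum-κ : sum κ ≡ j ℕ.* suc k ℕ.+ sum κ′
  sum-κ = trans (sum-↭ κ↭) (sum-replicate j (suc k) κ′)
  jk≤m : j ℕ.* suc k ≤ m
  jk≤m = subst (j ℕ.* suc k ≤_) (sym sum-κ) (ℕ.m≤m+n _ (sum κ′))
  j∈ : j ∈ multiples k m
  j∈ = Membership.∈-filter⁺ (λ j → j ℕ.* suc k ℕ.≤? m) (Membership.∈-upTo⁺ (s≤s (ℕ.≤-trans (ℕ.m≤m*n j (suc k)) jk≤m))) jk≤m
  bounds′ : PartsUpTo k κ′
  bounds′ = All.zipWith (λ { ((0<p , p≤1+k) , 1+k≢p) → 0<p , ℕ.s≤s⁻¹ (ℕ.≤∧≢⇒< p≤1+k (1+k≢p ∘ sym)) }) (keep bounds , ∉κ′)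
  sum-κ′ : sum κ′ ≡ m ∸ j ℕ.* suc k
  sum-κ′ = begin
    sum κ′                                      ≡⟨ ℕ.m+n∸m≡n (j ℕ.* suc k) (sum κ′) ⟨
    j ℕ.* suc k ℕ.+ sum κ′ ∸ j ℕ.* suc k        ≡⟨ cong (_∸ j ℕ.* suc k) sum-κ ⟨
    m ∸ j ℕ.* suc k                             ∎
  member : κ ∈↭ withMultiplicity k m j
  member = Any.map⁺ (Any.map (λ κ′↭ → ↭-trans κ↭ (↭.++⁺ˡ (replicate j (suc k)) κ′↭))
    (partitionsUpTo-complete k (m ∸ j ℕ.* suc k) κ′ bounds′ sum-κ′))

++-cancelˡ-↭ : ∀ (κ : List ℕ) {ν ν′} → κ ++ ν ↭ κ ++ ν′ → ν ↭ ν′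
++-cancelˡ-↭ []      p = p
++-cancelˡ-↭ (k ∷ κ) p = ++-cancelˡ-↭ κ (↭.drop-∷ p)

-- Lists from different branches are not permutations of each other because they contain `suc k`
-- with different multiplicities; within one branch the common prefix cancels.
partitionsUpTo-unique : ∀ k m → Unique↭ (partitionsUpTo k m)
partitionsUpTo-unique zero    zero    = [] ∷ []
partitionsUpTo-unique zero    (suc m) = []
partitionsUpTo-unique (suc k) m       = SetoidUniqueₚ.concat⁺ ↭-setoidℕ
  (All.map⁺ (All.universal (λ j → SetoidUniqueₚ.map⁺ ↭-setoidℕ ↭-setoidℕ (++-cancelˡ-↭ (replicate j (suc k))) (partitionsUpTo-unique k _)) (multiples k m)))
  (AllPairs.map⁺ (AllPairs.map (λ {i} {j} i≢j {v} (v∈ , v∈′) → i≢j (trans (sym (mult {v} {i} v∈)) (mult {v} {j} v∈′))) (Unique.filter⁺ (λ j → j ℕ.* suc k ℕ.≤? m) (Unique.upTo⁺ (suc m)))))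
  where
  mult : ∀ {v j} → v ∈↭ withMultiplicity k m j → multiplicity (suc k) v ≡ j
  mult {v} {j} v∈ = find (Any.map⁻ v∈) (partitionsUpTo-sound k _)
    where
    find : ∀ {κs} → Any (λ κ → v ↭ replicate j (suc k) ++ κ) κs → All (IsPartitionUpTo k (m ∸ j ℕ.* suc k)) κs → multiplicity (suc k) v ≡ j
    find (here p)  (κ-part ∷ _) = trans (multiplicity-↭ (suc k) p)
      (multiplicity-replicate (suc k) j (All.map (s≤s ∘ proj₂) (IsPartitionUpTo.bounds κ-part)))
    find (there q) (_ ∷ sound)  = find q sound

part≤sum : ∀ κ → All (_≤ sum κ) κ
part≤sum []      = []
part≤sum (k ∷ κ) = ℕ.m≤m+n k (sum κ) ∷ All.map (λ p≤ → ℕ.≤-trans p≤ (ℕ.m≤n+m (sum κ) k)) (part≤sum κ)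

partitionsOf-complete : ∀ {m} κ → All (0 <_) κ → sum κ ≡ m → κ ∈↭ partitionsOf m
partitionsOf-complete κ positive refl = partitionsUpTo-complete (sum κ) (sum κ) κ (All.zip (positive , part≤sum κ)) refl

partitionsOf-sound : ∀ m → All (IsPartitionUpTo m m) (partitionsOf m)
partitionsOf-sound m = partitionsUpTo-sound m m

partitionsOf-unique : ∀ m → Unique↭ (partitionsOf m)
partitionsOf-unique m = partitionsUpTo-unique m m

-- The numbers z_κ and the removal of a part

zFactor : List ℕ → ℕ → ℕ
zFactor κ i = i ^ multiplicity i κ ℕ.* multiplicity i κ !

-- In `z` the range of the product varies with the sum of κ. A free bound N makes κ and `k ∷ κ`
-- comparable; factors beyond the largest part are 1.
zUpTo : ℕ → List ℕ → ℕ
zUpTo N κ = product (map (zFactor κ) (applyUpTo suc N))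

zUpTo-suc : ∀ N κ → zUpTo (suc N) κ ≡ zUpTo N κ ℕ.* zFactor κ (suc N)
zUpTo-suc N κ = begin
  product (map (zFactor κ) (applyUpTo suc (suc N)))
    ≡⟨ cong (product ∘ map (zFactor κ)) (applyUpTo-∷ʳ suc N) ⟨
  product (map (zFactor κ) (applyUpTo suc N ++ suc N ∷ []))
    ≡⟨ cong product (map-++ (zFactor κ) (applyUpTo suc N) (suc N ∷ [])) ⟩
  product (map (zFactor κ) (applyUpTo suc N) ++ zFactor κ (suc N) ∷ [])
    ≡⟨ product-++ (map (zFactor κ) (applyUpTo suc N)) (zFactor κ (suc N) ∷ []) ⟩
  zUpTo N κ ℕ.* (zFactor κ (suc N) ℕ.* 1)
    ≡⟨ cong (zUpTo N κ ℕ.*_) (ℕ.*-identityʳ _) ⟩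
  zUpTo N κ ℕ.* zFactor κ (suc N) ∎
  where open ≡-Reasoning

zUpTo-stable : ∀ d N κ → All (_≤ N) κ → zUpTo (d ℕ.+ N) κ ≡ zUpTo N κ
zUpTo-stable zero    N κ κ≤N = refl
zUpTo-stable (suc d) N κ κ≤N = begin
  zUpTo (suc d ℕ.+ N) κ                          ≡⟨ zUpTo-suc (d ℕ.+ N) κ ⟩
  zUpTo (d ℕ.+ N) κ ℕ.* zFactor κ (suc d ℕ.+ N)  ≡⟨ cong₂ ℕ._*_ (zUpTo-stable d N κ κ≤N) (cong (λ m → (suc d ℕ.+ N) ^ m ℕ.* m !)
                                                      (multiplicity-< (suc d ℕ.+ N) (All.map (λ p≤N → s≤s (ℕ.≤-trans p≤N (ℕ.m≤n+m N d))) κ≤N))) ⟩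
  zUpTo N κ ℕ.* 1                                ≡⟨ ℕ.*-identityʳ _ ⟩
  zUpTo N κ                                      ∎
  where open ≡-Reasoning

zFactor-∷-≡ : ∀ k κ → zFactor (k ∷ κ) k ≡ (k ℕ.* multiplicity k (k ∷ κ)) ℕ.* zFactor κ k
zFactor-∷-≡ k κ rewrite multiplicity-∷-≡ k κ = ℕ*-interchange k (k ^ multiplicity k κ) (suc (multiplicity k κ)) (multiplicity k κ !)

zFactor-∷-≢ : ∀ {k i} κ → i ≢ k → zFactor (k ∷ κ) i ≡ zFactor κ i
zFactor-∷-≢ {k} {i} κ i≢k = cong (λ m → i ^ m ℕ.* m !) (multiplicity-∷-≢ κ i≢k)

zUpTo-∷-> : ∀ N {k} κ → N < k → zUpTo N (k ∷ κ) ≡ zUpTo N κ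
zUpTo-∷-> zero    κ N<k = refl
zUpTo-∷-> (suc N) {k} κ N<k = trans (zUpTo-suc N (k ∷ κ)) (trans
  (cong₂ ℕ._*_ (zUpTo-∷-> N κ (ℕ.<-trans (ℕ.n<1+n N) N<k)) (zFactor-∷-≢ κ (ℕ.<⇒≢ N<k)))
  (sym (zUpTo-suc N κ)))

zUpTo-∷ : ∀ N {k} κ → 0 < k → k ≤ N → zUpTo N (k ∷ κ) ≡ (k ℕ.* multiplicity k (k ∷ κ)) ℕ.* zUpTo N κ
zUpTo-∷ zero    κ 0<k k≤0 = contradiction (ℕ.<-≤-trans 0<k k≤0) (ℕ.<-irrefl refl)
zUpTo-∷ (suc N) {k} κ 0<k k≤1+N with k ℕ.≟ suc N
... | yes refl = begin
  zUpTo (suc N) (k ∷ κ)                                 ≡⟨ zUpTo-suc N (k ∷ κ) ⟩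
  zUpTo N (k ∷ κ) ℕ.* zFactor (k ∷ κ) k                 ≡⟨ cong₂ ℕ._*_ (zUpTo-∷-> N κ (ℕ.n<1+n N)) (zFactor-∷-≡ k κ) ⟩
  zUpTo N κ ℕ.* ((k ℕ.* multiplicity k (k ∷ κ)) ℕ.* zFactor κ k)  ≡⟨ ℕ*-x∙yz≈y∙xz (zUpTo N κ) (k ℕ.* multiplicity k (k ∷ κ)) (zFactor κ k) ⟩
  (k ℕ.* multiplicity k (k ∷ κ)) ℕ.* (zUpTo N κ ℕ.* zFactor κ k)  ≡⟨ cong ((k ℕ.* multiplicity k (k ∷ κ)) ℕ.*_) (zUpTo-suc N κ) ⟨
  (k ℕ.* multiplicity k (k ∷ κ)) ℕ.* zUpTo (suc N) κ    ∎
  where open ≡-Reasoning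
... | no k≢1+N = begin
  zUpTo (suc N) (k ∷ κ)                                 ≡⟨ zUpTo-suc N (k ∷ κ) ⟩
  zUpTo N (k ∷ κ) ℕ.* zFactor (k ∷ κ) (suc N)           ≡⟨ cong₂ ℕ._*_ (zUpTo-∷ N κ 0<k (ℕ.s≤s⁻¹ (ℕ.≤∧≢⇒< k≤1+N k≢1+N))) (zFactor-∷-≢ κ (k≢1+N ∘ sym)) ⟩
  (k ℕ.* multiplicity k (k ∷ κ)) ℕ.* zUpTo N κ ℕ.* zFactor κ (suc N)    ≡⟨ ℕ.*-assoc (k ℕ.* multiplicity k (k ∷ κ)) (zUpTo N κ) (zFactor κ (suc N)) ⟩
  (k ℕ.* multiplicity k (k ∷ κ)) ℕ.* (zUpTo N κ ℕ.* zFactor κ (suc N))  ≡⟨ cong ((k ℕ.* multiplicity k (k ∷ κ)) ℕ.*_) (zUpTo-suc N κ) ⟨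
  (k ℕ.* multiplicity k (k ∷ κ)) ℕ.* zUpTo (suc N) κ    ∎
  where open ≡-Reasoning

-- Raising the multiplicity of k to m multiplies the factor k^m m! by k m and leaves the other
-- factors alone.
z-∷ : ∀ {k} κ → 0 < k → z (k ∷ κ) ≡ (k ℕ.* multiplicity k (k ∷ κ)) ℕ.* z κ
z-∷ {k} κ 0<k = trans (zUpTo-∷ (k ℕ.+ sum κ) κ 0<k (ℕ.m≤m+n k (sum κ)))
  (cong ((k ℕ.* multiplicity k (k ∷ κ)) ℕ.*_) (zUpTo-stable k (sum κ) κ (part≤sum κ)))

z-↭ : ∀ {κ κ′} → κ ↭ κ′ → z κ ≡ z κ′
z-↭ {κ} {κ′} p = trans
  (cong product (map-cong (λ i → cong (λ m → i ^ m ℕ.* m !) (multiplicity-↭ i p)) (applyUpTo suc (sum κ))))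
  (cong (λ N → zUpTo N κ′) (sum-↭ p))

1/z : List ℕ → ℚ
1/z κ = 1 /z κ

/z-as-* : ∀ n κ → n /z κ ≡ ι n * 1/z κ
/z-as-* n κ = /-as-* n (z κ) {{z≢0 κ}}

z-*-1/z : ∀ κ → ι (z κ) * 1/z κ ≡ 1ℚ
z-*-1/z κ = trans (ℚ.*-comm (ι (z κ)) _) (/-*-cancel 1 (z κ) {{z≢0 κ}})

1/z-↭ : ∀ {κ κ′} → κ ↭ κ′ → 1/z κ ≡ 1/z κ′
1/z-↭ {κ} {κ′} p = ι-cancelˡ (z κ) {{z≢0 κ}} (trans (z-*-1/z κ) (sym (trans (cong (λ d → ι d * 1/z κ′) (z-↭ p)) (z-*-1/z κ′))))

1/z-∷ : ∀ {k} κ → 0 < k → ι (k ℕ.* multiplicity k (k ∷ κ)) * 1/z (k ∷ κ) ≡ 1/z κ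
1/z-∷ {k} κ 0<k = ι-cancelˡ (z κ) {{z≢0 κ}} (begin
  ι (z κ) * (ι km * 1/z (k ∷ κ))  ≡⟨ ℚ.*-assoc (ι (z κ)) (ι km) _ ⟨
  ι (z κ) * ι km * 1/z (k ∷ κ)    ≡⟨ cong (_* 1/z (k ∷ κ)) (trans (ℚ.*-comm (ι (z κ)) (ι km)) (sym (ι-* km (z κ)))) ⟩
  ι (km ℕ.* z κ) * 1/z (k ∷ κ)    ≡⟨ cong (λ d → ι d * 1/z (k ∷ κ)) (z-∷ κ 0<k) ⟨
  ι (z (k ∷ κ)) * 1/z (k ∷ κ)     ≡⟨ z-*-1/z (k ∷ κ) ⟩
  1ℚ                              ≡⟨ z-*-1/z κ ⟨
  ι (z κ) * 1/z κ                 ∎)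
  where
  open ≡-Reasoning
  km = k ℕ.* multiplicity k (k ∷ κ)

-- Here `antidiag` serves as a plain sum over 0 ≤ i ≤ m. An entry p of κ contributes p at i = p - 1,
-- which the bound p ≤ m + 1 keeps in range.
antidiag-multiplicities : ∀ m κ → PartsUpTo (suc m) κ →
  antidiag m (λ i _ → ι (suc i ℕ.* multiplicity (suc i) κ)) ≡ ι (sum κ)
antidiag-multiplicities m []          []                  = antidiag-≡0 m (λ i _ _ → cong ι (ℕ.*-zeroʳ i))
antidiag-multiplicities m (suc p ∷ κ) ((_ , s≤s p≤m) ∷ b) = begin
  antidiag m (λ i _ → ι (suc i ℕ.* multiplicity (suc i) (suc p ∷ κ)))
    ≡⟨ antidiag-cong m (λ i _ → split i (suc i ℕ.≟ suc p)) ⟩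
  antidiag m (λ i _ → 𝟙 (i ℕ.≟ p) * ι (suc p) + ι (suc i ℕ.* multiplicity (suc i) κ))
    ≡⟨ antidiag-+ m _ _ ⟩
  antidiag m (λ i _ → 𝟙 (i ℕ.≟ p) * ι (suc p)) + antidiag m (λ i _ → ι (suc i ℕ.* multiplicity (suc i) κ))
    ≡⟨ cong₂ _+_ (antidiag-point m p (λ _ → ι (suc p)) p≤m) (antidiag-multiplicities m κ b) ⟩
  ι (suc p) + ι (sum κ)
    ≡⟨ ι-+ (suc p) (sum κ) ⟨
  ι (suc p ℕ.+ sum κ) ∎
  where
  open ≡-Reasoning
  split : ∀ i → Dec (suc i ≡ suc p) → ι (suc i ℕ.* multiplicity (suc i) (suc p ∷ κ)) ≡ 𝟙 (i ℕ.≟ p) * ι (suc p) + ι (suc i ℕ.* multiplicity (suc i) κ)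
  split i (yes refl) = trans
    (cong ι (trans (cong (suc i ℕ.*_) (multiplicity-∷-≡ (suc i) κ)) (ℕ.*-suc (suc i) _)))
    (trans (ι-+ (suc i) (suc i ℕ.* multiplicity (suc i) κ))
           (cong (_+ ι (suc i ℕ.* multiplicity (suc i) κ)) (sym (trans (cong (_* ι (suc p)) (𝟙-yes refl (i ℕ.≟ i))) (ℚ.*-identityˡ (ι (suc i)))))))
  split i (no 1+i≢1+p) = trans
    (cong (λ m → ι (suc i ℕ.* m)) (multiplicity-∷-≢ κ 1+i≢1+p))
    (sym (trans (cong (_+ ι (suc i ℕ.* multiplicity (suc i) κ)) (trans (cong (_* ι (suc p)) (𝟙-no (1+i≢1+p ∘ cong suc) (i ℕ.≟ p))) (ℚ.*-zeroˡ (ι (suc p)))))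
                (ℚ.+-identityˡ _)))

Σˡ-partitions : (List ℕ → ℚ) → ℕ → ℚ
Σˡ-partitions Ψ m = Σˡ (partitionsOf m) (λ κ → 1/z κ * Ψ κ)

-- The part k of κ ⊢ k + j is removed; the weight k·m_k(κ)/z_κ becomes 1/z_{κ∖k}.
Σˡ-partitions-remove : ∀ {Ψ : List ℕ → ℚ} → (∀ {κ κ′} → κ ↭ κ′ → Ψ κ ≡ Ψ κ′) → ∀ k j → 0 < k →
  Σˡ (partitionsOf (k ℕ.+ j)) (λ κ → ι (k ℕ.* multiplicity k κ) * (1/z κ * Ψ κ)) ≡ Σˡ-partitions (λ κ → Ψ (k ∷ κ)) j
Σˡ-partitions-remove {Ψ} Ψ-↭ k j 0<k = begin
  Σˡ (partitionsOf (k ℕ.+ j)) g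
    -- Lists without a part k are absent on the right, but there the multiplicity makes `g` vanish.
    ≡⟨ PartitionSums.Σˡ-unique g-↭ (partitionsOf-unique (k ℕ.+ j))
         (SetoidUniqueₚ.map⁺ ↭-setoidℕ ↭-setoidℕ ↭.drop-∷ (partitionsOf-unique j)) remove-k add-k ⟩
  Σˡ (map (k ∷_) (partitionsOf j)) g
    ≡⟨ Σˡ-map (k ∷_) (partitionsOf j) g ⟩
  Σˡ (partitionsOf j) (λ κ → g (k ∷ κ))
    ≡⟨ Σˡ-cong (partitionsOf j) (λ κ → trans (sym (ℚ.*-assoc (ι (k ℕ.* multiplicity k (k ∷ κ))) (1/z (k ∷ κ)) (Ψ (k ∷ κ)))) (cong (_* Ψ (k ∷ κ)) (1/z-∷ κ 0<k))) ⟩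
  Σˡ-partitions (λ κ → Ψ (k ∷ κ)) j ∎
  where
  open ≡-Reasoning
  g : List ℕ → ℚ
  g κ = ι (k ℕ.* multiplicity k κ) * (1/z κ * Ψ κ)
  g-↭ : ∀ {κ κ′} → κ ↭ κ′ → g κ ≡ g κ′
  g-↭ p = cong₂ _*_ (cong (λ m → ι (k ℕ.* m)) (multiplicity-↭ k p)) (cong₂ _*_ (1/z-↭ p) (Ψ-↭ p))
  multiplicity≢0 : ∀ κ → g κ ≢ 0ℚ → multiplicity k κ ≢ 0
  multiplicity≢0 κ gκ≢0 m≡0 = gκ≢0 (trans
    (cong (λ m → ι m * (1/z κ * Ψ κ)) (trans (cong (k ℕ.*_) m≡0) (ℕ.*-zeroʳ k)))
    (ℚ.*-zeroˡ (1/z κ * Ψ κ)))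
  remove-from : ∀ {κ} → IsPartitionUpTo (k ℕ.+ j) (k ℕ.+ j) κ → Σ[ κ′ ∈ List ℕ ] κ ↭ k ∷ κ′ → κ ∈↭ map (k ∷_) (partitionsOf j)
  remove-from κ-part (κ′ , κ↭) = Any.map⁺ (Any.map (λ κ′↭ → ↭-trans κ↭ (prep k κ′↭)) (partitionsOf-complete κ′
    (All.tail (All.map proj₁ (↭.All-resp-↭ κ↭ bounds)))
    (ℕ.+-cancelˡ-≡ k (sum κ′) j (trans (sym (sum-↭ κ↭)) sum≡))))
    where open IsPartitionUpTo κ-part
  remove-k : ∀ {κ} → κ ∈ partitionsOf (k ℕ.+ j) → g κ ≢ 0ℚ → κ ∈↭ map (k ∷_) (partitionsOf j)
  remove-k {κ} κ∈ gκ≢0 = remove-from (All.lookup (partitionsOf-sound (k ℕ.+ j)) κ∈)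
    (remove-part k (multiplicity≢0⇒∈ k κ (multiplicity≢0 κ gκ≢0)))
  add-to : ∀ {κ} → Σ[ κ′ ∈ List ℕ ] κ′ ∈ partitionsOf j × κ ≡ k ∷ κ′ → κ ∈↭ partitionsOf (k ℕ.+ j)
  add-to (κ′ , κ′∈ , refl) = partitionsOf-complete (k ∷ κ′) (0<k ∷ All.map proj₁ bounds) (cong (k ℕ.+_) sum≡)
    where open IsPartitionUpTo (All.lookup (partitionsOf-sound j) κ′∈)
  add-k : ∀ {κ} → κ ∈ map (k ∷_) (partitionsOf j) → g κ ≢ 0ℚ → κ ∈↭ partitionsOf (k ℕ.+ j)
  add-k κ∈ _ = add-to (Membership.∈-map⁻ (k ∷_) κ∈)

Σˡ-partitions-suc : ∀ {Ψ : List ℕ → ℚ} → (∀ {κ κ′} → κ ↭ κ′ → Ψ κ ≡ Ψ κ′) → ∀ m →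
  ι (suc m) * Σˡ-partitions Ψ (suc m) ≡ antidiag m (λ i j → Σˡ-partitions (λ κ → Ψ (suc i ∷ κ)) j)
Σˡ-partitions-suc {Ψ} Ψ-↭ m = begin
  ι (suc m) * Σˡ (partitionsOf (suc m)) (λ κ → 1/z κ * Ψ κ)
    ≡⟨ Σˡ-*ˡ (ι (suc m)) (partitionsOf (suc m)) _ ⟨
  Σˡ (partitionsOf (suc m)) (λ κ → ι (suc m) * (1/z κ * Ψ κ))
    ≡⟨ Σˡ-cong∈ (partitionsOf (suc m)) (λ {κ} κ∈ → expand κ (All.lookup (partitionsOf-sound (suc m)) κ∈)) ⟩
  Σˡ (partitionsOf (suc m)) (λ κ → antidiag m (λ i _ → ι (suc i ℕ.* multiplicity (suc i) κ) * (1/z κ * Ψ κ)))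
    ≡⟨ antidiag-Σˡ (partitionsOf (suc m)) m (λ κ i _ → ι (suc i ℕ.* multiplicity (suc i) κ) * (1/z κ * Ψ κ)) ⟨
  antidiag m (λ i _ → Σˡ (partitionsOf (suc m)) (λ κ → ι (suc i ℕ.* multiplicity (suc i) κ) * (1/z κ * Ψ κ)))
    ≡⟨ antidiag-cong≤ m (λ { i j refl → Σˡ-partitions-remove Ψ-↭ (suc i) j (s≤s z≤n) }) ⟩
  antidiag m (λ i j → Σˡ-partitions (λ κ → Ψ (suc i ∷ κ)) j) ∎
  where
  open ≡-Reasoning
  expand : ∀ κ → IsPartitionUpTo (suc m) (suc m) κ →
    ι (suc m) * (1/z κ * Ψ κ) ≡ antidiag m (λ i _ → ι (suc i ℕ.* multiplicity (suc i) κ) * (1/z κ * Ψ κ))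
  expand κ κ-part = trans
    (cong (_* (1/z κ * Ψ κ)) (sym (trans (antidiag-multiplicities m κ bounds) (cong ι sum≡))))
    (sym (antidiag-*ʳ m (λ i _ → ι (suc i ℕ.* multiplicity (suc i) κ)) (1/z κ * Ψ κ)))
    where open IsPartitionUpTo κ-part

-- Conjugacy and rearrangement of cycles

record Conjugate {A B : Set} (f : A → A) (g : B → B) : Set where
  constructor conjugate
  field
    bijection : A ↔ B
    commutes  : ∀ a → Inverse.to bijection (f a) ≡ g (Inverse.to bijection a)

Conjugate-refl : ∀ {A : Set} {f : A → A} → Conjugate f f
Conjugate-refl = conjugate (↔-id _) (λ _ → refl)

Conjugate-sym : ∀ {A B : Set} {f : A → A} {g : B → B} → Conjugate f g → Conjugate g f
Conjugate-sym {f = f} {g} (conjugate h eq) = conjugate (↔-sym h) λ b → trans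
  (cong from (sym (trans (eq (from b)) (cong g (strictlyInverseˡ b)))))
  (strictlyInverseʳ (f (from b)))
  where open Inverse h

Conjugate-trans : ∀ {A B C : Set} {f : A → A} {g : B → B} {h : C → C} → Conjugate f g → Conjugate g h → Conjugate f h
Conjugate-trans (conjugate p eq) (conjugate q eq′) =
  conjugate (q ↔-∘ p) λ a → trans (cong (Inverse.to q) (eq a)) (eq′ (Inverse.to p a))

Conjugate-⊎ : ∀ {A A′ B B′ : Set} {f : A → A} {f′ : A′ → A′} {g : B → B} {g′ : B′ → B′} →
  Conjugate f f′ → Conjugate g g′ → Conjugate (Sum.map f g) (Sum.map f′ g′)
Conjugate-⊎ (conjugate p eq) (conjugate q eq′) =
  conjugate (p ⊎-↔ q) λ { (inj₁ a) → cong inj₁ (eq a) ; (inj₂ b) → cong inj₂ (eq′ b) }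

Conjugate-⊕ : ∀ {k m} (σ : Permutation′ k) (τ : Permutation′ m) →
  Conjugate (σ ⊕ τ ⟨$⟩ʳ_) (Sum.map (σ ⟨$⟩ʳ_) (τ ⟨$⟩ʳ_))
Conjugate-⊕ {k} σ τ = conjugate Fin.+↔⊎ λ i → Fin.splitAt-join k _ (Sum.map (σ ⟨$⟩ʳ_) (τ ⟨$⟩ʳ_) (splitAt k i))

⊕-Conjugate : ∀ {k l m n} (σ : Permutation′ k) (σ′ : Permutation′ l) (τ : Permutation′ m) (τ′ : Permutation′ n) →
  Conjugate (σ ⟨$⟩ʳ_) (σ′ ⟨$⟩ʳ_) → Conjugate (τ ⟨$⟩ʳ_) (τ′ ⟨$⟩ʳ_) → Conjugate (σ ⊕ τ ⟨$⟩ʳ_) (σ′ ⊕ τ′ ⟨$⟩ʳ_)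
⊕-Conjugate σ σ′ τ τ′ p q =
  Conjugate-trans (Conjugate-⊕ σ τ) (Conjugate-trans (Conjugate-⊎ p q) (Conjugate-sym (Conjugate-⊕ σ′ τ′)))

-- Conjugacy is taken between maps on arbitrary sets, so blocks can be viewed as summands of a
-- disjoint union. Interchanging two of them is then a case distinction without index arithmetic.
standard-↭ : ∀ {κ κ′} → κ ↭ κ′ → Conjugate (standard κ ⟨$⟩ʳ_) (standard κ′ ⟨$⟩ʳ_)
standard-↭ ↭.refl       = Conjugate-refl
standard-↭ (prep {κ} {κ′} k p)   = ⊕-Conjugate (cycle k) (cycle k) (standard κ) (standard κ′) Conjugate-refl (standard-↭ p)
standard-↭ (swap {κ} {κ′} k l p) = Conjugate-trans
  (Conjugate-trans (Conjugate-⊕ (cycle k) (cycle l ⊕ standard κ)) (Conjugate-⊎ Conjugate-refl (Conjugate-⊕ (cycle l) (standard κ))))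
  (Conjugate-trans exchange
    (Conjugate-sym (Conjugate-trans (Conjugate-⊕ (cycle l) (cycle k ⊕ standard κ′)) (Conjugate-⊎ Conjugate-refl (Conjugate-⊕ (cycle k) (standard κ′))))))
  where
  exchange : Conjugate (Sum.map (cycle k ⟨$⟩ʳ_) (Sum.map (cycle l ⟨$⟩ʳ_) (standard κ ⟨$⟩ʳ_)))
                       (Sum.map (cycle l ⟨$⟩ʳ_) (Sum.map (cycle k ⟨$⟩ʳ_) (standard κ′ ⟨$⟩ʳ_)))
  exchange with conjugate h eq ← standard-↭ p = conjugate (mk↔ₛ′
      [ inj₂ ∘ inj₁ , [ inj₁ , inj₂ ∘ inj₂ ∘ Inverse.to h ]′ ]′
      [ inj₂ ∘ inj₁ , [ inj₁ , inj₂ ∘ inj₂ ∘ Inverse.from h ]′ ]′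
      (λ { (inj₁ _) → refl ; (inj₂ (inj₁ _)) → refl ; (inj₂ (inj₂ c)) → cong (inj₂ ∘ inj₂) (Inverse.strictlyInverseˡ h c) })
      (λ { (inj₁ _) → refl ; (inj₂ (inj₁ _)) → refl ; (inj₂ (inj₂ c)) → cong (inj₂ ∘ inj₂) (Inverse.strictlyInverseʳ h c) }))
    (λ { (inj₁ _) → refl ; (inj₂ (inj₁ _)) → refl ; (inj₂ (inj₂ c)) → cong (inj₂ ∘ inj₂) (eq c) })
standard-↭ (↭.trans p q) = Conjugate-trans (standard-↭ p) (standard-↭ q)

-- The class with cycle type κ ⊢ m has m!/z_κ elements.
Σˡ-perms-classes : ∀ {Φ : ∀ n → Permutation′ n → ℚ} → IsClassFamily Φ → ∀ m →
  Σˡ (perms m) (Φ m) ≡ ι (m !) * Σˡ-partitions (λ κ → Φ (sum κ) (standard κ)) m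
Σˡ-perms-classes class m = go m class m ℕ.≤-refl
  where
  open ≡-Reasoning
  -- Induction on a bound for m, with Φ varying: the recursive calls concern smaller sizes and the
  -- family obtained by adjoining a fixed cycle.
  go : ∀ N {Φ : ∀ n → Permutation′ n → ℚ} → IsClassFamily Φ → ∀ m → m ≤ N →
       Σˡ (perms m) (Φ m) ≡ ι (m !) * Σˡ-partitions (λ κ → Φ (sum κ) (standard κ)) m
  go N       {Φ} class zero    _         = begin
    Φ 0 Perm.id + 0ℚ                     ≡⟨ cong (_+ 0ℚ) (ℚ.*-identityˡ (Φ 0 Perm.id)) ⟨
    1ℚ * Φ 0 Perm.id + 0ℚ                ≡⟨ ℚ.*-identityˡ _ ⟨
    1ℚ * (1ℚ * Φ 0 Perm.id + 0ℚ)         ∎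
  go (suc N) {Φ} class (suc m) (s≤s m≤N) = begin
    Σˡ (perms (suc m)) (Φ (suc m))
      ≡⟨ Σˡ-perms-cycles class (λ k j → Σˡ-partitions (λ κ → Φ (sum (suc k ∷ κ)) (standard (suc k ∷ κ))) j) m
           (λ k j j≤m → go N {λ n π → Φ (suc k ℕ.+ n) (cycle (suc k) ⊕ π)} (class-⊕ k) j (ℕ.≤-trans j≤m m≤N)) ⟩
    ι (m !) * antidiag m (λ k j → Σˡ-partitions (λ κ → Φ (sum (suc k ∷ κ)) (standard (suc k ∷ κ))) j)
      ≡⟨ cong (ι (m !) *_) (Σˡ-partitions-suc (λ {κ} {κ′} p → let conjugate θ eq = standard-↭ p in class θ (standard κ) (standard κ′) eq) m) ⟨
    ι (m !) * (ι (suc m) * Σˡ-partitions (λ κ → Φ (sum κ) (standard κ)) (suc m))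
      ≡⟨ trans (sym (ℚ.*-assoc (ι (m !)) (ι (suc m)) _)) (cong (_* Σˡ-partitions (λ κ → Φ (sum κ) (standard κ)) (suc m))
           (trans (ℚ.*-comm (ι (m !)) (ι (suc m))) (sym (ι-* (suc m) (m !))))) ⟩
    ι (suc m !) * Σˡ-partitions (λ κ → Φ (sum κ) (standard κ)) (suc m) ∎
    where
    class-⊕ : ∀ k → IsClassFamily (λ n π → Φ (suc k ℕ.+ n) (cycle (suc k) ⊕ π))
    class-⊕ k θ σ τ eq with conjugate η eq′ ← ⊕-Conjugate (cycle (suc k)) (cycle (suc k)) σ τ Conjugate-refl (conjugate θ eq) =
      class η (cycle (suc k) ⊕ σ) (cycle (suc k) ⊕ τ) eq′

-- Equivariant functions

∏-split : ∀ k {m} (s : Fin (k ℕ.+ m) → Series) → ∏ s ≈ₛ ∏ (s ∘ (_↑ˡ m)) *ₛ ∏ (s ∘ (k ↑ʳ_))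
∏-split zero    s α = sym (conv-identityˡ (coeff (∏ s)) α)
∏-split (suc k) {m} s α = trans
  (conv-cong {coeff (s zero)} (λ _ → refl) (∏-split k (s ∘ suc)) α)
  (sym (conv-assoc (coeff (s zero)) (coeff (∏ (s ∘ suc ∘ (_↑ˡ m)))) (coeff (∏ (s ∘ (suc k ↑ʳ_)))) α))

iterate : ∀ {A} → A ⇒ A → ℕ → A ⇒ A
iterate {A} e zero    = ⇒-id
iterate {A} e (suc k) = record
  { func      = record { to = e.to ∘ eᵏ.to ; cong = e.to-cong ∘ eᵏ.to-cong }
  ; preserves = λ a α → trans (e.preserves (eᵏ.to a) α) (eᵏ.preserves a α)
  }
  where
  module e  = _⇒_ e
  module eᵏ = _⇒_ (iterate e k)

Functions : ℕ → WeightedSet → WeightedSet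
Functions m A = record
  { setoid      = record
    { Carrier       = Fin m → A.Carrier
    ; _≈_           = λ f g → ∀ i → f i A.≈ g i
    ; isEquivalence = record
      { refl  = λ _ → A≈.refl
      ; sym   = λ p i → A≈.sym (p i)
      ; trans = λ p q i → A≈.trans (p i) (q i)
      }
    }
  ; weight      = λ f → ∏ (A.weight ∘ f)
  ; weight-cong = λ {f} {g} p → Product.sum-cong-≋ {m} {A.weight ∘ f} {A.weight ∘ g} (λ i → A.weight-cong (p i))
  }
  where
  module A = WeightedSet A
  module A≈ = Setoid A.setoid

module Equivariants (A : WeightedSet) (_≟_ : DecidableEquality A) (e : A ⇒ A) where
  private
    module A = WeightedSet A
    module A≈ = Setoid A.setoid
    module e = _⇒_ e

  functions-≟ : ∀ {m} → DecidableEquality (Functions m A)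
  functions-≟ f g = Fin.all? (λ i → f i ≟ g i)

  IsEquivariant : ∀ {m} → Permutation′ m → (Fin m → A.Carrier) → Set
  IsEquivariant τ f = ∀ i → e.to (f i) A.≈ f (τ ⟨$⟩ʳ i)

  isEquivariant? : ∀ {m} (τ : Permutation′ m) f → Dec (IsEquivariant τ f)
  isEquivariant? τ f = Fin.all? (λ i → e.to (f i) ≟ f (τ ⟨$⟩ʳ i))

  Equivariant : ∀ {m} → Permutation′ m → WeightedSet
  Equivariant {m} τ = record
    { setoid      = On.setoid {B = Σ[ f ∈ (Fin m → A.Carrier) ] IsEquivariant τ f} (WeightedSet.setoid (Functions m A)) proj₁
    ; weight      = WeightedSet.weight (Functions m A) ∘ proj₁
    ; weight-cong = WeightedSet.weight-cong (Functions m A)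
    }

  equivariant-≟ : ∀ {m} (τ : Permutation′ m) → DecidableEquality (Equivariant τ)
  equivariant-≟ τ (f , _) (g , _) = functions-≟ f g

  functions-0 : Functions 0 A HasSum 1ₛ
  functions-0 α = (λ ()) ∷ [] , [] ∷ [] , (λ _ _ → here λ ()) , sym (ℚ.+-identityʳ _)

  functions-suc : ∀ m → Correspondence (A ⊗ Functions m A) (Functions (suc m) A)
  functions-suc m = record
    { to         = cons
    ; to-cong    = λ { (p , q) zero → p ; (p , q) (suc i) → q i }
    ; injective  = λ p → p zero , p ∘ suc
    ; surjective = λ f → (f zero , f ∘ suc) , λ { zero → A≈.refl ; (suc i) → A≈.refl }
    ; preserves  = λ _ _ → refl
    }
    where
    cons : A.Carrier × (Fin m → A.Carrier) → Fin (suc m) → A.Carrier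
    cons (a , f) zero    = a
    cons (a , f) (suc i) = f i

  functions-hasSum : ∀ {s} → A HasSum s → ∀ m → Functions m A HasSum ∏ {m} (λ _ → s)
  functions-hasSum {s} h zero    = functions-0
  functions-hasSum {s} h (suc m) = hasSum-transport (functions-suc m) {s *ₛ ∏ {m} (λ _ → s)}
    (hasSum-⊗ {A} {Functions m A} {s} {∏ {m} (λ _ → s)} _≟_ functions-≟ h (functions-hasSum {s} h m))

  equivariant-conjugate : ∀ {m n} (θ : Permutation m n) (σ : Permutation′ m) (τ : Permutation′ n) → Intertwines θ σ τ →
    Correspondence (Equivariant σ) (Equivariant τ)
  equivariant-conjugate {m} θ σ τ eq = record
    { to         = λ (f , f-eq) → (λ i → f (θ ⟨$⟩ˡ i)) , λ i → A≈.trans (f-eq (θ ⟨$⟩ˡ i)) (A≈.reflexive (cong f (back i)))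
    ; to-cong    = λ p i → p (θ ⟨$⟩ˡ i)
    ; injective  = λ { {f , _} {g , _} p i → A≈.trans (A≈.reflexive (cong f (sym (Perm.inverseˡ θ))))
                       (A≈.trans (p (θ ⟨$⟩ʳ i)) (A≈.reflexive (cong g (Perm.inverseˡ θ)))) }
    ; surjective = λ (f , f-eq) →
        ((λ i → f (θ ⟨$⟩ʳ i)) , λ i → A≈.trans (f-eq (θ ⟨$⟩ʳ i)) (A≈.reflexive (cong f (sym (eq i))))) ,
        λ i → A≈.reflexive (cong f (Perm.inverseʳ θ))
    ; preserves  = λ (f , _) α → sym (Product.sum-permute (A.weight ∘ f) (Perm.flip θ) α)
    }
    where
    back : ∀ i → σ ⟨$⟩ʳ (θ ⟨$⟩ˡ i) ≡ θ ⟨$⟩ˡ (τ ⟨$⟩ʳ i)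
    back i = perm-injective θ (trans (eq (θ ⟨$⟩ˡ i)) (trans (cong (τ ⟨$⟩ʳ_) (Perm.inverseʳ θ)) (sym (Perm.inverseʳ θ))))

  -- Each block is mapped to itself, so the equations for `f` never mix values from different
  -- blocks.
  equivariant-⊕ : ∀ {k m} (σ : Permutation′ k) (τ : Permutation′ m) →
    Correspondence (Equivariant σ ⊗ Equivariant τ) (Equivariant (σ ⊕ τ))
  equivariant-⊕ {k} {m} σ τ = record
    { to         = λ ((f , f-eq) , (g , g-eq)) → glue f g , glue-equivariant f g f-eq g-eq
    ; to-cong    = λ { {(f , _) , (g , _)} {(f′ , _) , (g′ , _)} (p , q) i → glue-cong f f′ g g′ p q i }
    ; injective  = λ { {(f , _) , (g , _)} {(f′ , _) , (g′ , _)} p →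
        (λ i → A≈.trans (A≈.reflexive (sym (glue-ˡ f g i))) (A≈.trans (p (i ↑ˡ m)) (A≈.reflexive (glue-ˡ f′ g′ i)))) ,
        (λ i → A≈.trans (A≈.reflexive (sym (glue-ʳ f g i))) (A≈.trans (p (k ↑ʳ i)) (A≈.reflexive (glue-ʳ f′ g′ i)))) }
    ; surjective = λ (h , h-eq) →
        (((h ∘ (_↑ˡ m)) , λ i → A≈.trans (h-eq (i ↑ˡ m)) (A≈.reflexive (cong h (⊕-ˡ i)))) ,
         ((h ∘ (k ↑ʳ_)) , λ i → A≈.trans (h-eq (k ↑ʳ i)) (A≈.reflexive (cong h (⊕-ʳ i))))) ,
        λ i → A≈.reflexive (glue-split h i)
    ; preserves  = λ ((f , _) , (g , _)) α → trans (∏-split k (A.weight ∘ glue f g) α) (conv-cong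
        (Product.sum-cong-≋ {k} {A.weight ∘ glue f g ∘ (_↑ˡ m)} {A.weight ∘ f} (λ i β → cong (λ a → coeff (A.weight a) β) (glue-ˡ f g i)))
        (Product.sum-cong-≋ {m} {A.weight ∘ glue f g ∘ (k ↑ʳ_)} {A.weight ∘ g} (λ i β → cong (λ a → coeff (A.weight a) β) (glue-ʳ f g i))) α)
    }
    where
    glue : (Fin k → A.Carrier) → (Fin m → A.Carrier) → Fin (k ℕ.+ m) → A.Carrier
    glue f g i = [ f , g ]′ (splitAt k i)
    glue-ˡ : ∀ f g i → glue f g (i ↑ˡ m) ≡ f i
    glue-ˡ f g i = cong [ f , g ]′ (Fin.splitAt-↑ˡ k i m)
    glue-ʳ : ∀ f g i → glue f g (k ↑ʳ i) ≡ g i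
    glue-ʳ f g i = cong [ f , g ]′ (Fin.splitAt-↑ʳ k m i)
    ⊕-ˡ : ∀ i → σ ⊕ τ ⟨$⟩ʳ (i ↑ˡ m) ≡ (σ ⟨$⟩ʳ i) ↑ˡ m
    ⊕-ˡ i rewrite Fin.splitAt-↑ˡ k i m = refl
    ⊕-ʳ : ∀ i → σ ⊕ τ ⟨$⟩ʳ (k ↑ʳ i) ≡ k ↑ʳ (τ ⟨$⟩ʳ i)
    ⊕-ʳ i rewrite Fin.splitAt-↑ʳ k m i = refl
    glue-split : ∀ (h : Fin (k ℕ.+ m) → A.Carrier) i → glue (h ∘ (_↑ˡ m)) (h ∘ (k ↑ʳ_)) i ≡ h i
    glue-split h i = trans (split (splitAt k i)) (cong h (Fin.join-splitAt k m i))
      where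
      split : ∀ s → [ h ∘ (_↑ˡ m) , h ∘ (k ↑ʳ_) ]′ s ≡ h (join k m s)
      split (inj₁ _) = refl
      split (inj₂ _) = refl
    glue-cong : ∀ f f′ g g′ → (∀ i → f i A.≈ f′ i) → (∀ i → g i A.≈ g′ i) → ∀ i → glue f g i A.≈ glue f′ g′ i
    glue-cong f f′ g g′ p q i with splitAt k i
    ... | inj₁ a = p a
    ... | inj₂ b = q b
    glue-equivariant : ∀ f g → IsEquivariant σ f → IsEquivariant τ g → IsEquivariant (σ ⊕ τ) (glue f g)
    glue-equivariant f g f-eq g-eq i with splitAt k i
    ... | inj₁ a = A≈.trans (f-eq a) (A≈.reflexive (sym (glue-ˡ f g (σ ⟨$⟩ʳ a))))
    ... | inj₂ b = A≈.trans (g-eq b) (A≈.reflexive (sym (glue-ʳ f g (τ ⟨$⟩ʳ b))))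

  e^ : ℕ → A.Carrier → A.Carrier
  e^ k = _⇒_.to (iterate e k)

  module _ (powers : ∀ a → PowersAreDilations (A.weight a)) where

    -- An equivariant function on a cycle of length k is determined by its value
    -- a at the last point, which satisfies eᵏ a ≈ a.
    equivariant-cycle : ∀ k → Correspondence (Dilated (suc k) (Fixed (iterate e (suc k)))) (Equivariant (cycle (suc k)))
    equivariant-cycle k = record
      { to         = λ (a , fixed) → orbit-of a , orbit-equivariant a fixed
      ; to-cong    = λ { {a , _} {b , _} a≈b i → _⇒_.to-cong (iterate e (k ∸ toℕ i)) a≈b }
      ; injective  = λ { {a , _} {b , _} p → A≈.trans (A≈.reflexive (sym (orbit-last a))) (A≈.trans (p (fromℕ k)) (A≈.reflexive (orbit-last b))) }
      ; surjective = λ (f , f-eq) → (f (fromℕ k) , fixed-last f f-eq) , λ i → A≈.sym (determined f f-eq (k ∸ toℕ i) i (ℕ.m+[n∸m]≡n (Fin.toℕ≤pred[n] i)))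
      ; preserves  = λ (a , fixed) α → trans
          (Product.sum-cong-≋ {suc k} {A.weight ∘ orbit-of a} {λ _ → A.weight a} (λ i → _⇒_.preserves (iterate e (k ∸ toℕ i)) a) α)
          (powers a (suc k) α)
      }
      where
      orbit-of : A.Carrier → Fin (suc k) → A.Carrier
      -- Since the cycle sends i to i - 1, each step down from the last index k applies e once more.
      orbit-of a i = e^ (k ∸ toℕ i) a
      orbit-last : ∀ a → orbit-of a (fromℕ k) ≡ a
      orbit-last a = cong (λ j → e^ j a) (trans (cong (k ∸_) (Fin.toℕ-fromℕ k)) (ℕ.n∸n≡0 k))
      cycle-suc : ∀ (i : Fin k) → cycle (suc k) ⟨$⟩ʳ suc i ≡ inject₁ i
      cycle-suc i = punchIn-last k i
        where
        punchIn-last : ∀ k (i : Fin k) → punchIn (fromℕ k) i ≡ inject₁ i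
        punchIn-last (suc k) zero    = refl
        punchIn-last (suc k) (suc i) = cong suc (punchIn-last k i)
      orbit-equivariant : ∀ a → e^ (suc k) a A.≈ a → IsEquivariant (cycle (suc k)) (orbit-of a)
      -- At index 0 the cycle wraps round to k, and the equation becomes the assumption that a is
      -- fixed by the (k+1)-st iterate.
      orbit-equivariant a fixed zero    = A≈.trans fixed (A≈.reflexive (sym (orbit-last a)))
      orbit-equivariant a fixed (suc i) = A≈.reflexive (trans
        (cong (λ j → e^ j a) (trans (sym (ℕ.+-∸-assoc 1 (Fin.toℕ<n i))) (cong (k ∸_) (sym (Fin.toℕ-inject₁ i)))))
        (cong (orbit-of a) (sym (cycle-suc i))))
      determined : ∀ f → IsEquivariant (cycle (suc k)) f → ∀ d i → toℕ i ℕ.+ d ≡ k → f i A.≈ e^ d (f (fromℕ k))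
      determined f f-eq zero    i eq = A≈.reflexive (cong f (Fin.toℕ-injective
        (trans (sym (ℕ.+-identityʳ (toℕ i))) (trans eq (sym (Fin.toℕ-fromℕ k))))))
      determined f f-eq (suc d) i eq = A≈.trans
        (A≈.reflexive (cong f (trans (Fin.toℕ-injective (trans (sym (Fin.toℕ-fromℕ< i<k)) (sym (Fin.toℕ-inject₁ j)))) (sym (cycle-suc j)))))
        (A≈.trans (A≈.sym (f-eq (suc j)))
        (e.to-cong (determined f f-eq d (suc j) (trans (cong (λ n → suc n ℕ.+ d) (Fin.toℕ-fromℕ< i<k)) (trans (sym (ℕ.+-suc (toℕ i) d)) eq)))))
        where
        i<k : toℕ i < k
        i<k = subst (toℕ i <_) eq (ℕ.m<m+n (toℕ i) (s≤s z≤n))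
        j : Fin k
        j = fromℕ< i<k
      fixed-last : ∀ f → IsEquivariant (cycle (suc k)) f → e^ (suc k) (f (fromℕ k)) A.≈ f (fromℕ k)
      fixed-last f f-eq = A≈.trans (e.to-cong (A≈.sym (determined f f-eq k zero refl))) (f-eq zero)

    equivariant-standard : ∀ {p : ℕ → Series} → (∀ k → Fixed (iterate e k) HasSum p k) →
      ∀ {κ} → All (0 <_) κ → Equivariant (standard κ) HasSum productₛ (map (λ k → dilate k (p k)) κ)
    equivariant-standard h [] α = ((λ ()) , λ ()) ∷ [] , [] ∷ [] , (λ _ _ → here λ ()) , sym (ℚ.+-identityʳ _)
    equivariant-standard {p} h {suc k ∷ κ} (_ ∷ positive) = hasSum-transport (equivariant-⊕ (cycle (suc k)) (standard κ))
      {dilate (suc k) (p (suc k)) *ₛ productₛ (map (λ k → dilate k (p k)) κ)}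
      (hasSum-⊗ {Equivariant (cycle (suc k))} {Equivariant (standard κ)} {dilate (suc k) (p (suc k))} {productₛ (map (λ k → dilate k (p k)) κ)}
        (equivariant-≟ (cycle (suc k))) (equivariant-≟ (standard κ))
        (hasSum-transport (equivariant-cycle k) {dilate (suc k) (p (suc k))}
          (hasSum-dilate (suc k) {Fixed (iterate e (suc k))} {p (suc k)} (h (suc k))))
        (equivariant-standard {p} h positive))

-- Orbits and the Cauchy–Frobenius count

module _ {A : Set} {P : A → Set} (P? : Unary.Decidable P) where

  -- Elements of `Fixed` and `Equivariant` carry a proof of membership, so the filter has to retain
  -- it.
  filterΣ : List A → List (Σ A P)
  filterΣ []       = []
  filterΣ (x ∷ xs) with P? x
  ... | yes p = (x , p) ∷ filterΣ xs
  ... | no  _ = filterΣ xs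

  map-proj₁-filterΣ : ∀ xs → map proj₁ (filterΣ xs) ≡ filter P? xs
  map-proj₁-filterΣ []       = refl
  map-proj₁-filterΣ (x ∷ xs) with P? x
  ... | yes _ = cong (x ∷_) (map-proj₁-filterΣ xs)
  ... | no  _ = map-proj₁-filterΣ xs

-- The common shape of `Fixed` and `Equivariant`, both of which unfold to instances of it. Equality
-- ignores the proofs.
Subset : (A : WeightedSet) → (WeightedSet.Carrier A → Set) → WeightedSet
Subset A P = record
  { setoid      = On.setoid {B = Σ[ a ∈ A.Carrier ] P a} A.setoid proj₁
  ; weight      = A.weight ∘ proj₁
  ; weight-cong = A.weight-cong
  }
  where module A = WeightedSet A

module _ (A : WeightedSet) {P : WeightedSet.Carrier A → Set} (P? : Unary.Decidable P)
         (resp : ∀ {a b} → WeightedSet._≈_ A a b → P a → P b) where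
  private
    module A = WeightedSet A
  open SetoidMembership A.setoid using () renaming (_∈_ to _∈ₛ_)

  subset-hasSumAt : ∀ {α as} → SetoidUnique.Unique A.setoid as →
    (∀ a → P a → coeff (A.weight a) α ≢ 0ℚ → a ∈ₛ as) →
    HasSumAt (Subset A P) α (Σˡ as (λ a → 𝟙 (P? a) * coeff (A.weight a) α))
  subset-hasSumAt {α} {as} u supp =
    filterΣ P? as ,
    AllPairs.map⁻ (subst (SetoidUnique.Unique A.setoid) (sym (map-proj₁-filterΣ P? as)) (SetoidUniqueₚ.filter⁺ A.setoid P? u)) ,
    (λ (a , pa) c≢0 → Any.map⁻ (subst (a ∈ₛ_) (sym (map-proj₁-filterΣ P? as))
      (SetoidMembershipₚ.∈-filter⁺ A.setoid P? resp (supp a pa c≢0) pa))) ,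
    (begin
      Σˡ as (λ a → 𝟙 (P? a) * coeff (A.weight a) α)
        ≡⟨ Σˡ-filter P? as (λ a → coeff (A.weight a) α) ⟨
      Σˡ (filter P? as) (λ a → coeff (A.weight a) α)
        ≡⟨ cong (λ xs → Σˡ xs (λ a → coeff (A.weight a) α)) (map-proj₁-filterΣ P? as) ⟨
      Σˡ (map proj₁ (filterΣ P? as)) (λ a → coeff (A.weight a) α)
        ≡⟨ Σˡ-map proj₁ (filterΣ P? as) (λ a → coeff (A.weight a) α) ⟩
      Σˡ (filterΣ P? as) (λ a → coeff (A.weight (proj₁ a)) α) ∎)
    where open ≡-Reasoning

module _ (X : FinSet) where
  open Inverse (FinSet.enumeration X)

  enumerate : List ∣ X ∣
  enumerate = map from (allFin (FinSet.size X))

  ∣∣-≟ : Decidable (_≡_ {A = ∣ X ∣})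
  ∣∣-≟ a b = map′ (λ eq → trans (sym (strictlyInverseʳ a)) (trans (cong from eq) (strictlyInverseʳ b))) (cong to) (to a Fin.≟ to b)

  enumerate-unique : SetoidUnique.Unique (≡.setoid ∣ X ∣) enumerate
  enumerate-unique = Unique.map⁺ (λ {i} {j} eq → trans (sym (strictlyInverseˡ i)) (trans (cong to eq) (strictlyInverseˡ j))) (Unique.allFin⁺ (FinSet.size X))

  enumerate-complete : ∀ a → a ∈ enumerate
  enumerate-complete a = subst (_∈ enumerate) (strictlyInverseʳ a) (Membership.∈-map⁺ from (Membership.∈-allFin (to a)))

  fixedPoints-Σˡ : ∀ (e : X ≃ X) → ι (fixedPoints X e) ≡ Σˡ enumerate (λ a → 𝟙 (∣∣-≟ (Inverse.to e a) a))
  fixedPoints-Σˡ e = begin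
    ι (length (filter (λ i → to (Inverse.to e (from i)) Fin.≟ i) indices))
      ≡⟨ ι-length (filter (λ i → to (Inverse.to e (from i)) Fin.≟ i) indices) ⟩
    Σˡ (filter (λ i → to (Inverse.to e (from i)) Fin.≟ i) indices) (λ _ → 1ℚ)
      ≡⟨ Σˡ-filter (λ i → to (Inverse.to e (from i)) Fin.≟ i) indices (λ _ → 1ℚ) ⟩
    Σˡ indices (λ i → 𝟙 (to (Inverse.to e (from i)) Fin.≟ i) * 1ℚ)
      ≡⟨ Σˡ-cong indices (λ i → trans (ℚ.*-identityʳ (𝟙 (to (Inverse.to e (from i)) Fin.≟ i))) (same i)) ⟩
    Σˡ indices (λ i → 𝟙 (∣∣-≟ (Inverse.to e (from i)) (from i)))
      ≡⟨ Σˡ-map from indices (λ a → 𝟙 (∣∣-≟ (Inverse.to e a) a)) ⟨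
    Σˡ enumerate (λ a → 𝟙 (∣∣-≟ (Inverse.to e a) a)) ∎
    where
    open ≡-Reasoning
    indices = allFin (FinSet.size X)
    same : ∀ i → 𝟙 (to (Inverse.to e (from i)) Fin.≟ i) ≡ 𝟙 (∣∣-≟ (Inverse.to e (from i)) (from i))
    same i = 𝟙-⇔ (λ eq → trans (sym (strictlyInverseʳ _)) (cong from eq)) (λ eq → trans (cong to eq) (strictlyInverseˡ i))
      (to (Inverse.to e (from i)) Fin.≟ i) (∣∣-≟ (Inverse.to e (from i)) (from i))

fixedPoints-conjugate : ∀ X Y (h : X ≃ Y) (e : X ≃ X) (e′ : Y ≃ Y) →
  (∀ a → Inverse.to h (Inverse.to e a) ≡ Inverse.to e′ (Inverse.to h a)) → ι (fixedPoints X e) ≡ ι (fixedPoints Y e′)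
fixedPoints-conjugate X Y h e e′ eq = begin
  ι (fixedPoints X e)
    ≡⟨ fixedPoints-Σˡ X e ⟩
  Σˡ (enumerate X) (λ a → 𝟙 (∣∣-≟ X (Inverse.to e a) a))
    ≡⟨ Σˡ-cong (enumerate X) (λ a → 𝟙-⇔ (λ ea≡a → trans (sym (eq a)) (cong to ea≡a)) (λ e′ha≡ha → injective (trans (eq a) e′ha≡ha))
         (∣∣-≟ X (Inverse.to e a) a) (∣∣-≟ Y (Inverse.to e′ (to a)) (to a))) ⟩
  Σˡ (enumerate X) (λ a → 𝟙 (∣∣-≟ Y (Inverse.to e′ (to a)) (to a)))
    ≡⟨ Σˡ-map to (enumerate X) (λ b → 𝟙 (∣∣-≟ Y (Inverse.to e′ b) b)) ⟨
  Σˡ (map to (enumerate X)) (λ b → 𝟙 (∣∣-≟ Y (Inverse.to e′ b) b))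
    ≡⟨ ListSums.Σˡ-unique (≡.setoid ∣ Y ∣) (∣∣-≟ Y) (λ { refl → refl }) (Unique.map⁺ injective (enumerate-unique X)) (enumerate-unique Y)
         (λ {b} _ _ → enumerate-complete Y b)
         (λ {b} _ _ → subst (_∈ map to (enumerate X)) (strictlyInverseˡ b) (Membership.∈-map⁺ to (enumerate-complete X (from b)))) ⟩
  Σˡ (enumerate Y) (λ b → 𝟙 (∣∣-≟ Y (Inverse.to e′ b) b))
    ≡⟨ fixedPoints-Σˡ Y e′ ⟨
  ι (fixedPoints Y e′) ∎
  where
  open ≡-Reasoning
  open Inverse h using (to; from; strictlyInverseˡ; strictlyInverseʳ)
  injective : ∀ {a b} → to a ≡ to b → a ≡ b
  injective {a} {b} p = trans (sym (strictlyInverseʳ a)) (trans (cong from p) (strictlyInverseʳ b))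

from-cong : ∀ {m n} (σ τ : Permutation m n) → σ Perm.≈ τ → ∀ i → σ ⟨$⟩ˡ i ≡ τ ⟨$⟩ˡ i
from-cong σ τ eq i = perm-injective τ (trans (sym (eq (σ ⟨$⟩ˡ i))) (trans (Perm.inverseʳ σ) (sym (Perm.inverseʳ τ))))

module Orbits (F : Species₁) (A : WeightedSet) (_≟_ : DecidableEquality A) where
  private
    module F = Species₁ F
    module A = WeightedSet A
    module A≈ = Setoid A.setoid
  open Analytic F A using (act; act-∘; _∼_)

  Labelled : ℕ → Set
  Labelled m = ∣ F.ob [ m ] ∣ × (Fin m → A.Carrier)

  labelledSetoid : ℕ → Setoid 0ℓ 0ℓ
  labelledSetoid m = ×-setoid (≡.setoid ∣ F.ob [ m ] ∣) (WeightedSet.setoid (Functions m A))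

  module _ {m : ℕ} where
    open Setoid (labelledSetoid m) public using () renaming (_≈_ to _≈ₗ_; refl to ≈ₗ-refl; sym to ≈ₗ-sym; trans to ≈ₗ-trans)

    _≟ₗ_ : Decidable _≈ₗ_
    (t , f) ≟ₗ (t′ , f′) = ∣∣-≟ (F.ob [ m ]) t t′ ×-dec Fin.all? (λ i → f i ≟ f′ i)

    infixr 8 _·_

    _·_ : Permutation′ m → Labelled m → Labelled m
    τ · (t , f) = act τ t , λ i → f (τ ⟨$⟩ˡ i)

    ·-cong : ∀ τ {x y} → x ≈ₗ y → τ · x ≈ₗ τ · y
    ·-cong τ (refl , p) = refl , λ i → p (τ ⟨$⟩ˡ i)

    ·-congˡ : ∀ {σ τ} → σ Perm.≈ τ → ∀ x → σ · x ≈ₗ τ · x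
    ·-congˡ {σ} {τ} eq (t , f) = F.mor-cong {[ m ]} {[ m ]} {σ} {τ} eq t , λ i → A≈.reflexive (cong f (from-cong σ τ eq i))

    ·-∘ : ∀ σ τ x → (σ ∘ₚ τ) · x ≈ₗ τ · (σ · x)
    ·-∘ σ τ (t , f) = act-∘ σ τ t , λ _ → A≈.refl

    ·⇒∼ : ∀ {x y} τ → τ · x ≈ₗ y → (m , x) ∼ (m , y)
    ·⇒∼ τ (p , q) = orbit τ p q

    ∼⇒· : ∀ {x y} → (m , x) ∼ (m , y) → Σ[ τ ∈ Permutation′ m ] τ · x ≈ₗ y
    ∼⇒· (orbit τ p q) = τ , p , q

    -- Decided by trying every permutation in `perms m`. The same decision later gives decidable
    -- equality on the G-structures that label F.
    ∼-dec : ∀ x y → Dec ((m , x) ∼ (m , y))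
    ∼-dec x y with any? (λ τ → (τ · x) ≟ₗ y) (perms m)
    ... | yes some = yes (let τ , eq = Any.satisfied some in ·⇒∼ τ eq)
    ... | no  none = no λ x∼y → let τ , eq = ∼⇒· x∼y in
      none (Any.map (λ {σ} τ≈σ → ≈ₗ-trans (≈ₗ-sym (·-congˡ {τ} {σ} τ≈σ x)) eq) (perms-complete τ))

  ∼-arity : ∀ {m m′ x x′} → (m , x) ∼ (m′ , x′) → m ≡ m′
  ∼-arity (orbit τ p q) = refl

  _∼?_ : DecidableEquality (analytic₁ F A)
  (m , x) ∼? (m′ , y) with m ℕ.≟ m′
  ... | yes refl = ∼-dec x y
  ... | no  m≢m′ = no (m≢m′ ∘ ∼-arity)

module Burnside (F : Species₁) (A : WeightedSet) (_≟_ : DecidableEquality A) (e : A ⇒ A)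
  (ε : ∀ m → Species₁.ob F [ m ] ≃ Species₁.ob F [ m ])
  (ε-natural : ∀ {m n} (θ : Permutation m n) t →
    Inverse.to (Species₁.mor F {[ m ]} {[ n ]} θ) (Inverse.to (ε m) t) ≡ Inverse.to (ε n) (Inverse.to (Species₁.mor F {[ m ]} {[ n ]} θ) t))
  where
  private
    module F = Species₁ F
    module A = WeightedSet A
    module A≈ = Setoid A.setoid
    module e = _⇒_ e
    module FA≈ = Setoid (WeightedSet.setoid (analytic₁ F A))
  open Analytic F A using (act; _∼_)
  open Orbits F A _≟_
  open Equivariants A _≟_ e

  shift : ∀ {m} → Labelled m → Labelled m
  shift {m} (t , f) = Inverse.to (ε m) t , e.to ∘ f

  shift-∼ : ∀ {m} {x y : Labelled m} → (m , x) ∼ (m , y) → (m , shift x) ∼ (m , shift y)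
  shift-∼ (orbit {t = t} τ refl q) = orbit τ (ε-natural τ t) (λ i → e.to-cong (q i))

  -- `Fixed` depends only on the underlying function, so in both applications `Fixed shiftMap`
  -- unfolds to the weighted set of fixed points that is wanted.
  shiftMap : analytic₁ F A ⇒ analytic₁ F A
  shiftMap = record
    { func      = record { to = λ (m , x) → m , shift x ; cong = λ { p@(orbit _ _ _) → shift-∼ p } }
    ; preserves = λ (m , t , f) → Product.sum-cong-≋ {m} {A.weight ∘ e.to ∘ f} {A.weight ∘ f} (λ i → e.preserves (f i))
    }

  IsFixed : Σ ℕ Labelled → Set
  IsFixed (m , x) = (m , shift x) ∼ (m , x)

  isFixed? : ∀ s → Dec (IsFixed s)
  isFixed? (m , x) = ∼-dec (shift x) x

  isFixed-∼ : ∀ {s s′} → s ∼ s′ → IsFixed s → IsFixed s′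
  isFixed-∼ s∼s′@(orbit _ _ _) fixed = FA≈.trans (shift-∼ (FA≈.sym s∼s′)) (FA≈.trans fixed s∼s′)

  symmetry : ∀ m → Permutation′ m → F.ob [ m ] ≃ F.ob [ m ]
  symmetry m τ = F.mor {[ m ]} {[ m ]} τ ↔-∘ ε m

  symmetryFixed : ∀ m → Permutation′ m → ℕ
  symmetryFixed m τ = fixedPoints (F.ob [ m ]) (symmetry m τ)

  symmetryFixed-class : ∀ {m n} (θ : Permutation m n) σ τ → Intertwines θ σ τ → ι (symmetryFixed m σ) ≡ ι (symmetryFixed n τ)
  symmetryFixed-class {m} {n} θ σ τ eq = fixedPoints-conjugate (F.ob [ m ]) (F.ob [ n ]) (F.mor {[ m ]} {[ n ]} θ) (symmetry m σ) (symmetry n τ) λ t →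
    let open ≡-Reasoning in begin
    Fθ (Inverse.to (F.mor {[ m ]} {[ m ]} σ) (Inverse.to (ε m) t))    ≡⟨ F.mor-∘ {[ m ]} {[ m ]} {[ n ]} θ σ _ ⟨
    Inverse.to (F.mor {[ m ]} {[ n ]} (θ ↔-∘ σ)) (Inverse.to (ε m) t)  ≡⟨ F.mor-cong {[ m ]} {[ n ]} {θ ↔-∘ σ} {τ ↔-∘ θ} eq _ ⟩
    Inverse.to (F.mor {[ m ]} {[ n ]} (τ ↔-∘ θ)) (Inverse.to (ε m) t)  ≡⟨ F.mor-∘ {[ m ]} {[ n ]} {[ n ]} τ θ _ ⟩
    Inverse.to (F.mor {[ n ]} {[ n ]} τ) (Fθ (Inverse.to (ε m) t))    ≡⟨ cong (Inverse.to (F.mor {[ n ]} {[ n ]} τ)) (ε-natural θ t) ⟩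
    Inverse.to (F.mor {[ n ]} {[ n ]} τ) (Inverse.to (ε n) (Fθ t))    ∎
    where
    Fθ = Inverse.to (F.mor {[ m ]} {[ n ]} θ)

  module _ {s : Series} (A-hasSum : A HasSum s) (α : List ℕ) where

    functionList : ∀ m → List (Fin m → A.Carrier)
    functionList m = proj₁ (functions-hasSum {s} A-hasSum m α)

    c : ∀ {m} → (Fin m → A.Carrier) → ℚ
    c f = coeff (∏ (A.weight ∘ f)) α

    equivariantSum : ∀ {m} → Permutation′ m → ℚ
    equivariantSum {m} τ = Σˡ (functionList m) (λ f → 𝟙 (isEquivariant? τ f) * c f)

    equivariantSum-hasSumAt : ∀ {m} (τ : Permutation′ m) → HasSumAt (Equivariant τ) α (equivariantSum τ)
    equivariantSum-hasSumAt {m} τ = subset-hasSumAt (Functions m A) (isEquivariant? τ)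
      (λ p f-eq i → A≈.trans (e.to-cong (A≈.sym (p i))) (A≈.trans (f-eq i) (p (τ ⟨$⟩ʳ i))))
      (proj₁ (proj₂ (functions-hasSum {s} A-hasSum m α)))
      (λ f _ → proj₁ (proj₂ (proj₂ (functions-hasSum {s} A-hasSum m α))) f)

    Φ : ∀ m → Permutation′ m → ℚ
    Φ m τ = ι (symmetryFixed m τ) * equivariantSum τ

    Φ-class : IsClassFamily Φ
    Φ-class θ σ τ eq = cong₂ _*_ (symmetryFixed-class θ σ τ eq)
      (hasSumAt-unique {Equivariant τ} (equivariant-≟ τ)
        (hasSumAt-transport (equivariant-conjugate θ σ τ eq) (equivariantSum-hasSumAt σ)) (equivariantSum-hasSumAt τ))

    module _ (m : ℕ) where
      cₗ : Labelled m → ℚ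
      cₗ (t , f) = c f

      private
        module Sums = ListSums (labelledSetoid m) _≟ₗ_
        module OrbitSums = ListSums (On.setoid {B = Labelled m} (WeightedSet.setoid (analytic₁ F A)) (m ,_)) ∼-dec
        X = On.setoid {B = Labelled m} (WeightedSet.setoid (analytic₁ F A)) (m ,_)

      cₗ-cong : Sums.Respects cₗ
      cₗ-cong {_ , f} {_ , g} (_ , p) = WeightedSet.weight-cong (Functions m A) {f} {g} p α

      cₗ-· : ∀ τ x → cₗ (τ · x) ≡ cₗ x
      cₗ-· τ (t , f) = sym (Product.sum-permute (A.weight ∘ f) (Perm.flip τ) α)

      labelledList : List (Labelled m)
      labelledList = cartesianProduct (enumerate (F.ob [ m ])) (functionList m)

      labelledList-unique : Sums.Unique labelledList
      labelledList-unique = SetoidUniqueₚ.cartesianProduct⁺ (≡.setoid ∣ F.ob [ m ] ∣) (WeightedSet.setoid (Functions m A))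
        (enumerate-unique (F.ob [ m ])) (proj₁ (proj₂ (functions-hasSum {s} A-hasSum m α)))

      labelledList-supported : Sums.Supported cₗ labelledList
      labelledList-supported (t , f) c≢0 = SetoidMembershipₚ.∈-cartesianProduct⁺ (≡.setoid ∣ F.ob [ m ] ∣) (WeightedSet.setoid (Functions m A))
        (enumerate-complete (F.ob [ m ]) t) (proj₁ (proj₂ (proj₂ (functions-hasSum {s} A-hasSum m α))) f c≢0)

      -- For y in the orbit of x this is the order of the stabiliser of x, otherwise 0. Counting
      -- transporters takes the place of stabiliser subgroups and cosets.
      transporters : Labelled m → Labelled m → ℚ
      transporters x y = Σˡ (perms m) (λ τ → 𝟙 ((τ · x) ≟ₗ y))

      -- Composing with a permutation ρ that carries x to y is a bijection of 𝔖ₘ.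
      transporters-∼ : ∀ {x y} z → (m , x) ∼ (m , y) → transporters y z ≡ transporters x z
      transporters-∼ {x} {y} z x∼y = move (∼⇒· x∼y)
        where
        move : Σ[ ρ ∈ Permutation′ m ] ρ · x ≈ₗ y → transporters y z ≡ transporters x z
        move (ρ , eq) = trans
          (Σˡ-cong (perms m) (λ τ → 𝟙-⇔
            (λ p → ≈ₗ-trans (·-∘ ρ τ x) (≈ₗ-trans (·-cong τ eq) p))
            (λ p → ≈ₗ-trans (·-cong τ (≈ₗ-sym eq)) (≈ₗ-trans (≈ₗ-sym (·-∘ ρ τ x)) p))
            ((τ · y) ≟ₗ z) (((ρ ∘ₚ τ) · x) ≟ₗ z)))
          (Σˡ-perms-reindex (ρ ∘ₚ_) (Perm.flip ρ ∘ₚ_)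
            (λ p i → p (ρ ⟨$⟩ʳ i))
            (λ {σ} {τ} p i → trans (cong (σ ⟨$⟩ʳ_) (sym (Perm.inverseʳ ρ))) (trans (p (ρ ⟨$⟩ˡ i)) (cong (τ ⟨$⟩ʳ_) (Perm.inverseʳ ρ))))
            (λ τ i → cong (τ ⟨$⟩ʳ_) (Perm.inverseˡ ρ))
            (λ {σ} {τ} p → 𝟙-⇔ (≈ₗ-trans (≈ₗ-sym (·-congˡ {σ = σ} {τ} p x))) (≈ₗ-trans (·-congˡ {σ = σ} {τ} p x)) ((σ · x) ≟ₗ z) ((τ · x) ≟ₗ z)))

      transporters-≁ : ∀ {x y} → ¬ ((m , x) ∼ (m , y)) → transporters x y ≡ 0ℚ
      transporters-≁ {x} {y} x≁y = Σˡ-≡0 (perms m) (λ {τ} _ → 𝟙-no (x≁y ∘ ·⇒∼ τ) ((τ · x) ≟ₗ y))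

      -- Each of the m! permutations carries x to one point, of the same weight as x. This does the
      -- work of the orbit-stabiliser theorem.
      Σˡ-transporters : ∀ x → Σˡ labelledList (λ y → transporters x y * cₗ y) ≡ ι (m !) * cₗ x
      Σˡ-transporters x = begin
        Σˡ labelledList (λ y → transporters x y * cₗ y)
          ≡⟨ Σˡ-cong labelledList (λ y → Σˡ-*ʳ (perms m) (λ τ → 𝟙 ((τ · x) ≟ₗ y)) (cₗ y)) ⟨
        Σˡ labelledList (λ y → Σˡ (perms m) (λ τ → 𝟙 ((τ · x) ≟ₗ y) * cₗ y))
          ≡⟨ Σˡ-swap labelledList (perms m) (λ y τ → 𝟙 ((τ · x) ≟ₗ y) * cₗ y) ⟩
        Σˡ (perms m) (λ τ → Σˡ labelledList (λ y → 𝟙 ((τ · x) ≟ₗ y) * cₗ y))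
          ≡⟨ Σˡ-cong (perms m) (λ τ → trans (Sums.Σˡ-point cₗ-cong labelledList-unique labelledList-supported (τ · x)) (cₗ-· τ x)) ⟩
        Σˡ (perms m) (λ _ → cₗ x)
          ≡⟨ Σˡ-const (perms m) (cₗ x) ⟩
        ι (length (perms m)) * cₗ x
          ≡⟨ cong (_* cₗ x) (length-perms m) ⟩
        ι (m !) * cₗ x ∎
        where open ≡-Reasoning

      representatives : List (Labelled m)
      representatives = deduplicate ∼-dec labelledList

      representatives-unique : OrbitSums.Unique representatives
      representatives-unique = DecSetoidUniqueₚ.deduplicate-!
        (record { isDecEquivalence = record { isEquivalence = Setoid.isEquivalence X ; _≟_ = ∼-dec } }) labelledList

      representatives-complete : ∀ {x} → SetoidMembership._∈_ X x labelledList → SetoidMembership._∈_ X x representatives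
      representatives-complete = SetoidMembershipₚ.∈-deduplicate⁺ X ∼-dec (λ y∼z x∼y → FA≈.trans x∼y (FA≈.sym y∼z))

      representatives-supported : ∀ x → cₗ x ≢ 0ℚ → SetoidMembership._∈_ X x representatives
      representatives-supported x c≢0 = representatives-complete
        (Any.map (λ {y} p → ·⇒∼ Perm.id (≈ₗ-trans (F.mor-id {[ m ]} (proj₁ x) , λ _ → A≈.refl) p)) (labelledList-supported x c≢0))

      -- A fixed orbit contributes one representative r, and for x in that orbit
      -- as many τ carry r to x as carry shift x to x.
      fixed-transporters : ∀ x r → 𝟙 (isFixed? (m , r)) * transporters r x ≡ 𝟙 (∼-dec x r) * transporters (shift x) x
      fixed-transporters x r = by-cases (∼-dec x r) (isFixed? (m , x))
        where
        by-cases : Dec ((m , x) ∼ (m , r)) → Dec (IsFixed (m , x)) →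
          𝟙 (isFixed? (m , r)) * transporters r x ≡ 𝟙 (∼-dec x r) * transporters (shift x) x
        by-cases (yes x∼r) (yes fixed) = cong₂ _*_
          (trans (𝟙-yes (isFixed-∼ x∼r fixed) (isFixed? (m , r))) (sym (𝟙-yes x∼r (∼-dec x r))))
          (transporters-∼ x (FA≈.trans fixed x∼r))
        by-cases (yes x∼r) (no ¬fixed) = trans
          (trans (cong (_* transporters r x) (𝟙-no (¬fixed ∘ isFixed-∼ (FA≈.sym x∼r)) (isFixed? (m , r)))) (ℚ.*-zeroˡ (transporters r x)))
          (sym (trans (cong (𝟙 (∼-dec x r) *_) (transporters-≁ ¬fixed)) (ℚ.*-zeroʳ (𝟙 (∼-dec x r)))))
        by-cases (no x≁r) _ = trans
          (trans (cong (𝟙 (isFixed? (m , r)) *_) (transporters-≁ (x≁r ∘ FA≈.sym))) (ℚ.*-zeroʳ (𝟙 (isFixed? (m , r)))))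
          (sym (trans (cong (_* transporters (shift x) x) (𝟙-no x≁r (∼-dec x r))) (ℚ.*-zeroˡ (transporters (shift x) x))))

      -- Substituting τ i for i turns e ∘ f ∘ τ⁻¹ = f into e ∘ f = f ∘ τ, and the conditions on t
      -- and on f are independent.
      fixedBy : ∀ τ t f → 𝟙 ((τ · shift (t , f)) ≟ₗ (t , f)) ≡
        𝟙 (∣∣-≟ (F.ob [ m ]) (act τ (Inverse.to (ε m) t)) t) * 𝟙 (isEquivariant? τ f)
      fixedBy τ t f = 𝟙-× (λ (p , q) → p , λ i → A≈.trans (A≈.reflexive (cong (e.to ∘ f) (sym (Perm.inverseˡ τ)))) (q (τ ⟨$⟩ʳ i)))
        (λ p q → p , λ i → A≈.trans (q (τ ⟨$⟩ˡ i)) (A≈.reflexive (cong f (Perm.inverseʳ τ))))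
        ((τ · shift (t , f)) ≟ₗ (t , f)) (∣∣-≟ (F.ob [ m ]) (act τ (Inverse.to (ε m) t)) t) (isEquivariant? τ f)

      Σˡ-fixedBy : ∀ τ → Σˡ labelledList (λ x → 𝟙 ((τ · shift x) ≟ₗ x) * cₗ x) ≡ Φ m τ
      Σˡ-fixedBy τ = begin
        Σˡ labelledList (λ x → 𝟙 ((τ · shift x) ≟ₗ x) * cₗ x)
          ≡⟨ Σˡ-cartesianProductWith _,_ ts fs (λ x → 𝟙 ((τ · shift x) ≟ₗ x) * cₗ x) ⟩
        Σˡ ts (λ t → Σˡ fs (λ f → 𝟙 ((τ · shift (t , f)) ≟ₗ (t , f)) * c f))
          ≡⟨ Σˡ-cong ts (λ t → Σˡ-cong fs (λ f → trans (cong (_* c f) (fixedBy τ t f))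
               (ℚ.*-assoc (𝟙 (fixes? t)) (𝟙 (isEquivariant? τ f)) (c f)))) ⟩
        Σˡ ts (λ t → Σˡ fs (λ f → 𝟙 (fixes? t) * (𝟙 (isEquivariant? τ f) * c f)))
          ≡⟨ Σˡ-cong ts (λ t → Σˡ-*ˡ (𝟙 (fixes? t)) fs (λ f → 𝟙 (isEquivariant? τ f) * c f)) ⟩
        Σˡ ts (λ t → 𝟙 (fixes? t) * equivariantSum τ)
          ≡⟨ Σˡ-*ʳ ts (λ t → 𝟙 (fixes? t)) (equivariantSum τ) ⟩
        Σˡ ts (λ t → 𝟙 (fixes? t)) * equivariantSum τ
          ≡⟨ cong (_* equivariantSum τ) (fixedPoints-Σˡ (F.ob [ m ]) (symmetry m τ)) ⟨
        Φ m τ ∎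
        where
        open ≡-Reasoning
        ts = enumerate (F.ob [ m ])
        fs = functionList m
        fixes? : ∀ t → Dec (act τ (Inverse.to (ε m) t) ≡ t)
        fixes? t = ∣∣-≟ (F.ob [ m ]) (act τ (Inverse.to (ε m) t)) t

      -- `Σˡ-transporters` spreads m! times the weight of r over the orbit of r. After the sums are
      -- exchanged, every x meets exactly one representative, and `fixed-transporters` replaces r by
      -- `shift x`.
      burnside : ι (m !) * Σˡ representatives (λ r → 𝟙 (isFixed? (m , r)) * cₗ r) ≡ Σˡ (perms m) (Φ m)
      burnside = begin
        ι (m !) * Σˡ representatives (λ r → 𝟙 (isFixed? (m , r)) * cₗ r)
          ≡⟨ Σˡ-*ˡ (ι (m !)) representatives (λ r → 𝟙 (isFixed? (m , r)) * cₗ r) ⟨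
        Σˡ representatives (λ r → ι (m !) * (𝟙 (isFixed? (m , r)) * cₗ r))
          ≡⟨ Σˡ-cong representatives (λ r → trans (x*yz≡y*xz (ι (m !)) (𝟙 (isFixed? (m , r))) (cₗ r))
               (trans (cong (𝟙 (isFixed? (m , r)) *_) (sym (Σˡ-transporters r)))
                      (sym (Σˡ-*ˡ (𝟙 (isFixed? (m , r))) labelledList (λ x → transporters r x * cₗ x))))) ⟩
        Σˡ representatives (λ r → Σˡ labelledList (λ x → 𝟙 (isFixed? (m , r)) * (transporters r x * cₗ x)))
          ≡⟨ Σˡ-swap representatives labelledList (λ r x → 𝟙 (isFixed? (m , r)) * (transporters r x * cₗ x)) ⟩
        Σˡ labelledList (λ x → Σˡ representatives (λ r → 𝟙 (isFixed? (m , r)) * (transporters r x * cₗ x)))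
          ≡⟨ Σˡ-cong∈ labelledList (λ {x} x∈ → pick x (representatives-complete (Any.map (λ { refl → FA≈.refl }) x∈))) ⟩
        Σˡ labelledList (λ x → transporters (shift x) x * cₗ x)
          ≡⟨ Σˡ-cong labelledList (λ x → Σˡ-*ʳ (perms m) (λ τ → 𝟙 ((τ · shift x) ≟ₗ x)) (cₗ x)) ⟨
        Σˡ labelledList (λ x → Σˡ (perms m) (λ τ → 𝟙 ((τ · shift x) ≟ₗ x) * cₗ x))
          ≡⟨ Σˡ-swap labelledList (perms m) (λ x τ → 𝟙 ((τ · shift x) ≟ₗ x) * cₗ x) ⟩
        Σˡ (perms m) (λ τ → Σˡ labelledList (λ x → 𝟙 ((τ · shift x) ≟ₗ x) * cₗ x))
          ≡⟨ Σˡ-cong (perms m) Σˡ-fixedBy ⟩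
        Σˡ (perms m) (Φ m) ∎
        where
        open ≡-Reasoning
        pick : ∀ x → SetoidMembership._∈_ X x representatives →
          Σˡ representatives (λ r → 𝟙 (isFixed? (m , r)) * (transporters r x * cₗ x)) ≡ transporters (shift x) x * cₗ x
        pick x x∈ = trans
          (Σˡ-cong representatives (λ r → trans (sym (ℚ.*-assoc (𝟙 (isFixed? (m , r))) (transporters r x) (cₗ x)))
            (trans (cong (_* cₗ x) (fixed-transporters x r)) (ℚ.*-assoc (𝟙 (∼-dec x r)) (transporters (shift x) x) (cₗ x)))))
          (OrbitSums.Σˡ-point-∈ {λ _ → transporters (shift x) x * cₗ x} (λ _ → refl) representatives-unique x∈)

      fixedOrbits : Σˡ representatives (λ r → 𝟙 (isFixed? (m , r)) * cₗ r) ≡ Σˡ-partitions (λ κ → Φ (sum κ) (standard κ)) m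
      fixedOrbits = ι-cancelˡ (m !) {{m ℕ.!≢0}} (trans burnside (Σˡ-perms-classes {Φ} Φ-class m))

hasSumAt-≡ : ∀ {A α q q′} → q ≡ q′ → HasSumAt A α q → HasSumAt A α q′
hasSumAt-≡ refl h = h

Fixed-id : ∀ {A} → Correspondence (Fixed {A} ⇒-id) A
Fixed-id {A} = record
  { to         = proj₁
  ; to-cong    = id
  ; injective  = id
  ; surjective = λ a → (a , A≈.refl) , A≈.refl
  ; preserves  = λ _ _ → refl
  }
  where module A≈ = Setoid (WeightedSet.setoid A)

module FixedOrbits (F : Species₁) (A : WeightedSet) (_≟_ : DecidableEquality A) (e : A ⇒ A)
  (ε : ∀ m → Species₁.ob F [ m ] ≃ Species₁.ob F [ m ])
  (ε-natural : ∀ {m n} (θ : Permutation m n) t →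
    Inverse.to (Species₁.mor F {[ m ]} {[ n ]} θ) (Inverse.to (ε m) t) ≡ Inverse.to (ε n) (Inverse.to (Species₁.mor F {[ m ]} {[ n ]} θ) t))
  (powers : ∀ a → PowersAreDilations (WeightedSet.weight A a))
  (p : ℕ → Series) (p-hasSum : ∀ k → Fixed (iterate e k) HasSum p k)
  where
  private
    FA = analytic₁ F A
  open Orbits F A _≟_
  open Equivariants A _≟_ e
  open Burnside F A _≟_ e ε ε-natural

  -- The iterate `iterate e 0` is the identity, so the hypothesis at k = 0 says that A itself is
  -- summable.
  A-hasSum : A HasSum p 0
  A-hasSum = hasSum-transport (Fixed-id {A}) {p 0} (p-hasSum 0)

  cycleTerm : List ℕ → List ℕ → ℚ
  cycleTerm α κ = ι (symmetryFixed (sum κ) (standard κ)) * coeff (productₛ (map (λ k → dilate k (p k)) κ)) α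

  -- Two evaluations of the weight of the equivariant functions meet here, a filtered sum and a
  -- product over cycles; uniqueness of sums identifies them.
  fixedOrbits-cycleTerm : ∀ α m →
    Σˡ (representatives {p 0} A-hasSum α m) (λ x → 𝟙 (isFixed? (m , x)) * coeff (WeightedSet.weight FA (m , x)) α) ≡
    Σˡ-partitions (cycleTerm α) m
  fixedOrbits-cycleTerm α m = trans (fixedOrbits {p 0} A-hasSum α m) (Σˡ-cong∈ (partitionsOf m) λ {κ} κ∈ →
    cong (λ q → 1/z κ * (ι (symmetryFixed (sum κ) (standard κ)) * q))
      (hasSumAt-unique {Equivariant (standard κ)} (equivariant-≟ (standard κ)) (equivariantSum-hasSumAt {p 0} A-hasSum α (standard κ))
        (equivariant-standard powers {p} p-hasSum (All.map proj₁ (IsPartitionUpTo.bounds (All.lookup (partitionsOf-sound m) κ∈))) α)))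

  -- `ms` lists the arities in which the monomial α can occur. It comes from the degree of α for G
  -- and from strict finiteness for F.
  fixed-hasSumAt : ∀ α ms → AllPairs _≢_ ms →
    (∀ m (x : Labelled m) → coeff (WeightedSet.weight FA (m , x)) α ≢ 0ℚ → m ∈ ms) →
    HasSumAt (Fixed shiftMap) α (Σˡ ms (Σˡ-partitions (cycleTerm α)))
  fixed-hasSumAt α ms ms-unique ms-supported = hasSumAt-≡ {Fixed shiftMap} {α}
    (trans (Σˡ-concatMap orbits ms term) (Σˡ-cong ms λ m → trans
      (Σˡ-map {B = WeightedSet.Carrier FA} (m ,_) (representatives {p 0} A-hasSum α m) term) (fixedOrbits-cycleTerm α m)))
    (subset-hasSumAt FA {IsFixed} isFixed? isFixed-∼ unique supported)
    where
    term : WeightedSet.Carrier FA → ℚ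
    term s = 𝟙 (isFixed? s) * coeff (WeightedSet.weight FA s) α
    orbits : ℕ → List (WeightedSet.Carrier FA)
    orbits m = map (m ,_) (representatives {p 0} A-hasSum α m)
    arity : ∀ {s m} → SetoidMembership._∈_ (WeightedSet.setoid FA) s (orbits m) → proj₁ s ≡ m
    arity s∈ = ∼-arity (proj₂ (Any.satisfied (Any.map⁻ s∈)))
    unique : SetoidUnique.Unique (WeightedSet.setoid FA) (concatMap orbits ms)
    unique = SetoidUniqueₚ.concat⁺ (WeightedSet.setoid FA)
      (All.map⁺ (All.universal (λ m → AllPairs.map⁺ (representatives-unique {p 0} A-hasSum α m)) ms))
      (AllPairs.map⁺ (AllPairs.map (λ {m} {m′} m≢m′ {s} (s∈ , s∈′) → m≢m′ (trans (sym (arity {s} {m} s∈)) (arity {s} {m′} s∈′))) ms-unique))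
    supported : ∀ s → IsFixed s → coeff (WeightedSet.weight FA s) α ≢ 0ℚ → SetoidMembership._∈_ (WeightedSet.setoid FA) s (concatMap orbits ms)
    supported (m , x) _ c≢0 = Any.concatMap⁺ orbits
      (Any.map (λ { refl → Any.map⁺ (representatives-supported {p 0} A-hasSum α m x c≢0) }) (ms-supported m x c≢0))

-- The function χ

indicator-T : ∀ b → indicator b ≢ 0ℚ → T b
indicator-T true  _   = _
indicator-T false i≢0 = contradiction refl i≢0

indicator-∧ : ∀ b {c} → indicator (b ∧ c) ≢ 0ℚ → T b
indicator-∧ true  _   = _
indicator-∧ false i≢0 = contradiction refl i≢0

∏-degree : ∀ {m} (f : Fin m → ℕ) α → coeff (∏ (x ∘ f)) α ≢ 0ℚ → sum α ≡ m
∏-degree {zero}  f α c≢0 = ℕ.≡ᵇ⇒≡ (sum α) 0 (indicator-T (sum α ≡ᵇ 0) c≢0)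
∏-degree {suc m} f α c≢0 with β , γ , _ , (β≢0 , γ≢0) , eq ← conv-support {coeff (x (f zero))} α c≢0 =
  trans (sym eq) (cong₂ ℕ._+_ (ℕ.≡ᵇ⇒≡ (sum β) 1 (indicator-∧ (sum β ≡ᵇ 1) β≢0)) (∏-degree (f ∘ suc) γ γ≢0))

powerSum-degree : ∀ k α → coeff (powerSum k) α ≢ 0ℚ → sum α ≡ k
powerSum-degree k α c≢0 with dilateCoeff-cases k α
... | inj₂ d            = contradiction (d (coeff Σx)) c≢0
... | inj₁ (β , eq , d) = trans eq (trans (cong (ℕ._* k) degree-1) (ℕ.*-identityˡ k))
  where
  degree-1 : sum β ≡ 1
  degree-1 = ℕ.≡ᵇ⇒≡ (sum β) 1 (indicator-T (sum β ≡ᵇ 1) (λ Σx≡0 → c≢0 (trans (d (coeff Σx)) Σx≡0)))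

powerSumₚ-degree : ∀ κ α → coeff (powerSumₚ κ) α ≢ 0ℚ → sum α ≡ sum κ
powerSumₚ-degree []      α c≢0 = ℕ.≡ᵇ⇒≡ (sum α) 0 (indicator-T (sum α ≡ᵇ 0) c≢0)
powerSumₚ-degree (k ∷ κ) α c≢0 with β , γ , _ , (β≢0 , γ≢0) , eq ← conv-support {coeff (powerSum k)} α c≢0 =
  trans (sym eq) (cong₂ ℕ._+_ (powerSum-degree k β β≢0) (powerSumₚ-degree κ γ γ≢0))

-- Symmetry of the power sums

IsSymmetric : (List ℕ → ℚ) → Set
IsSymmetric f = ∀ {α β} → α ↭ β → f α ≡ f β

∘∷-symmetric : ∀ {f} → IsSymmetric f → ∀ i → IsSymmetric (f ∘ (i ∷_))
∘∷-symmetric f-sym i p = f-sym (prep i p)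

-- Swapping two exponents exchanges two nested antidiagonal sums. The factors must vary in the
-- induction, because splitting off an exponent restricts each of them to the lists that start with
-- a given number.
conv-symmetric : ∀ {f g} → IsSymmetric f → IsSymmetric g → IsSymmetric (conv f g)
conv-symmetric f-sym g-sym ↭.refl       = refl
conv-symmetric f-sym g-sym (prep a p)   = antidiag-cong a λ i j → conv-symmetric (∘∷-symmetric f-sym i) (∘∷-symmetric g-sym j) p
conv-symmetric {f} {g} f-sym g-sym (swap {α} {β} a b p) = trans
  (antidiag-swap a b (λ i j k l → conv (f ∘ (i ∷_) ∘ (k ∷_)) (g ∘ (j ∷_) ∘ (l ∷_)) α))
  (antidiag-cong b λ k l → antidiag-cong a λ i j → trans
    (conv-cong (λ γ → f-sym (swap i k ↭-refl)) (λ γ → g-sym (swap j l ↭-refl)) α)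
    (conv-symmetric (∘∷-symmetric (∘∷-symmetric f-sym k) i) (∘∷-symmetric (∘∷-symmetric g-sym l) j) p))
conv-symmetric f-sym g-sym (↭.trans p q) = trans (conv-symmetric f-sym g-sym p) (conv-symmetric f-sym g-sym q)

module _ (k : ℕ) where

  -- Both divisibility tests are arguments, so that a swap of the two exponents can be checked by
  -- cases on both at once.
  dilateCoeff₂ : ∀ {a b} → Dec (k ∣ a) → Dec (k ∣ b) → (List ℕ → ℚ) → List ℕ → ℚ
  dilateCoeff₂ (no _)                _                     f α = 0ℚ
  dilateCoeff₂ (yes _)               (no _)                f α = 0ℚ
  dilateCoeff₂ (yes (divides q _)) (yes (divides r _)) f α = dilateCoeff k (f ∘ (q ∷_) ∘ (r ∷_)) α

  dilateCoeff-∷∷ : ∀ a b f α → dilateCoeff k f (a ∷ b ∷ α) ≡ dilateCoeff₂ (k ∣? a) (k ∣? b) f α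
  dilateCoeff-∷∷ a b f α with k ∣? a
  ... | no _ = refl
  ... | yes (divides q _) with k ∣? b
  ...   | no _              = refl
  ...   | yes (divides r _) = refl

  dilateCoeff-symmetric : ∀ {f} → IsSymmetric f → IsSymmetric (dilateCoeff k f)
  dilateCoeff-symmetric f-sym ↭.refl     = refl
  dilateCoeff-symmetric f-sym (prep a p) with k ∣? a
  ... | yes (divides q _) = dilateCoeff-symmetric (∘∷-symmetric f-sym q) p
  ... | no  _             = refl
  dilateCoeff-symmetric {f} f-sym (swap {α} {β} a b p) = trans (dilateCoeff-∷∷ a b f α)
    (trans (exchange (k ∣? a) (k ∣? b)) (sym (dilateCoeff-∷∷ b a f β)))
    where
    exchange : (a? : Dec (k ∣ a)) (b? : Dec (k ∣ b)) → dilateCoeff₂ a? b? f α ≡ dilateCoeff₂ b? a? f β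
    exchange (no _)              (no _)              = refl
    exchange (no _)              (yes _)             = refl
    exchange (yes _)             (no _)              = refl
    exchange (yes (divides q _)) (yes (divides r _)) = trans
      (dilateCoeff-cong k (λ γ → f-sym (swap q r ↭-refl)) α)
      (dilateCoeff-symmetric (∘∷-symmetric (∘∷-symmetric f-sym r) q) p)
  dilateCoeff-symmetric f-sym (↭.trans p q) = trans (dilateCoeff-symmetric f-sym p) (dilateCoeff-symmetric f-sym q)

powerSumₚ-symmetric : ∀ κ → IsSymmetric (coeff (powerSumₚ κ))
powerSumₚ-symmetric []      p = cong (λ d → indicator (d ≡ᵇ 0)) (sum-↭ p)
powerSumₚ-symmetric (k ∷ κ) p = conv-symmetric {coeff (powerSum k)} {coeff (powerSumₚ κ)}
  (dilateCoeff-symmetric k (λ q → cong (λ d → indicator (d ≡ᵇ 1)) (sum-↭ q))) (powerSumₚ-symmetric κ) p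

iterate-id : ∀ {A} k a → _⇒_.to (iterate (⇒-id {A}) k) a ≡ a
iterate-id zero    a = refl
iterate-id {A} (suc k) a = iterate-id {A} k a

module _ (G : Species₂) where
  private
    module G = Species₂ G

  -- Keeping σ itself in place of a standard permutation lets χ be defined without choosing a cycle
  -- type for σ.
  fixed₂ : List ℕ → ∀ {n} → Permutation′ n → ℕ
  fixed₂ κ {n} σ = fixedPoints (G.ob [ sum κ ] [ n ]) (G.mor {[ sum κ ]} {[ sum κ ]} {[ n ]} {[ n ]} (standard κ) σ)

  mor-exchange : ∀ {A A′ B B′} (f : A ≃ A′) (g : B ≃ B′) t →
    Inverse.to (G.mor {A} {A′} {B′} {B′} f (↔-id _)) (Inverse.to (G.mor {A} {A} {B} {B′} (↔-id _) g) t) ≡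
    Inverse.to (G.mor {A} {A′} {B} {B′} f g) t
  mor-exchange {A} {A′} {B} {B′} f g t = trans
    (sym (G.mor-∘ {A} {A} {A′} {B} {B′} {B′} f (↔-id _) (↔-id _) g t))
    (G.mor-cong {A} {A′} {B} {B′} (λ _ → refl) (λ _ → refl) t)

  mor-exchange′ : ∀ {A A′ B B′} (f : A ≃ A′) (g : B ≃ B′) t →
    Inverse.to (G.mor {A′} {A′} {B} {B′} (↔-id _) g) (Inverse.to (G.mor {A} {A′} {B} {B} f (↔-id _)) t) ≡
    Inverse.to (G.mor {A} {A′} {B} {B′} f g) t
  mor-exchange′ {A} {A′} {B} {B′} f g t = trans
    (sym (G.mor-∘ {A} {A′} {A′} {B} {B} {B′} (↔-id _) f g (↔-id _) t))
    (G.mor-cong {A} {A′} {B} {B′} (λ _ → refl) (λ _ → refl) t)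

fixed₂-conjugate : ∀ (G : Species₂) {m n} κ (ρ : Permutation m n) (σ : Permutation′ m) (σ′ : Permutation′ n) →
  Intertwines ρ σ σ′ → ι (fixed₂ G κ σ) ≡ ι (fixed₂ G κ σ′)
fixed₂-conjugate G {m} {n} κ ρ σ σ′ eq = fixedPoints-conjugate (G.ob K [ m ]) (G.ob K [ n ])
  (G.mor {K} {K} {[ m ]} {[ n ]} (↔-id _) ρ)
  (G.mor {K} {K} {[ m ]} {[ m ]} (standard κ) σ) (G.mor {K} {K} {[ n ]} {[ n ]} (standard κ) σ′) λ t → trans
    (sym (G.mor-∘ {K} {K} {K} {[ m ]} {[ m ]} {[ n ]} (↔-id _) (standard κ) ρ σ t))
    (trans (G.mor-cong {K} {K} {[ m ]} {[ n ]} (λ _ → refl) eq t)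
           (G.mor-∘ {K} {K} {K} {[ m ]} {[ n ]} {[ n ]} (standard κ) (↔-id _) σ′ ρ t))
  where
  module G = Species₂ G
  K = [ sum κ ]

module Characteristic (G : Species₂) (n : ℕ) where
  private
    module G = Species₂ G

  -- Since p_κ is homogeneous of degree |κ|, only partitions of the degree of α contribute at α, and
  -- the infinite sum over partitions is finite in each coefficient.
  χ : Permutation′ n → Series
  χ σ = record
    { coeff    = λ α → Σˡ-partitions (λ κ → ι (fixed₂ G κ σ) * coeff (powerSumₚ κ) α) (sum α)
    ; coherent = λ α → trans
        (cong (Σˡ-partitions (λ κ → ι (fixed₂ G κ σ) * coeff (powerSumₚ κ) (α ∷ʳ 0))) (sum-∷ʳ0 α))
        (Σˡ-cong (partitionsOf (sum α)) (λ κ → cong (λ c → 1/z κ * (ι (fixed₂ G κ σ) * c)) (coherent (powerSumₚ κ) α)))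
    }

  χ-class : IsClassFunction χ
  χ-class σ σ′ ρ eq α = Σˡ-cong (partitionsOf (sum α)) λ κ →
    cong (λ q → 1/z κ * (q * coeff (powerSumₚ κ) α)) (fixed₂-conjugate G κ ρ σ σ′ eq)

  χ-symmetric : ∀ σ → Symmetric (χ σ)
  χ-symmetric σ {α} {β} p = trans
    (cong (Σˡ-partitions (λ κ → ι (fixed₂ G κ σ) * coeff (powerSumₚ κ) α)) (sum-↭ p))
    (Σˡ-cong (partitionsOf (sum β)) (λ κ → cong (λ c → 1/z κ * (ι (fixed₂ G κ σ) * c)) (powerSumₚ-symmetric κ p)))

  χ-fix : ∀ σ → Fix G σ HasSum χ σ
  χ-fix σ α = hasSumAt-≡ {Fix G σ} {α} value
    (FixedOrbits.fixed-hasSumAt (sectionY G [ n ]) (weightedSet ℙₓ) ℕ._≟_ ⇒-id ε natural x-powers (λ _ → Σx) iterates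
      -- Every label of a structure has degree 1, so α occurs only in arity equal to its degree.
      α (sum α ∷ []) ([] ∷ []) (λ m (t , f) c≢0 → here (sym (∏-degree f α c≢0))))
    where
    ε : ∀ m → G.ob [ m ] [ n ] ≃ G.ob [ m ] [ n ]
    ε m = G.mor {[ m ]} {[ m ]} {[ n ]} {[ n ]} (↔-id _) σ
    natural : ∀ {m m′} (θ : Permutation m m′) t →
      Inverse.to (G.mor {[ m ]} {[ m′ ]} {[ n ]} {[ n ]} θ (↔-id _)) (Inverse.to (ε m) t) ≡
      Inverse.to (ε m′) (Inverse.to (G.mor {[ m ]} {[ m′ ]} {[ n ]} {[ n ]} θ (↔-id _)) t)
    natural {m} {m′} θ t = trans (mor-exchange G {A = [ m ]} {[ m′ ]} {[ n ]} {[ n ]} θ σ t) (sym (mor-exchange′ G {A = [ m ]} {[ m′ ]} {[ n ]} {[ n ]} θ σ t))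
    iterates : ∀ k → Fixed (iterate (⇒-id {weightedSet ℙₓ}) k) HasSum Σx
    iterates k = hasSum-transport {weightedSet ℙₓ} {Fixed (iterate (⇒-id {weightedSet ℙₓ}) k)} (record
      { to         = λ j → j , iterate-id {weightedSet ℙₓ} k j
      ; to-cong    = id
      ; injective  = id
      ; surjective = λ (j , _) → j , refl
      ; preserves  = λ _ _ → refl
      }) {Σx} (SetsR.hasTotal ℙₓ)
    -- The trailing 0ℚ ends the sum over the one-element list of arities.
    value : Σˡ-partitions (λ κ → ι (fixedPoints (G.ob [ sum κ ] [ n ]) (G.mor {[ sum κ ]} {[ sum κ ]} {[ n ]} {[ n ]} (standard κ) (↔-id _) ↔-∘ ε (sum κ)))
                               * coeff (productₛ (map (λ k → dilate k Σx) κ)) α) (sum α) + 0ℚ ≡ coeff (χ σ) α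
    value = trans (ℚ.+-identityʳ _) (Σˡ-cong (partitionsOf (sum α)) λ κ →
      cong (λ q → 1/z κ * (q * coeff (powerSumₚ κ) α)) (fixedPoints-conjugate (G.ob [ sum κ ] [ n ]) (G.ob [ sum κ ] [ n ]) (↔-id _)
        (G.mor {[ sum κ ]} {[ sum κ ]} {[ n ]} {[ n ]} (standard κ) (↔-id _) ↔-∘ ε (sum κ)) (G.mor {[ sum κ ]} {[ sum κ ]} {[ n ]} {[ n ]} (standard κ) σ)
        (mor-exchange G {A = [ sum κ ]} {[ sum κ ]} {[ n ]} {[ n ]} (standard κ) σ)))

  -- The family is indexed by decreasing lists under equality, while `partitionsOf` is complete only
  -- up to permutation; decreasing lists that are permutations of each other coincide. The bijection
  -- θ replaces `standard μ` by σ in the fixed point counts.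
  χ-frobenius : ∀ σ μ → HasCycleType σ μ → frobenius G μ HasSum χ σ
  χ-frobenius σ (μ , μ-partition) (θ , conjugates) α = κs , κs-unique , supported , value
    where
    open ≡-Reasoning
    sound : All IsPartition (partitionsOf (sum α))
    sound = All.map (λ κ-part → let open IsPartitionUpTo κ-part in linked , All.map proj₁ bounds) (partitionsOf-sound (sum α))
    κs : List Partition
    κs = All.reduce (λ {κ} κ-partition → κ , κ-partition) sound
    parts-reduce : ∀ {κs} (ps : All IsPartition κs) → map parts (All.reduce (λ {κ} κ-partition → κ , κ-partition) ps) ≡ κs
    parts-reduce []       = refl
    parts-reduce (p ∷ ps) = cong (_ ∷_) (parts-reduce ps)
    κs-unique : SetoidUnique.Unique (On.setoid (≡.setoid (List ℕ)) parts) κs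
    κs-unique = AllPairs.map⁻ (subst (AllPairs _≢_) (sym (parts-reduce sound))
      (AllPairs.map (λ { ¬↭ refl → ¬↭ ↭-refl }) (partitionsOf-unique (sum α))))
    supported : ∀ κ → coeff (frobeniusTerm G μ (parts κ)) α ≢ 0ℚ → SetoidMembership._∈_ (On.setoid (≡.setoid (List ℕ)) parts) κ κs
    supported (κ , κ-linked , κ-positive) c≢0 = Any.map⁻ (subst (κ ∈_) (sym (parts-reduce sound))
      (identify (partitionsOf-complete κ κ-positive (sym (powerSumₚ-degree κ α
        (λ c≡0 → c≢0 (trans (cong (fix₂ G κ μ /z κ *_) c≡0) (ℚ.*-zeroʳ (fix₂ G κ μ /z κ))))))) sound))
      where
      identify : ∀ {κs} → Any (κ ↭_) κs → All IsPartition κs → κ ∈ κs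
      identify (here p)  ((κ′-linked , _) ∷ _) = here (sorted-↭⇒≡ κ-linked κ′-linked p)
      identify (there q) (_ ∷ ps)              = there (identify q ps)
    value : coeff (χ σ) α ≡ Σˡ κs (λ κ → coeff (frobeniusTerm G μ (parts κ)) α)
    value = begin
      Σˡ (partitionsOf (sum α)) (λ κ → 1/z κ * (ι (fixed₂ G κ σ) * coeff (powerSumₚ κ) α))
        ≡⟨ Σˡ-cong (partitionsOf (sum α)) (λ κ → trans (sym (ℚ.*-assoc (1/z κ) (ι (fixed₂ G κ σ)) (coeff (powerSumₚ κ) α)))
             (cong (_* coeff (powerSumₚ κ) α) (trans (ℚ.*-comm (1/z κ) (ι (fixed₂ G κ σ)))
               (trans (cong (_* 1/z κ) (sym (fixed₂-conjugate G κ θ (standard μ) σ conjugates))) (sym (/z-as-* (fix₂ G κ μ) κ)))))) ⟩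
      Σˡ (partitionsOf (sum α)) (λ κ → coeff (frobeniusTerm G μ κ) α)
        ≡⟨ cong (λ ks → Σˡ ks (λ κ → coeff (frobeniusTerm G μ κ) α)) (parts-reduce sound) ⟨
      Σˡ (map parts κs) (λ κ → coeff (frobeniusTerm G μ κ) α)
        ≡⟨ Σˡ-map parts κs (λ κ → coeff (frobeniusTerm G μ κ) α) ⟩
      Σˡ κs (λ κ → coeff (frobeniusTerm G μ (parts κ)) α) ∎

-- Inner plethysm

coeff-⟦⟧ : ∀ {n} (f : PowerSumPolynomial) (χ : Permutation′ n → Series) σ α →
  coeff ((f ⟦ χ ⟧) σ) α ≡ Σˡ f (λ (c , κ) → c * coeff (productₛ (map (λ k → ψ k χ σ) κ)) α)
coeff-⟦⟧ []      χ σ α = refl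
coeff-⟦⟧ ((c , κ) ∷ f) χ σ α = cong (c * coeff (productₛ (map (λ k → ψ k χ σ) κ)) α +_) (coeff-⟦⟧ f χ σ α)

module _ (F : Species₁) (finite : StrictlyFinite F) (G : Species₂) {n : ℕ} (σ : Permutation′ n) where
  private
    module G = Species₂ G
    W = analytic₂ G (weightedSet ℙₓ) [ n ]
    module W≈ = Setoid (WeightedSet.setoid W)
    N = proj₁ finite
  open Characteristic G n using (χ; χ-fix)

  relabel : Permutation′ n → W ⇒ W
  relabel τ = analytic₂-map G {weightedSet ℙₓ} {weightedSet ℙₓ} {[ n ]} {[ n ]} ⇒-id τ

  relabel-^ₚ : ∀ k s → _⇒_.to (relabel (σ ^ₚ k)) s W≈.≈ _⇒_.to (iterate (relabel σ) k) s
  relabel-^ₚ zero    (m , t , f) = W≈.reflexive (cong (λ u → m , u , f) (G.mor-id {[ m ]} {[ n ]} t))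
  relabel-^ₚ (suc k) (m , t , f) = W≈.trans
    (W≈.reflexive (cong (λ u → m , u , f) (trans
      (G.mor-cong {[ m ]} {[ m ]} {[ n ]} {[ n ]} (λ _ → refl) (λ _ → refl) t)
      (G.mor-∘ {[ m ]} {[ m ]} {[ m ]} {[ n ]} {[ n ]} {[ n ]} (↔-id _) (↔-id _) σ (σ ^ₚ k) t))))
    (_⇒_.to-cong (relabel σ) (relabel-^ₚ k (m , t , f)))

  relabel-iterates : ∀ k → Fixed (iterate (relabel σ) k) HasSum χ (σ ^ₚ k)
  relabel-iterates k = hasSum-transport
    (Fixed-cong {e = relabel (σ ^ₚ k)} {iterate (relabel σ) k} (relabel-^ₚ k)) {χ (σ ^ₚ k)} (χ-fix (σ ^ₚ k))

  plethysm-hasSum : Fixed (analytic₁-map F (relabel σ)) HasSum (Z F finite ⟦ χ ⟧) σ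
  plethysm-hasSum α = hasSumAt-≡ {Fixed (analytic₁-map F (relabel σ))} {α} value
    (FixedOrbits.fixed-hasSumAt F W (Orbits._∼?_ (sectionY G [ n ]) (weightedSet ℙₓ) ℕ._≟_) (relabel σ)
      (λ _ → ↔-id _) (λ _ _ → refl) (λ (m , t , f) → ∏-powers (x ∘ f) (x-powers ∘ f)) (λ k → χ (σ ^ₚ k)) relabel-iterates
      -- Labels of degree 0 are possible here, so the arity is bounded by the vanishing of F from N
      -- on.
      α (upTo N) (Unique.upTo⁺ N) (λ m (t , _) _ → Membership.∈-upTo⁺ (ℕ.≰⇒> (λ N≤m → proj₂ finite m N≤m t))))
    where
    open ≡-Reasoning
    partitions = concatMap partitionsOf (upTo N)
    C : List ℕ → ℚ
    C κ = coeff (productₛ (map (λ k → ψ k χ σ) κ)) α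
    value : Σˡ (upTo N) (Σˡ-partitions (λ κ → ι (fix₁ F κ) * C κ)) ≡ coeff ((Z F finite ⟦ χ ⟧) σ) α
    value = begin
      Σˡ (upTo N) (λ m → Σˡ (partitionsOf m) (λ κ → 1/z κ * (ι (fix₁ F κ) * C κ)))
        ≡⟨ Σˡ-concatMap partitionsOf (upTo N) (λ κ → 1/z κ * (ι (fix₁ F κ) * C κ)) ⟨
      Σˡ partitions (λ κ → 1/z κ * (ι (fix₁ F κ) * C κ))
        ≡⟨ Σˡ-cong partitions (λ κ → trans (sym (ℚ.*-assoc (1/z κ) (ι (fix₁ F κ)) (C κ)))
             (cong (_* C κ) (trans (ℚ.*-comm (1/z κ) (ι (fix₁ F κ))) (sym (/z-as-* (fix₁ F κ) κ))))) ⟩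
      Σˡ partitions (λ κ → fix₁ F κ /z κ * C κ)
        ≡⟨ Σˡ-map (λ κ → fix₁ F κ /z κ , κ) partitions (λ (c , κ) → c * C κ) ⟨
      Σˡ (Z F finite) (λ (c , κ) → c * C κ)
        ≡⟨ coeff-⟦⟧ (Z F finite) χ σ α ⟨
      coeff ((Z F finite ⟦ χ ⟧) σ) α ∎

  -- Naturality at the identity of `ℙₓ` and at σ says that the isomorphism intertwines the two
  -- actions of σ, hence it matches their fixed points along with the weights.
  Fix-innerPlethysm : ∀ {H} → IsInnerPlethysm F G H → Correspondence (Fixed (analytic₁-map F (relabel σ))) (Fix H σ)
  Fix-innerPlethysm {H} plethysm = record
    { to         = λ (s , fixed) → iso.from s , injective (FW≈.trans (natural (iso.from s))
                     (FW≈.trans (_⇒_.to-cong (analytic₁-map F (relabel σ)) (to-from s)) (FW≈.trans fixed (FW≈.sym (to-from s)))))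
    ; to-cong    = iso.from-cong
    ; injective  = λ {(s , _)} {(s′ , _)} p → FW≈.trans (FW≈.sym (to-from s)) (FW≈.trans (iso.to-cong p) (to-from s′))
    ; surjective = λ (h , fixed) → (iso.to h , FW≈.trans (FW≈.sym (natural h)) (iso.to-cong fixed)) , iso.inverseʳ FW≈.refl
    ; preserves  = λ (s , _) α → trans (sym (preserves (iso.from s) α)) (WeightedSet.weight-cong (analytic₁ F W) (to-from s) α)
    }
    where
    open _≅_ (IsInnerPlethysm.iso plethysm ℙₓ [ n ]) using (inverse; preserves)
    module iso = Inverse inverse
    module HA≈ = Setoid (WeightedSet.setoid (analytic₂ H (weightedSet ℙₓ) [ n ]))
    module FW≈ = Setoid (WeightedSet.setoid (analytic₁ F W))
    natural : ∀ s → iso.to (_⇒_.to (analytic₂-map H {weightedSet ℙₓ} {weightedSet ℙₓ} {[ n ]} {[ n ]} ⇒-id σ) s) FW≈.≈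
                    _⇒_.to (analytic₁-map F (relabel σ)) (iso.to s)
    natural = IsInnerPlethysm.natural plethysm ℙₓ ℙₓ [ n ] [ n ] ⇒-id σ
    to-from : ∀ s → iso.to (iso.from s) FW≈.≈ s
    to-from s = iso.inverseˡ HA≈.refl
    injective : ∀ {h h′} → iso.to h FW≈.≈ iso.to h′ → h HA≈.≈ h′
    injective {h} {h′} p = HA≈.trans (HA≈.sym (iso.inverseʳ FW≈.refl)) (HA≈.trans (iso.from-cong p) (iso.inverseʳ FW≈.refl))

lemma2p20 : (F : Species₁) (finite : StrictlyFinite F) (G H : Species₂) → IsInnerPlethysm F G H → (n : ℕ) →
    Σ[ χ ∈ (Permutation′ n → Series) ]
        (IsClassFunction χ × (∀ σ → Symmetric (χ σ)))
      × (∀ σ → Fix G σ HasSum χ σ)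
      × (∀ σ μ → HasCycleType σ μ → frobenius G μ HasSum χ σ)
      × (∀ σ → Fix H σ HasSum (Z F finite ⟦ χ ⟧) σ)
lemma2p20 F finite G H plethysm n = χ , (χ-class , χ-symmetric) , χ-fix , χ-frobenius , λ σ →
  hasSum-transport (Fix-innerPlethysm F finite G σ plethysm) {(Z F finite ⟦ χ ⟧) σ} (plethysm-hasSum F finite G σ)
  where open Characteristic G n
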